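{- Let $S$ be a finite set of places of $\mathbb{Q}$ containing the archimedean place, and let $\varphi(z)=z^2$. Let $\alpha,\beta\in\mathbb{Q}$ with $\alpha,\beta$ both non-preperiodic for $\varphi$. Then $$\left|\{n\geq 0\mid \varphi^n(\alpha)\text{ is }S\text{ -integral relative to }\beta\}\right|\leq 3|S|+12\log_2|S|+50.$$
   Context: Two points $x,y\in\mathbb{P}^1(\mathbb{Q})$ are $S$-integral relative to each other if for every prime $p\notin S$ their reductions in $\mathbb{P}^1(\mathbb{F}_p)$ are distinct. A point is preperiodic for $z^2$ if its forward orbit is finite (for rationals: $0,\pm1$). -}

module Defs where

open import Data.Nat as ℕ using (ℕ; suc; _≤_; _^_)
open import Data.Nat.Primality using (Prime)
open import Data.Nat.Logarithm using (⌊log₂_⌋)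
open import Data.Integer as ℤ using (ℤ; +_)
open import Data.Integer.Divisibility using () renaming (_∣_ to _∣ℤ_)
open import Data.Rational as ℚ using (ℚ; ↥_; ↧_)
open import Data.List using (List; length)
open import Data.List.Membership.Propositional using (_∈_)
open import Data.List.Relation.Unary.All using (All)
open import Data.List.Relation.Unary.Unique.Propositional using (Unique)
open import Data.Product using (Σ; _×_)
open import Function using (_∘_)
open import Relation.Nullary using (¬_)
open import Relation.Binary.PropositionalEquality using (_≡_; _≢_)

φ : ℚ → ℚ
φ z = z ℚ.* z

φ^ : ℕ → ℚ → ℚ
φ^ ℕ.zero    z = z
φ^ (suc n) z = φ (φ^ n z)

Preperiodic : ℚ → Set
Preperiodic x = Σ ℕ λ i → Σ ℕ λ j → i ≢ j × φ^ i x ≡ φ^ j x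

-- A rational x = a/b (lowest terms, b > 0) is the point [a : b] ∈ ℙ¹(ℚ) with
-- coprime integer coordinates; its reduction mod p is [a mod p : b mod p] ∈ ℙ¹(𝔽ₚ).
-- Two points [a:b], [c:d] of ℙ¹(𝔽ₚ) are equal iff a·d ≡ c·b (mod p).
SameReduction : ℕ → ℚ → ℚ → Set
SameReduction p x y = (+ p) ∣ℤ ((↥ x) ℤ.* (↧ y) ℤ.- (↥ y) ℤ.* (↧ x))

-- S is given by the list of its finite places (distinct primes); the archimedean
-- place is always included, so |S| = 1 + (number of finite places).
record PlaceSet : Set where
  field
    finitePlaces : List ℕ
    allPrime     : All Prime finitePlaces
    distinct     : Unique finitePlaces

card : PlaceSet → ℕ
card S = suc (length (PlaceSet.finitePlaces S))

SIntegral : PlaceSet → ℚ → ℚ → Set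
SIntegral S x y = (p : ℕ) → Prime p → ¬ (p ∈ PlaceSet.finitePlaces S) → ¬ SameReduction p x y

-- The bound 3|S| + 12 log₂|S| + 50, rounded down (exact for an integer count):
-- ⌊12 log₂ s⌋ = ⌊log₂ (s¹²)⌋.
bound : ℕ → ℕ
bound s = 3 ℕ.* s ℕ.+ ⌊log₂ (s ^ 12) ⌋ ℕ.+ 50

{-# OPTIONS --safe #-}
module Submission where

-- Write α = a / b and β = c / d, so that ξ n = a ^ (2 ^ n) * d - c * b ^ (2 ^ n) has only primes of S.
-- Archimedean size: apart from n = 0 and at most two further n, |ξ n| is about as large as the
-- heights X n = H(α) ^ (2 ^ n) and T = H(β) allow, hence some p ∈ S contributes p ^ K ∣ ξ n with
-- (p ^ K) ^ |S| ≥ |ξ n|.  It remains to bound the n dominated by one p.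
-- * If X n is much smaller than T there is at most one: p ^ K would divide
--   a ^ (2 ^ m) * b ^ (2 ^ n) - a ^ (2 ^ n) * b ^ (2 ^ m) for two of them.
-- * If X n ≥ T ^ (2 ^ E) with 2 ^ E a power of |S| there are at most two.  For n₁ < n₂ < n₃ the
--   rationals x = α ^ (2 ^ (n₂ - k)) and w = α ^ (2 ^ (n₃ - k)) are p-adically close to the same
--   2 ^ k-th root of β (n₁ excludes different roots).  This contradicts the Thue–Siegel principle:
--   divided differences of e ↦ s ^ e over the nodes e = r i + j, where r = 2 ^ k and j < 8 · 2 ^ t,
--   are sparse polynomials in s vanishing to high order at s = 1.  Replacing s ^ r by
--   β / α ^ (2 ^ n₂) and s by w / x gives a nonzero rational of small height that is divisible by
--   a large power of p.
-- * The remaining n lie in an interval of length O(log |S|).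

open import Defs
open import Data.Empty using (⊥; ⊥-elim)
open import Data.Integer as ℤ using ()
open import Data.Integer.Properties as ℤ using ()
open import Data.List using (List; []; _∷_; length)
open import Data.List.Membership.Propositional using (_∈_)
open import Data.List.Relation.Unary.All as All using (All; []; _∷_)
open import Data.List.Relation.Unary.All.Properties as All using ()
open import Data.List.Relation.Unary.AllPairs using ([]; _∷_)
open import Data.List.Relation.Unary.Any using (here; there)
open import Data.List.Relation.Unary.Unique.Propositional using (Unique)
open import Data.Nat as ℕ using (ℕ; zero; suc; _≤_)
open import Data.Nat.Coprimality as Coprimality using (Coprime)
open import Data.Nat.Divisibility as ℕ using ()
open import Data.Nat.DivMod as ℕ using ()
open import Data.Nat.Primality using (Prime)
open import Data.Nat.Properties as ℕ using ()
open import Data.Product using (∃; ∃₂; _×_; _,_; proj₁; proj₂)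
open import Data.Rational using (ℚ)
open import Data.Sum using (_⊎_; inj₁; inj₂; [_,_]′)
open import Relation.Binary.Definitions using (DecidableEquality; tri<; tri≈; tri>)
open import Relation.Binary.PropositionalEquality hiding (J)
open import Relation.Nullary using (Dec; yes; no; ¬_)

-- The gap `n₃ - n₂` has no upper bound, and this shapes the construction. The degree in s grows
-- with the gap, so coefficients of factorial size would outgrow X n₂ ^ (c L) for every fixed c,
-- where L is the number of rows of nodes. A small common multiple of the node differences keeps
-- them exponential in L. A node r i + j costs i copies of β / α ^ (2 ^ n₂), of height at most T · X
-- n₂, and fewer than 8 · 2 ^ t copies of w / x; using s = w / x throughout would cost r times as
-- many. Nonvanishing comes from varying one last node: if all divided differences were 0, the
-- interpolation polynomial f would satisfy V f(x + r) = U f(x) with U ≠ V, which only f = 0 does.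
-- With q = 2 ^ t there are D = 8 q L nodes, and the value is divisible by a power of p at least X
-- n₂ ^ (8 L), while its size is at most X n₂ ^ (5 L): one L for the constants, two for the powers
-- of β / α ^ (2 ^ n₂), two for those of w / x. Exponents are powers of two so that D = 2 ^ (n₃ -
-- n₂), which gives both sources of p-divisibility the same lower bound.

module Counting where

  -- Counting by duplicate-free lists.

  open import Data.Nat
  open import Data.Nat.Properties

  -- Quantifying over duplicate-free lists, as the theorem does, states the bound without deciding P
  -- or first proving that only finitely many numbers satisfy it.
  AtMost : ℕ → (ℕ → Set) → Set
  AtMost m P = ∀ {xs} → Unique xs → All P xs → length xs ≤ m

  record Split (P Q : ℕ → Set) (xs : List ℕ) : Set where
    constructor split
    field
      {ys zs}  : List ℕ
      lengths  : length xs ≡ length ys + length zs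
      uniqueˡ  : Unique ys
      uniqueʳ  : Unique zs
      allˡ     : All P ys
      allʳ     : All Q zs
      ≢-xs     : ∀ {y} → All (y ≢_) xs → All (y ≢_) ys × All (y ≢_) zs

  splitAll : ∀ {P Q xs} → Unique xs → All (λ n → P n ⊎ Q n) xs → Split P Q xs
  splitAll [] [] = split refl [] [] [] [] (λ _ → [] , [])
  splitAll (x∉ ∷ u) (p ∷ ps) with splitAll u ps
  splitAll (x∉ ∷ u) (inj₁ p ∷ ps) | split e uˡ uʳ aˡ aʳ sub = let x∉ys , _ = sub x∉ in
    split (cong suc e) (x∉ys ∷ uˡ) uʳ (p ∷ aˡ) aʳ
      (λ { (r ∷ rs) → let rˡ , rʳ = sub rs in (r ∷ rˡ) , rʳ })
  splitAll (x∉ ∷ u) (inj₂ q ∷ ps) | split {ys} {zs} e uˡ uʳ aˡ aʳ sub = let _ , x∉zs = sub x∉ in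
    split (trans (cong suc e) (sym (+-suc (length ys) (length zs)))) uˡ (x∉zs ∷ uʳ) aˡ (q ∷ aʳ)
      (λ { (r ∷ rs) → let rˡ , rʳ = sub rs in rˡ , (r ∷ rʳ) })

  atMost-⊎ : ∀ {m n P Q} → AtMost m P → AtMost n Q → AtMost (m + n) (λ x → P x ⊎ Q x)
  atMost-⊎ {m} {n} p q u a with splitAll u a
  ... | split e uˡ uʳ aˡ aʳ _ = subst (_≤ m + n) (sym e) (+-mono-≤ (p uˡ aˡ) (q uʳ aʳ))

  atMost-map : ∀ {m} {P Q : ℕ → Set} → (∀ {x} → Q x → P x) → AtMost m P → AtMost m Q
  atMost-map f p u a = p u (All.map f a)

  atMost-0 : ∀ {P : ℕ → Set} → (∀ {x} → P x → ⊥) → AtMost 0 P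
  atMost-0 absurd {[]} u a = z≤n
  atMost-0 absurd {x ∷ xs} u (p ∷ _) = ⊥-elim (absurd p)

  atMost-1 : ∀ {P : ℕ → Set} → (∀ {x y} → P x → P y → x < y → ⊥) → AtMost 1 P
  atMost-1 absurd {[]} u a = z≤n
  atMost-1 absurd {x ∷ []} u a = s≤s z≤n
  atMost-1 absurd {x ∷ y ∷ xs} ((x≢y ∷ _) ∷ u) (px ∷ py ∷ _) with <-cmp x y
  ... | tri< x<y _ _ = ⊥-elim (absurd px py x<y)
  ... | tri≈ _ x≡y _ = ⊥-elim (x≢y x≡y)
  ... | tri> _ _ y<x = ⊥-elim (absurd py px y<x)

  atMost-2 : ∀ {P : ℕ → Set} → (∀ {x y z} → P x → P y → P z → x < y → y < z → ⊥) → AtMost 2 P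
  atMost-2 absurd {[]} u a = z≤n
  atMost-2 absurd {x ∷ []} u a = s≤s z≤n
  atMost-2 absurd {x ∷ y ∷ []} u a = s≤s (s≤s z≤n)
  atMost-2 absurd {x ∷ y ∷ z ∷ xs} ((x≢y ∷ x≢z ∷ _) ∷ (y≢z ∷ _) ∷ u) (px ∷ py ∷ pz ∷ _)
    with <-cmp x y | <-cmp y z | <-cmp x z
  ... | tri≈ _ e _ | _          | _          = ⊥-elim (x≢y e)
  ... | _          | tri≈ _ e _ | _          = ⊥-elim (y≢z e)
  ... | _          | _          | tri≈ _ e _ = ⊥-elim (x≢z e)
  ... | tri< a _ _ | tri< b _ _ | _          = ⊥-elim (absurd px py pz a b)
  ... | tri< a _ _ | tri> _ _ b | tri< c _ _ = ⊥-elim (absurd px pz py c b)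
  ... | tri< a _ _ | tri> _ _ b | tri> _ _ c = ⊥-elim (absurd pz px py c a)
  ... | tri> _ _ a | tri< b _ _ | tri< c _ _ = ⊥-elim (absurd py px pz a c)
  ... | tri> _ _ a | tri< b _ _ | tri> _ _ c = ⊥-elim (absurd py pz px b c)
  ... | tri> _ _ a | tri> _ _ b | _          = ⊥-elim (absurd pz py px b a)

  atMost-interval : ∀ lo len → AtMost len (λ n → lo ≤ n × n < lo + len)
  atMost-interval lo zero = atMost-0 λ (lo≤ , <lo) → <⇒≱ (subst (_ <_) (+-identityʳ lo) <lo) lo≤
  atMost-interval lo (suc len) = atMost-map cases
    (atMost-⊎ (atMost-1 λ { refl refl → <-irrefl refl }) (atMost-interval (suc lo) len))
    where
    cases : ∀ {n} → lo ≤ n × n < lo + suc len → lo ≡ n ⊎ (suc lo ≤ n × n < suc lo + len)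
    cases {n} (lo≤n , n<) with m≤n⇒m<n∨m≡n lo≤n
    ... | inj₁ lo<n = inj₂ (lo<n , subst (n <_) (+-suc lo len) n<)
    ... | inj₂ eq = inj₁ eq

  atMost-∈ : ∀ {m} {R : ℕ → ℕ → Set} → (∀ p → AtMost m (R p)) →
             ∀ ps → AtMost (length ps * m) (λ n → ∃ λ p → p ∈ ps × R p n)
  atMost-∈ h [] = atMost-0 λ { (_ , () , _) }
  atMost-∈ {m} {R} h (p ∷ ps) = atMost-map cases (atMost-⊎ (h p) (atMost-∈ h ps))
    where
    cases : ∀ {n} → (∃ λ p′ → p′ ∈ p ∷ ps × R p′ n) → R p n ⊎ (∃ λ p′ → p′ ∈ ps × R p′ n)
    cases (_ , here refl , r) = inj₁ r
    cases (p′ , there p∈ , r) = inj₂ (p′ , p∈ , r)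

-- A common multiple of 1, ..., m of size exponential in m.

module Lcm where

  open import Data.Nat
  open import Data.Nat.Properties
  open import Data.Nat.Divisibility
  open import Data.Nat.Primality
  open import Data.Nat.Coprimality using (coprime-divisor)
  open import Data.Nat.Induction using (<-rec)
  open import Data.Nat.Tactic.RingSolver using (solve-∀)
  open import Data.Nat.Primality.Factorisation using (factorise)
  open import Data.Nat.ListAction using (product)

  choose : ℕ → ℕ → ℕ
  choose n zero = 1
  choose zero (suc k) = 0
  choose (suc n) (suc k) = choose n k + choose n (suc k)

  choose-> : ∀ {n k} → n < k → choose n k ≡ 0
  choose-> {zero} {suc k} _ = refl
  choose-> {suc n} {suc k} (s≤s n<k) =
    cong₂ _+_ (choose-> n<k) (choose-> (m<n⇒m<1+n n<k))

  choose≤2^ : ∀ n k → choose n k ≤ 2 ^ n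
  choose≤2^ n zero = m^n>0 2 n
  choose≤2^ zero (suc k) = z≤n
  choose≤2^ (suc n) (suc k) = +-mono-≤ (choose≤2^ n k)
    (≤-trans (choose≤2^ n (suc k)) (≤-reflexive (sym (+-identityʳ (2 ^ n)))))

  choose-nn : ∀ n → choose n n ≡ 1
  choose-nn zero = refl
  choose-nn (suc n) = cong₂ _+_ (choose-nn n) (choose-> (n<1+n n))

  choose>0 : ∀ {n k} → k ≤ n → 0 < choose n k
  choose>0 {n} {zero} _ = s≤s z≤n
  choose>0 {suc n} {suc k} (s≤s k≤n) = <-≤-trans (choose>0 k≤n) (m≤m+n _ _)

  absorption : ∀ n k → suc k * choose (suc n) (suc k) ≡ suc n * choose n k
  absorption n zero = trans (*-identityˡ (suc (choose n 1))) (trans (cong suc (choose-1 n)) (sym (*-identityʳ (suc n))))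
    where
    choose-1 : ∀ n → choose n 1 ≡ n
    choose-1 zero = refl
    choose-1 (suc n) = cong suc (choose-1 n)
  absorption zero (suc k) = *-zeroʳ (suc (suc k))
  absorption (suc n) (suc k) = begin
    suc (suc k) * (choose (suc n) (suc k) + choose (suc n) (suc (suc k)))
      ≡⟨ *-distribˡ-+ (suc (suc k)) (choose (suc n) (suc k)) _ ⟩
    suc (suc k) * choose (suc n) (suc k) + suc (suc k) * choose (suc n) (suc (suc k))
      ≡⟨ cong₂ _+_ (cong (choose (suc n) (suc k) +_) (absorption n k)) (absorption n (suc k)) ⟩
    (choose n k + choose n (suc k)) + suc n * choose n k + suc n * choose n (suc k)
      ≡⟨ alg (choose n k) (choose n (suc k)) n ⟩
    suc (suc n) * (choose n k + choose n (suc k)) ∎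
    where
    open ≡-Reasoning
    alg : ∀ a b n → (a + b) + suc n * a + suc n * b ≡ suc (suc n) * (a + b)
    alg = solve-∀

  prime∤⇒coprime : ∀ {p n} → Prime p → ¬ p ∣ n → Coprime p n
  prime∤⇒coprime {p} pr p∤n {d} (d∣p , d∣n) with prime⇒irreducible pr d∣p
  ... | inj₁ d≡1 = d≡1
  ... | inj₂ refl = ⊥-elim (p∤n d∣n)

  coprime-* : ∀ {m n o} → Coprime m o → Coprime n o → Coprime (m * n) o
  coprime-* {m} {n} c₁ c₂ {d} (d∣mn , d∣o) =
    c₂ (coprime-divisor (λ (e∣d , e∣m) → c₁ (e∣m , ∣-trans e∣d d∣o)) d∣mn , d∣o)

  coprime-^ : ∀ {m o} k → Coprime m o → Coprime (m ^ k) o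
  coprime-^ zero c = Coprimality.1-coprimeTo _
  coprime-^ {m} (suc k) c = coprime-* c (coprime-^ k c)

  -- If q did not divide the coefficient, q ^ a would be coprime to it, and the absorption identity
  -- would make q ^ a divide the smaller positive number m.
  q∣choose : ∀ {q} → Prime q → ∀ a {m} → 0 < m → m < q ^ a → q ∣ choose (q ^ a) m
  q∣choose {q} pr a {suc m} _ m<k with q ^ a in eq
  ... | suc n with q ∣? choose (suc n) (suc m)
  ...   | yes d = d
  ...   | no ∤ = ⊥-elim (<⇒≱ m<k (∣⇒≤ (coprime-divisor cop (subst (suc n ∣_) com (m∣m*n {suc n} (choose n m))))))
    where
    cop : Coprime (suc n) (choose (suc n) (suc m))
    cop = subst (λ z → Coprime z (choose (suc n) (suc m))) eq (coprime-^ a (prime∤⇒coprime pr ∤))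
    com : suc n * choose n m ≡ choose (suc n) (suc m) * suc m
    com = trans (sym (absorption n m)) (*-comm (suc m) _)

  -- Pascal's rule, started from the row q ^ a, whose inner entries are divisible by q.
  q∣choose-+ : ∀ {q} → Prime q → ∀ a n {m} → n < m → m < q ^ a → q ∣ choose (n + q ^ a) m
  q∣choose-+ pr a zero 0<m m<k = q∣choose pr a 0<m m<k
  q∣choose-+ {q} pr a (suc n) {suc m} (s≤s n<m) m<k =
    ∣m∣n⇒∣m+n (q∣choose-+ pr a n n<m (<-trans (n<1+n m) m<k))
              (q∣choose-+ pr a n (m<n⇒m<1+n n<m) m<k)

  primePart : ∀ {q} → Prime q → ∀ n → 0 < n → ∃₂ λ a v → n ≡ q ^ a * v × ¬ q ∣ v
  primePart {q} pr = <-rec _ step where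
    instance _ = prime⇒nonTrivial pr
    step : ∀ n → (∀ {m} → m < n → 0 < m → ∃₂ λ a v → m ≡ q ^ a * v × ¬ q ∣ v) →
           0 < n → ∃₂ λ a v → n ≡ q ^ a * v × ¬ q ∣ v
    step n rec 0<n with q ∣? n
    ... | no ∤ = 0 , n , sym (*-identityˡ n) , ∤
    ... | yes (divides zero refl) = ⊥-elim (<-irrefl refl 0<n)
    ... | yes (divides (suc m) refl) with rec (m<m*n (suc m) q (nonTrivial⇒n>1 q)) (s≤s z≤n)
    ...   | a , v , eq , ∤ = suc a , v ,
      trans (*-comm (suc m) q) (trans (cong (q *_) eq) (sym (*-assoc q (q ^ a) v))) , ∤

  coprime-∣-* : ∀ {u v n} → Coprime u v → u ∣ n → v ∣ n → u * v ∣ n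
  coprime-∣-* {u} {v} c (divides k refl) v∣n with coprime-divisor {v} {u} {k} (Coprimality.sym c) (subst (v ∣_) (*-comm k u) v∣n)
  ... | divides j refl = divides j (trans (*-assoc j v u) (cong (j *_) (*-comm v u)))

  primeFactor : ∀ n → 1 < n → ∃ λ q → Prime q × q ∣ n
  primeFactor n 1<n with factorise n {{>-nonZero (<-trans (s≤s z≤n) 1<n)}}
  ... | record { factors = [] ; isFactorisation = refl } = ⊥-elim (<-irrefl refl 1<n)
  ... | record { factors = q ∷ qs ; isFactorisation = refl ; factorsPrime = pr ∷ _ } = q , pr , m∣m*n (product qs)

  -- A multiple of 1, …, 2 ^ i of size only 4 ^ (2 ^ i): passing from m to 2 m, each prime power
  -- in (m , 2 m] is paid for by the central binomial coefficient.
  commonMultiple : ℕ → ℕ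
  commonMultiple zero = 1
  commonMultiple (suc i) = commonMultiple i * choose (2 ^ i + 2 ^ i) (2 ^ i)

  2^-suc : ∀ i → 2 ^ suc i ≡ 2 ^ i + 2 ^ i
  2^-suc i = cong (2 ^ i +_) (+-identityʳ (2 ^ i))

  ∣commonMultiple : ∀ i {k} → 0 < k → k ≤ 2 ^ i → k ∣ commonMultiple i
  ∣commonMultiple zero {suc zero} _ _ = ∣-refl
  ∣commonMultiple zero {suc (suc k)} _ (s≤s ())
  ∣commonMultiple (suc i) {k} 0<k k≤ with k ≤? 2 ^ i
  ... | yes k≤m = ∣m⇒∣m*n _ (∣commonMultiple i 0<k k≤m)
  ... | no k≰m with primeFactor k (≤-<-trans (m^n>0 2 i) (≰⇒> k≰m))
  ...   | q , pr , q∣k with primePart pr k 0<k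
  ...     | zero , v , refl , ∤ = ⊥-elim (∤ (subst (q ∣_) (+-identityʳ v) q∣k))
  ...     | suc a , zero , refl , ∤ = ⊥-elim (∤ (q ∣0))
  -- A prime power in (m , 2 m]: the binomial coefficient supplies one factor q, and the remaining
  -- `q ^ a` is at most m, so it divides the earlier multiple.
  ...     | suc a , suc zero , refl , ∤ =
    subst₂ _∣_ (sym (*-identityʳ (q * q ^ a))) (*-comm (choose (m + m) m) (commonMultiple i))
      (*-pres-∣ (subst (λ z → q ∣ choose z m) (m∸n+n≡m qa≤2m) (q∣choose-+ pr (suc a) (m + m ∸ q ^ suc a) lt m<qa))
                (∣commonMultiple i (m^n>0 q a) qa′≤m))
    where
    instance
      _ = prime⇒nonZero pr
      _ = prime⇒nonTrivial pr
    m = 2 ^ i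
    m<qa : m < q ^ suc a
    m<qa = subst (m <_) (*-identityʳ (q * q ^ a)) (≰⇒> k≰m)
    qa≤2m : q ^ suc a ≤ m + m
    qa≤2m = subst₂ _≤_ (*-identityʳ (q * q ^ a)) (2^-suc i) k≤
    lt : m + m ∸ q ^ suc a < m
    lt = +-cancelʳ-< (q ^ suc a) _ _ (subst (_< m + q ^ suc a) (sym (m∸n+n≡m qa≤2m)) (+-monoʳ-< m m<qa))
    qa′≤m : q ^ a ≤ m
    qa′≤m = *-cancelˡ-≤ 2 (≤-trans (*-monoˡ-≤ (q ^ a) (nonTrivial⇒n>1 q)) (subst (q ^ suc a ≤_) (sym (2^-suc i)) qa≤2m))
  -- Here k splits into two coprime factors, both at least 2, so each is at most `2 ^ i` and already
  -- divides the earlier multiple.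
  ...     | suc a , suc (suc v) , refl , ∤ =
    ∣m⇒∣m*n _ (coprime-∣-* (coprime-^ (suc a) (prime∤⇒coprime pr ∤))
      (∣commonMultiple i (m^n>0 q (suc a)) (half u (s≤s (s≤s z≤n)) k≤))
      (∣commonMultiple i (s≤s z≤n) (half w 1<u (subst (_≤ 2 ^ suc i) (*-comm u w) k≤))))
    where
    instance
      _ = prime⇒nonZero pr
      _ = prime⇒nonTrivial pr
    u = q ^ suc a
    w = suc (suc v)
    1<u : 1 < u
    1<u = ≤-trans (nonTrivial⇒n>1 q) (m≤m*n q (q ^ a) {{m^n≢0 q a}})
    half : ∀ x {y} → 1 < y → x * y ≤ 2 ^ suc i → x ≤ 2 ^ i
    half x {y} 1<y le = *-cancelˡ-≤ 2 (≤-trans (≤-trans (≤-reflexive (*-comm 2 x)) (*-monoʳ-≤ x 1<y)) le)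

  commonMultiple≤ : ∀ i → commonMultiple i ≤ 2 ^ (2 * 2 ^ i)
  commonMultiple≤ zero = s≤s z≤n
  commonMultiple≤ (suc i) = ≤-trans
    (*-mono-≤ (commonMultiple≤ i) (choose≤2^ (2 ^ i + 2 ^ i) (2 ^ i)))
    (≤-reflexive (trans (sym (^-distribˡ-+-* 2 (2 * 2 ^ i) _)) (cong (2 ^_) (alg (2 ^ i)))))
    where
    alg : ∀ m → 2 * m + (m + m) ≡ 2 * (2 * m)
    alg = solve-∀

  commonMultiple>0 : ∀ i → 0 < commonMultiple i
  commonMultiple>0 zero = s≤s z≤n
  commonMultiple>0 (suc i) = *-mono-≤ (commonMultiple>0 i) (choose>0 (m≤m+n (2 ^ i) _))

-- Integer polynomial functions: differences, roots, geometric recurrences.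

module Poly where

  open import Data.Integer using (ℤ; 0ℤ; _+_; _-_; _*_; -_)
  open import Data.Integer.Properties
  open import Data.Integer.Tactic.RingSolver using (solve-∀)
  open import Data.Product using (Σ)

  -- Polynomial functions of degree < n, in Horner form.
  Poly : ℕ → (ℤ → ℤ) → Set
  Poly zero    f = ∀ x → f x ≡ 0ℤ
  Poly (suc n) f = Σ (ℤ → ℤ) λ g → Poly n g × (∀ x → f x ≡ f 0ℤ + x * g x)

  poly-cong : ∀ n {f g} → (∀ x → f x ≡ g x) → Poly n f → Poly n g
  poly-cong zero eq p x = trans (sym (eq x)) (p x)
  poly-cong (suc n) eq (h , ph , e) =
    h , ph , λ x → trans (sym (eq x)) (trans (e x) (cong (_+ x * h x) (eq 0ℤ)))

  poly-mono : ∀ n {f} → Poly n f → Poly (suc n) f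
  poly-mono zero p = (λ _ → 0ℤ) , (λ _ → refl) ,
    λ x → trans (p x) (sym (cong₂ _+_ (p 0ℤ) (*-zeroʳ x)))
  poly-mono (suc n) (g , pg , e) = g , poly-mono n pg , e

  poly-+ : ∀ n {f g} → Poly n f → Poly n g → Poly n (λ x → f x + g x)
  poly-+ zero p q x = cong₂ _+_ (p x) (q x)
  poly-+ (suc n) {f} {g} (f′ , pf , ef) (g′ , pg , eg) =
    (λ x → f′ x + g′ x) , poly-+ n pf pg ,
    λ x → trans (cong₂ _+_ (ef x) (eg x)) (alg (f 0ℤ) (g 0ℤ) x (f′ x) (g′ x))
    where
    alg : ∀ a b x u v → (a + x * u) + (b + x * v) ≡ a + b + x * (u + v)
    alg = solve-∀

  poly-* : ∀ n c {f} → Poly n f → Poly n (λ x → c * f x)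
  poly-* zero c p x = trans (cong (c *_) (p x)) (*-zeroʳ c)
  poly-* (suc n) c {f} (g , pg , e) =
    (λ x → c * g x) , poly-* n c pg , λ x → trans (cong (c *_) (e x)) (alg c (f 0ℤ) x (g x))
    where
    alg : ∀ c a x u → c * (a + x * u) ≡ c * a + x * (c * u)
    alg = solve-∀

  poly-const : ∀ c → Poly 1 (λ _ → c)
  poly-const c = (λ _ → 0ℤ) , (λ _ → refl) ,
    λ x → sym (trans (cong (λ z → c + z) (*-zeroʳ x)) (+-identityʳ c))

  poly-0 : ∀ n → Poly n (λ _ → 0ℤ)
  poly-0 zero _ = refl
  poly-0 (suc n) = poly-mono n (poly-0 n)

  poly-x* : ∀ n {f} → Poly n f → Poly (suc n) (λ x → x * f x)
  poly-x* n {f} p = f , p , λ x → sym (trans (cong (_+ x * f x) (*-zeroˡ (f 0ℤ))) (+-identityˡ _))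

  poly-linear* : ∀ n b {f} → Poly n f → Poly (suc n) (λ x → (x - b) * f x)
  poly-linear* n b {f} p = poly-cong (suc n) (λ x → alg x b (f x))
    (poly-+ (suc n) (poly-x* n p) (poly-mono n (poly-* n (- b) p)))
    where
    alg : ∀ x b u → x * u + - b * u ≡ (x - b) * u
    alg = solve-∀

  poly-shift : ∀ n r {f} → Poly n f → Poly n (λ x → f (x + r))
  poly-shift zero r p x = p (x + r)
  poly-shift (suc n) r {f} (g , pg , e) = poly-cong (suc n) (λ x → trans (alg (f 0ℤ) x r (g (x + r))) (sym (e (x + r))))
    (poly-+ (suc n) (poly-+ (suc n) (lift n (f 0ℤ)) (poly-x* n shifted)) (poly-mono n (poly-* n r shifted)))
    where
    shifted = poly-shift n r pg
    lift : ∀ n c → Poly (suc n) (λ _ → c)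
    lift zero c = poly-const c
    lift (suc n) c = poly-mono (suc n) (lift n c)
    alg : ∀ a x r u → a + x * u + r * u ≡ a + (x + r) * u
    alg = solve-∀

  poly-Δ : ∀ n r {f} → Poly (suc n) f → Poly n (λ x → f (x + r) - f x)
  poly-Δ zero r {f} (g , pg , e) x = trans (cong₂ _-_ (c (x + r)) (c x)) (+-inverseʳ (f 0ℤ))
    where
    c : ∀ x → f x ≡ f 0ℤ
    c x = trans (e x) (trans (cong (λ z → f 0ℤ + x * z) (pg x)) (trans (cong (λ z → f 0ℤ + z) (*-zeroʳ x)) (+-identityʳ _)))
  poly-Δ (suc n) r {f} (g , pg , e) = poly-cong (suc n)
    (λ x → sym (trans (cong₂ _-_ (e (x + r)) (e x)) (alg (f 0ℤ) x r (g (x + r)) (g x))))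
    (poly-+ (suc n) (poly-x* n (poly-Δ n r pg)) (poly-* (suc n) r (poly-shift (suc n) r pg)))
    where
    alg : ∀ a x r u v → a + (x + r) * u - (a + x * v) ≡ x * (u - v) + r * u
    alg = solve-∀

  poly-quotient : ∀ n a {f} → Poly (suc n) f → Σ (ℤ → ℤ) λ g → Poly n g × (∀ x → f x ≡ f a + (x - a) * g x)
  poly-quotient zero a {f} (g , pg , e) = g , pg , λ x → trans (c x) (sym (trans
      (cong₂ (λ u v → u + (x - a) * v) (c a) (pg x)) (trans (cong (λ z → f 0ℤ + z) (*-zeroʳ (x - a))) (+-identityʳ _))))
    where
    c : ∀ x → f x ≡ f 0ℤ
    c x = trans (e x) (trans (cong (λ z → f 0ℤ + x * z) (pg x)) (trans (cong (λ z → f 0ℤ + z) (*-zeroʳ x)) (+-identityʳ _)))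
  poly-quotient (suc n) a {f} (g , pg , e) with poly-quotient n a pg
  ... | h , ph , eh = (λ x → g x + a * h x) , poly-+ (suc n) pg (poly-mono n (poly-* n a ph)) ,
    λ x → trans (e x) (trans (alg₁ (f 0ℤ) x a (g x) (g a))
      (trans (cong (λ z → f 0ℤ + a * g a + (x - a) * g x + a * (z - g a)) (eh x))
      (trans (alg₂ (f 0ℤ) x a (g x) (g a) (h x))
             (cong (_+ (x - a) * (g x + a * h x)) (sym (e a))))))
    where
    alg₁ : ∀ c x a u v → c + x * u ≡ c + a * v + (x - a) * u + a * (u - v)
    alg₁ = solve-∀
    alg₂ : ∀ c x a u v w → c + a * v + (x - a) * u + a * (v + (x - a) * w - v) ≡ c + a * v + (x - a) * (u + a * w)
    alg₂ = solve-∀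

  poly-roots : ∀ {f} as → Poly (length as) f → Unique as → All (λ a → f a ≡ 0ℤ) as → ∀ x → f x ≡ 0ℤ
  poly-roots [] p _ _ = p
  poly-roots {f} (a ∷ as) p (a∉ ∷ u) (fa≡0 ∷ fas) with poly-quotient (length as) a p
  ... | g , pg , e = λ x → trans (factor x) (trans (cong ((x - a) *_) (g≡0 x)) (*-zeroʳ (x - a)))
    where
    factor : ∀ x → f x ≡ (x - a) * g x
    factor x = trans (e x) (trans (cong (_+ (x - a) * g x) fa≡0) (+-identityˡ _))
    root : ∀ {b} → a ≢ b → f b ≡ 0ℤ → g b ≡ 0ℤ
    root {b} a≢b fb≡0 with i*j≡0⇒i≡0∨j≡0 (b - a) (trans (sym (factor b)) fb≡0)
    ... | inj₁ b-a≡0 = ⊥-elim (a≢b (sym (i-j≡0⇒i≡j b a b-a≡0)))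
    ... | inj₂ gb≡0 = gb≡0
    g≡0 = poly-roots as pg u (All.zipWith (λ (a≢b , z) → root a≢b z) (a∉ , fas))

  -- The difference f(x + r) - f(x) obeys the same relation in lower degree, so it vanishes by
  -- induction. Then f(x + r) = f(x), and the relation becomes (V - U) f = 0.
  poly-geometric : ∀ n r {U V f} → Poly n f → U ≢ V → (∀ x → V * f (x + r) ≡ U * f x) → ∀ x → f x ≡ 0ℤ
  poly-geometric zero r p U≢V e = p
  poly-geometric (suc n) r {U} {V} {f} p U≢V e x = conclude
    where
    open ≡-Reasoning
    Δf : ℤ → ℤ
    Δf x = f (x + r) - f x
    Δf≡0 : ∀ x → Δf x ≡ 0ℤ
    Δf≡0 = poly-geometric n r {U} {V} (poly-Δ n r p) U≢V λ x →
      trans (*-distribˡ-minus V (f (x + r + r)) (f (x + r)))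
        (trans (cong₂ _-_ (e (x + r)) (e x)) (sym (*-distribˡ-minus U (f (x + r)) (f x))))
      where
      *-distribˡ-minus : ∀ a b c → a * (b - c) ≡ a * b - a * c
      *-distribˡ-minus = solve-∀
    eq : (V - U) * f x ≡ 0ℤ
    eq = begin
      (V - U) * f x                  ≡⟨ alg V U (f x) (f (x + r)) ⟩
      V * f (x + r) - U * f x - V * (f (x + r) - f x)
        ≡⟨ cong₂ (λ u v → u - U * f x - V * v) (e x) (Δf≡0 x) ⟩
      U * f x - U * f x - V * 0ℤ     ≡⟨ cong₂ (λ u v → u - v) (+-inverseʳ (U * f x)) (*-zeroʳ V) ⟩
      0ℤ ∎
      where
      alg : ∀ v u a b → (v - u) * a ≡ v * b - u * a - v * (b - a)
      alg = solve-∀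
    conclude : f x ≡ 0ℤ
    conclude with i*j≡0⇒i≡0∨j≡0 (V - U) eq
    ... | inj₁ z = ⊥-elim (U≢V (sym (i-j≡0⇒i≡j V U z)))
    ... | inj₂ z = z

-- Finite sums and products.

module Sums where

  open import Data.Integer using (ℤ; 0ℤ; 1ℤ; _+_; _*_; ∣_∣)
  open import Data.Integer.Properties
  open import Data.Integer.Tactic.RingSolver using (solve-∀)

  ∑ : {A : Set} → List A → (A → ℤ) → ℤ
  ∑ []       f = 0ℤ
  ∑ (x ∷ xs) f = f x + ∑ xs f

  ∏ : {A : Set} → List A → (A → ℤ) → ℤ
  ∏ []       f = 1ℤ
  ∏ (x ∷ xs) f = f x * ∏ xs f

  module _ {A : Set} where

    ∑-cong : ∀ (xs : List A) {f g} → (∀ {x} → x ∈ xs → f x ≡ g x) → ∑ xs f ≡ ∑ xs g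
    ∑-cong [] h = refl
    ∑-cong (x ∷ xs) h = cong₂ _+_ (h (here refl)) (∑-cong xs (λ x∈ → h (there x∈)))

    ∏-cong : ∀ (xs : List A) {f g} → (∀ {x} → x ∈ xs → f x ≡ g x) → ∏ xs f ≡ ∏ xs g
    ∏-cong [] h = refl
    ∏-cong (x ∷ xs) h = cong₂ _*_ (h (here refl)) (∏-cong xs (λ x∈ → h (there x∈)))

    ∑-0 : ∀ (xs : List A) {f} → (∀ {x} → x ∈ xs → f x ≡ 0ℤ) → ∑ xs f ≡ 0ℤ
    ∑-0 [] h = refl
    ∑-0 (x ∷ xs) h = cong₂ _+_ (h (here refl)) (∑-0 xs (λ x∈ → h (there x∈)))

    ∑-single : ∀ (xs : List A) {f a} → Unique xs → a ∈ xs → (∀ {x} → x ∈ xs → x ≢ a → f x ≡ 0ℤ) → ∑ xs f ≡ f a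
    ∑-single (x ∷ xs) {f} (x∉ ∷ u) (here refl) h =
      trans (cong (f x +_) (∑-0 xs λ y∈ → h (there y∈) λ { refl → All.lookup x∉ y∈ refl })) (+-identityʳ (f x))
    ∑-single (x ∷ xs) {f} {a} (x∉ ∷ u) (there a∈) h =
      trans (cong₂ _+_ (h (here refl) (All.lookup x∉ a∈)) (∑-single xs u a∈ (λ y∈ → h (there y∈)))) (+-identityˡ (f a))

    ∑-* : ∀ c (xs : List A) f → ∑ xs (λ x → c * f x) ≡ c * ∑ xs f
    ∑-* c [] f = sym (*-zeroʳ c)
    ∑-* c (x ∷ xs) f = trans (cong (c * f x +_) (∑-* c xs f)) (sym (*-distribˡ-+ c (f x) (∑ xs f)))

    ∑-+ : ∀ (xs : List A) f g → ∑ xs (λ x → f x + g x) ≡ ∑ xs f + ∑ xs g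
    ∑-+ [] f g = refl
    ∑-+ (x ∷ xs) f g = trans (cong (f x + g x +_) (∑-+ xs f g)) (alg (f x) (g x) (∑ xs f) (∑ xs g))
      where
      alg : ∀ a b c d → a + b + (c + d) ≡ a + c + (b + d)
      alg = solve-∀

    ∑-∣∣≤ : ∀ (xs : List A) f {M} → (∀ {x} → x ∈ xs → ∣ f x ∣ ℕ.≤ M) → ∣ ∑ xs f ∣ ℕ.≤ length xs ℕ.* M
    ∑-∣∣≤ [] f h = ℕ.z≤n
    ∑-∣∣≤ (x ∷ xs) f h = ℕ.≤-trans (∣i+j∣≤∣i∣+∣j∣ (f x) (∑ xs f))
      (ℕ.+-mono-≤ (h (here refl)) (∑-∣∣≤ xs f (λ x∈ → h (there x∈))))

    ∏-zero : ∀ (xs : List A) {f a} → a ∈ xs → f a ≡ 0ℤ → ∏ xs f ≡ 0ℤ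
    ∏-zero (x ∷ xs) {f} (here refl) e = trans (cong (_* ∏ xs f) e) (*-zeroˡ (∏ xs f))
    ∏-zero (x ∷ xs) {f} (there a∈) e = trans (cong (f x *_) (∏-zero xs a∈ e)) (*-zeroʳ (f x))

    ∏-* : ∀ (xs : List A) f g → ∏ xs (λ x → f x * g x) ≡ ∏ xs f * ∏ xs g
    ∏-* [] f g = refl
    ∏-* (x ∷ xs) f g = trans (cong (f x * g x *_) (∏-* xs f g)) (alg (f x) (g x) (∏ xs f) (∏ xs g))
      where
      alg : ∀ a b c d → a * b * (c * d) ≡ a * c * (b * d)
      alg = solve-∀

    ∏-∣∣≤ : ∀ (xs : List A) f {M} → (∀ {x} → x ∈ xs → ∣ f x ∣ ℕ.≤ M) → ∣ ∏ xs f ∣ ℕ.≤ M ℕ.^ length xs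
    ∏-∣∣≤ [] f h = ℕ.≤-refl
    ∏-∣∣≤ (x ∷ xs) f h = ℕ.≤-trans (ℕ.≤-reflexive (∣i*j∣≡∣i∣*∣j∣ (f x) (∏ xs f)))
      (ℕ.*-mono-≤ (h (here refl)) (∏-∣∣≤ xs f (λ x∈ → h (there x∈))))

-- Lagrange interpolation and divided differences without denominators.

module Lagrange {A : Set} (_≟_ : DecidableEquality A) (ν : A → ℤ.ℤ) where

  open import Data.Integer using (ℤ; 0ℤ; 1ℤ; _+_; _-_; _*_; -_)
  open import Data.Integer.Properties hiding (_≟_)
  open import Data.Integer.Tactic.RingSolver using (solve-∀)
  open import Data.List using (map)
  open import Data.List.Properties using (length-map)
  open Poly
  open Sums

  ω : List A → ℤ → ℤ
  ω I x = ∏ I (λ a → x - ν a)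

  -- The omitted factor is replaced by 1 rather than removed, so that products with different
  -- omissions run over the same list and can be treated column by column.
  factorExcept : A → ℤ → A → ℤ
  factorExcept e x a with a ≟ e
  ... | yes _ = 1ℤ
  ... | no  _ = x - ν a

  ωExcept : List A → A → ℤ → ℤ
  ωExcept I e x = ∏ I (factorExcept e x)

  factorExcept-≢ : ∀ {e a} x → a ≢ e → factorExcept e x a ≡ x - ν a
  factorExcept-≢ {e} {a} x a≢e with a ≟ e
  ... | yes a≡e = ⊥-elim (a≢e a≡e)
  ... | no _ = refl

  factorExcept-≡ : ∀ e x → factorExcept e x e ≡ 1ℤ
  factorExcept-≡ e x with e ≟ e
  ... | yes _ = refl
  ... | no e≢e = ⊥-elim (e≢e refl)

  ω-split : ∀ I {e} x → Unique I → e ∈ I → ω I x ≡ (x - ν e) * ωExcept I e x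
  ω-split (a ∷ I) {e} x (a∉ ∷ u) (here refl) = cong ((x - ν a) *_) (trans
    (∏-cong I (λ b∈ → sym (factorExcept-≢ x (λ { refl → All.lookup a∉ b∈ refl }))))
    (sym (trans (cong (_* ωExcept I a x) (factorExcept-≡ a x)) (*-identityˡ _))))
  ω-split (a ∷ I) {e} x (a∉ ∷ u) (there e∈) = trans
    (cong₂ _*_ (sym (factorExcept-≢ x (All.lookup a∉ e∈))) (ω-split I x u e∈))
    (alg (factorExcept e x a) (x - ν e) (ωExcept I e x))
    where
    alg : ∀ a b c → a * (b * c) ≡ b * (a * c)
    alg = solve-∀

  ωExcept-node : ∀ I {e a} → a ∈ I → a ≢ e → ωExcept I e (ν a) ≡ 0ℤ
  ωExcept-node I {e} {a} a∈ a≢e = ∏-zero I a∈ (trans (factorExcept-≢ (ν a) a≢e) (+-inverseʳ (ν a)))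

  poly-ωExcept-suc : ∀ I e → Poly (suc (length I)) (ωExcept I e)
  poly-ωExcept-suc [] e = poly-const 1ℤ
  poly-ωExcept-suc (a ∷ I) e with a ≟ e
  ... | yes _ = poly-mono (suc (length I)) (poly-cong (suc (length I)) (λ x → sym (*-identityˡ _)) (poly-ωExcept-suc I e))
  ... | no _ = poly-linear* (suc (length I)) (ν a) (poly-ωExcept-suc I e)

  poly-ωExcept : ∀ I {e} → e ∈ I → Poly (length I) (ωExcept I e)
  poly-ωExcept (a ∷ I) {e} e∈ with a ≟ e
  ... | yes _ = poly-cong (suc (length I)) (λ x → sym (*-identityˡ _)) (poly-ωExcept-suc I e)
  poly-ωExcept (a ∷ I) {e} (here refl) | no a≢e = ⊥-elim (a≢e refl)
  poly-ωExcept (a ∷ I) {e} (there e∈)  | no _ = poly-linear* (length I) (ν a) (poly-ωExcept I e∈)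

  poly-∑ : ∀ n (xs : List A) {f : A → ℤ → ℤ} → (∀ {a} → a ∈ xs → Poly n (f a)) → Poly n (λ x → ∑ xs (λ a → f a x))
  poly-∑ n [] h = poly-0 n
  poly-∑ n (a ∷ xs) h = poly-+ n (h (here refl)) (poly-∑ n xs (λ a∈ → h (there a∈)))

  -- `κ e` is `Δ` divided by the Lagrange denominator at e; one `Δ` common to all nodes keeps the
  -- interpolation over ℤ.
  module Interpolation (I : List A) (unique : Unique (map ν I)) (κ : A → ℤ) (Δ : ℤ)
                       (κ-ωExcept : ∀ {e} → e ∈ I → κ e * ωExcept I e (ν e) ≡ Δ) where

    uniqueI : Unique I
    uniqueI = go I unique where
      go : ∀ I → Unique (map ν I) → Unique I
      go [] [] = []
      go (a ∷ I) (a∉ ∷ u) = All.map (λ ne eq → ne (cong ν eq)) (All.map⁻ a∉) ∷ go I u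

    -- Δ times the Lagrange interpolation polynomial with values F at the nodes
    interpolate : (A → ℤ) → ℤ → ℤ
    interpolate F x = ∑ I (λ e → κ e * F e * ωExcept I e x)

    poly-interpolate : ∀ F → Poly (length I) (interpolate F)
    poly-interpolate F = poly-∑ (length I) I (λ {e} e∈ → poly-* (length I) (κ e * F e) (poly-ωExcept I e∈))

    interpolate-node : ∀ F {e} → e ∈ I → interpolate F (ν e) ≡ Δ * F e
    interpolate-node F {e} e∈ = trans
      (∑-single I uniqueI e∈ (λ {a} a∈ a≢e → trans (cong (κ a * F a *_) (ωExcept-node I e∈ (λ eq → a≢e (sym eq)))) (*-zeroʳ (κ a * F a))))
      (trans (alg (κ e) (F e) (ωExcept I e (ν e))) (cong (_* F e) (κ-ωExcept e∈)))
      where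
      alg : ∀ a b c → a * b * c ≡ a * c * b
      alg = solve-∀

    poly-vanishing : ∀ {q} → Poly (length I) q → (∀ {e} → e ∈ I → q (ν e) ≡ 0ℤ) → ∀ x → q x ≡ 0ℤ
    poly-vanishing {q} p h = poly-roots (map ν I) (subst (λ n → Poly n q) (sym (length-map ν I)) p) unique
      (All.map⁺ (All.tabulate h))

    interpolate-poly : ∀ {q} → Poly (length I) q → ∀ x → interpolate (λ e → q (ν e)) x ≡ Δ * q x
    interpolate-poly {q} p x = i-j≡0⇒i≡j _ _ (trans (alg (interpolate F x) Δ (q x))
      (poly-vanishing {λ x → interpolate F x + - Δ * q x}
        (poly-+ (length I) (poly-interpolate F) (poly-* (length I) (- Δ) p))
        (λ {e} e∈ → trans (sym (alg (interpolate F (ν e)) Δ (q (ν e)))) (i≡j⇒i-j≡0 (interpolate-node F e∈))) x))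
      where
      F : A → ℤ
      F e = q (ν e)
      alg : ∀ a b c → a - b * c ≡ a + - b * c
      alg = solve-∀

    -- Divided differences on the nodes ν e (e ∈ I) and the extra node y, scaled by Δ * Λ.
    module Divided (Λ y κ₀ : ℤ) (ρ : A → ℤ) (ρ-y : ∀ {e} → e ∈ I → ρ e * (ν e - y) ≡ Λ) (κ₀-ω : κ₀ * ω I y ≡ Δ) where

      divided : (A → ℤ) → ℤ → ℤ
      divided F F₀ = κ₀ * Λ * F₀ + ∑ I (λ e → κ e * ρ e * F e)

      -- Up to nonzero factors the divided difference measures by how much the interpolation
      -- polynomial misses F₀ at the extra node. Annihilation of low degrees and the meaning of a
      -- zero divided difference both follow by cancelling.
      ω*divided : ∀ F F₀ → ω I y * divided F F₀ ≡ Λ * (Δ * F₀ - interpolate F y)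
      ω*divided F F₀ = begin
        ω I y * (κ₀ * Λ * F₀ + S)          ≡⟨ alg (ω I y) κ₀ Λ F₀ S ⟩
        Λ * (κ₀ * ω I y * F₀) + ω I y * S  ≡⟨ cong₂ (λ u v → Λ * (u * F₀) + v) κ₀-ω sums ⟩
        Λ * (Δ * F₀) + - Λ * interpolate F y ≡⟨ alg′ Λ (Δ * F₀) (interpolate F y) ⟩
        Λ * (Δ * F₀ - interpolate F y) ∎
        where
        open ≡-Reasoning
        S = ∑ I (λ e → κ e * ρ e * F e)
        alg : ∀ w k l f s → w * (k * l * f + s) ≡ l * (k * w * f) + w * s
        alg = solve-∀
        alg′ : ∀ l a b → l * a + - l * b ≡ l * (a - b)
        alg′ = solve-∀
        alg₃ : ∀ n y w k r f → (y - n) * w * (k * r * f) ≡ - (r * (n - y)) * (k * f * w)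
        alg₃ = solve-∀
        sums : ω I y * S ≡ - Λ * interpolate F y
        sums = trans (sym (∑-* (ω I y) I _)) (trans
          (∑-cong I (λ {e} e∈ → trans (cong (_* (κ e * ρ e * F e)) (ω-split I y uniqueI e∈))
            (trans (alg₃ (ν e) y (ωExcept I e y) (κ e) (ρ e) (F e)) (cong (λ z → - z * _) (ρ-y e∈)))))
          (∑-* (- Λ) I _))

      divided-poly : Δ ≢ 0ℤ → ∀ {q} → Poly (length I) q → divided (λ e → q (ν e)) (q y) ≡ 0ℤ
      divided-poly Δ≢0 {q} p with i*j≡0⇒i≡0∨j≡0 (ω I y)
        (trans (ω*divided (λ e → q (ν e)) (q y))
        (trans (cong (λ z → Λ * (Δ * q y - z)) (interpolate-poly p y))
        (trans (cong (Λ *_) (+-inverseʳ (Δ * q y))) (*-zeroʳ Λ))))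
      ... | inj₂ e = e
      ... | inj₁ e = ⊥-elim (Δ≢0 (trans (sym κ₀-ω) (trans (cong (κ₀ *_) e) (*-zeroʳ κ₀))))

      divided≡0⇒ : Λ ≢ 0ℤ → ∀ F F₀ → divided F F₀ ≡ 0ℤ → interpolate F y ≡ Δ * F₀
      divided≡0⇒ Λ≢0 F F₀ e with i*j≡0⇒i≡0∨j≡0 Λ (trans (sym (ω*divided F F₀)) (trans (cong (ω I y *_) e) (*-zeroʳ (ω I y))))
      ... | inj₁ z = ⊥-elim (Λ≢0 z)
      ... | inj₂ z = sym (i-j≡0⇒i≡j _ _ z)

-- Integral weights for a single arithmetic progression of nodes.

module Weights where

  open import Data.Integer using (ℤ; +_; -[1+_]; +[1+_]; 0ℤ; 1ℤ; _+_; _-_; _*_; -_; ∣_∣)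
  open import Data.Integer.Properties
  open import Data.Integer.Tactic.RingSolver using (solve-∀)
  open import Data.List using (map; upTo; applyUpTo; cartesianProduct; _++_)
  open import Data.List.Relation.Unary.Unique.Propositional.Properties using () renaming (upTo⁺ to unique-upTo; cartesianProduct⁺ to unique-cartesianProduct)
  open Sums

  ∏-++ : ∀ {A : Set} (xs ys : List A) f → ∏ (xs ++ ys) f ≡ ∏ xs f * ∏ ys f
  ∏-++ [] ys f = sym (*-identityˡ (∏ ys f))
  ∏-++ (x ∷ xs) ys f = trans (cong (f x *_) (∏-++ xs ys f)) (sym (*-assoc (f x) (∏ xs f) (∏ ys f)))

  ∏-map : ∀ {A B : Set} (g : A → B) xs f → ∏ (map g xs) f ≡ ∏ xs (λ x → f (g x))
  ∏-map g [] f = refl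
  ∏-map g (x ∷ xs) f = cong (f (g x) *_) (∏-map g xs f)

  ∏-cartesianProduct : ∀ {A B : Set} (xs : List A) (ys : List B) f →
                       ∏ (cartesianProduct xs ys) f ≡ ∏ xs (λ x → ∏ ys (λ y → f (x , y)))
  ∏-cartesianProduct [] ys f = refl
  ∏-cartesianProduct (x ∷ xs) ys f = trans (∏-++ (map (x ,_) ys) _ f)
    (cong₂ _*_ (∏-map (x ,_) ys f) (∏-cartesianProduct xs ys f))

  prod : ℕ → (ℕ → ℤ) → ℤ
  prod zero    f = 1ℤ
  prod (suc n) f = f 0 * prod n (λ i → f (suc i))

  prod-cong : ∀ n {f g : ℕ → ℤ} → (∀ i → f i ≡ g i) → prod n f ≡ prod n g
  prod-cong zero h = refl
  prod-cong (suc n) h = cong₂ _*_ (h 0) (prod-cong n (λ i → h (suc i)))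

  prod-last : ∀ n f → prod (suc n) f ≡ prod n f * f n
  prod-last zero f = *-comm (f 0) 1ℤ
  prod-last (suc n) f = trans (cong (f 0 *_) (prod-last n (λ i → f (suc i))))
    (sym (*-assoc (f 0) _ _))

  ∏-upTo : ∀ n f → ∏ (upTo n) f ≡ prod n f
  ∏-upTo n f = go n (λ i → i) where
    go : ∀ n g → ∏ (applyUpTo g n) f ≡ prod n (λ i → f (g i))
    go zero g = refl
    go (suc n) g = cong (f (g 0) *_) (go n (λ i → g (suc i)))

  unique-map : ∀ {A B : Set} {f : A → B} {xs} → Unique xs →
               (∀ {a b} → a ∈ xs → b ∈ xs → f a ≡ f b → a ≡ b) → Unique (map f xs)
  unique-map [] inj = []
  unique-map (x∉ ∷ u) inj =
    All.map⁺ (All.tabulate λ y∈ eq → All.lookup x∉ y∈ (inj (here refl) (there y∈) eq)) ∷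
    unique-map u (λ a∈ b∈ → inj (there a∈) (there b∈))

  ∣i-j∣≤ : ∀ {M} i j → ∣ i ∣ ℕ.≤ M → ∣ j ∣ ℕ.≤ M → ∣ i - j ∣ ℕ.≤ 2 ℕ.* M
  ∣i-j∣≤ {M} i j p q = ℕ.≤-trans (∣i-j∣≤∣i∣+∣j∣ i j)
    (ℕ.+-mono-≤ p (ℕ.≤-trans q (ℕ.≤-reflexive (sym (ℕ.+-identityʳ M)))))

  module Progression (r : ℤ) (Λ : ℕ) where

    -- This is Λ · r ^ N · N!, a numerator that clears the denominators of all weights of a
    -- progression with N + 1 terms.
    scale : ℕ → ℤ
    scale zero    = + Λ
    scale (suc N) = scale N * (r * + suc N)

    -- The quotient Λ / z, exact when z is nonzero and divides Λ; its value at 0 is a placeholder.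
    inverse : ℤ → ℤ
    inverse (+ zero)   = 0ℤ
    inverse +[1+ n ]   = + (Λ ℕ./ suc n)
    inverse -[1+ n ]   = - + (Λ ℕ./ suc n)

    ∣inverse∣≤ : ∀ z → ∣ inverse z ∣ ℕ.≤ Λ
    ∣inverse∣≤ (+ zero) = ℕ.z≤n
    ∣inverse∣≤ +[1+ n ] = ℕ.m/n≤m Λ (suc n)
    ∣inverse∣≤ -[1+ n ] = ℕ.≤-trans (ℕ.≤-reflexive (∣-i∣≡∣i∣ (+ (Λ ℕ./ suc n)))) (ℕ.m/n≤m Λ (suc n))

    inverse-* : ∀ z → z ≢ 0ℤ → ∣ z ∣ ℕ.∣ Λ → inverse z * z ≡ + Λ
    inverse-* (+ zero) z≢0 _ = ⊥-elim (z≢0 refl)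
    inverse-* +[1+ n ] _ d = trans (sym (pos-* (Λ ℕ./ suc n) (suc n))) (cong +_ (ℕ.m/n*n≡m d))
    inverse-* -[1+ n ] _ d = trans (alg (+ (Λ ℕ./ suc n)) (+ suc n)) (trans (sym (pos-* (Λ ℕ./ suc n) (suc n))) (cong +_ (ℕ.m/n*n≡m d)))
      where
      alg : ∀ a b → - a * - b ≡ a * b
      alg = solve-∀

    -- scale N divided by the product of y - r i (i ≤ N), by partial fractions.
    offWeight : ℕ → ℤ → ℤ
    offWeight zero    y = inverse y
    offWeight (suc N) y = offWeight N (y - r) - offWeight N y

    ∣offWeight∣≤ : ∀ N y → ∣ offWeight N y ∣ ℕ.≤ 2 ℕ.^ N ℕ.* Λ
    ∣offWeight∣≤ zero y = ℕ.≤-trans (∣inverse∣≤ y) (ℕ.≤-reflexive (sym (ℕ.*-identityˡ Λ)))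
    ∣offWeight∣≤ (suc N) y = ℕ.≤-trans (∣i-j∣≤ (offWeight N (y - r)) (offWeight N y) (∣offWeight∣≤ N (y - r)) (∣offWeight∣≤ N y))
      (ℕ.≤-reflexive (sym (ℕ.*-assoc 2 (2 ℕ.^ N) Λ)))

    -- Telescoping: dropping the first factor of the longer product and dropping its last one give
    -- reciprocals that differ by (first - last) / product, and first - last is r (N + 1), exactly
    -- the factor by which `scale` grows.
    offWeight-* : ∀ N y → (∀ i → i ℕ.≤ N → inverse (y - r * + i) * (y - r * + i) ≡ + Λ) →
                  offWeight N y * prod (suc N) (λ i → y - r * + i) ≡ scale N
    offWeight-* zero y h = trans (cong₂ _*_ (cong inverse (sym y-0)) (*-identityʳ _)) (h 0 ℕ.z≤n)
      where
      y-0 : y - r * + 0 ≡ y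
      y-0 = trans (cong (λ z → y - z) (*-zeroʳ r)) (+-identityʳ y)
    offWeight-* (suc N) y h = begin
      (a - b) * (f 0 * p)                       ≡⟨ alg₁ a b (f 0) p ⟩
      a * p * f 0 - b * (f 0 * p)               ≡⟨ cong (λ z → a * p * f 0 - b * z) (prod-last (suc N) f) ⟩
      a * p * f 0 - b * (prod (suc N) f * f (suc N)) ≡⟨ alg₂ (a * p) (f 0) b (prod (suc N) f) (f (suc N)) ⟩
      a * p * f 0 - b * prod (suc N) f * f (suc N) ≡⟨ cong₂ (λ u v → u * f 0 - v * f (suc N)) ih₁ (offWeight-* N y (λ i i≤N → h i (ℕ.m≤n⇒m≤1+n i≤N))) ⟩
      scale N * f 0 - scale N * f (suc N)       ≡⟨ alg₃ (scale N) y r (+ suc N) ⟩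
      scale N * (r * + suc N) ∎
      where
      open ≡-Reasoning
      f : ℕ → ℤ
      f i = y - r * + i
      a = offWeight N (y - r)
      b = offWeight N y
      p = prod (suc N) (λ i → f (suc i))
      shift : ∀ i → y - r - r * + i ≡ f (suc i)
      shift i = trans (alg y r (+ i)) (cong (λ z → y - r * z) (sym (pos-+ 1 i)))
        where
        alg : ∀ y r i → y - r - r * i ≡ y - r * (1ℤ + i)
        alg = solve-∀
      ih₁ : a * p ≡ scale N
      ih₁ = trans (cong (a *_) (sym (prod-cong (suc N) shift)))
        (offWeight-* N (y - r) (λ i i≤N → trans (cong (λ z → inverse z * z) (shift i)) (h (suc i) (ℕ.s≤s i≤N))))
      alg₁ : ∀ a b f p → (a - b) * (f * p) ≡ a * p * f - b * (f * p)
      alg₁ = solve-∀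
      alg₂ : ∀ x f b p g → x * f - b * (p * g) ≡ x * f - b * p * g
      alg₂ = solve-∀
      alg₃ : ∀ s y r n → s * (y - r * 0ℤ) - s * (y - r * n) ≡ s * (r * n)
      alg₃ = solve-∀

    skip : ℕ → ℕ → ℤ → ℤ
    skip zero    zero    z = 1ℤ
    skip zero    (suc _) z = z
    skip (suc _) zero    z = z
    skip (suc i) (suc j) z = skip i j z

    skip-≡ : ∀ i z → skip i i z ≡ 1ℤ
    skip-≡ zero z = refl
    skip-≡ (suc i) z = skip-≡ i z

    skip-≢ : ∀ i j z → i ≢ j → skip i j z ≡ z
    skip-≢ zero zero z ne = ⊥-elim (ne refl)
    skip-≢ zero (suc j) z ne = refl
    skip-≢ (suc i) zero z ne = refl
    skip-≢ (suc i) (suc j) z ne = skip-≢ i j z (λ e → ne (cong suc e))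

    prodSkip : ℕ → ℕ → ℤ
    prodSkip N i = prod (suc N) (λ j → skip i j (r * (+ i - + j)))

    -- scale N divided by the product of r (i - j) (j ≤ N, j ≠ i).
    onWeight : ℕ → ℕ → ℤ
    onWeight zero    zero    = + Λ
    onWeight zero    (suc i) = 0ℤ
    onWeight (suc N) zero    = - onWeight N zero
    onWeight (suc N) (suc i) = onWeight N i - onWeight N (suc i)

    ∣onWeight∣≤ : ∀ N i → ∣ onWeight N i ∣ ℕ.≤ 2 ℕ.^ N ℕ.* Λ
    ∣onWeight∣≤ zero zero = ℕ.≤-reflexive (sym (ℕ.*-identityˡ Λ))
    ∣onWeight∣≤ zero (suc i) = ℕ.z≤n
    ∣onWeight∣≤ (suc N) zero = ℕ.≤-trans (ℕ.≤-reflexive (∣-i∣≡∣i∣ (onWeight N 0)))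
      (ℕ.≤-trans (∣onWeight∣≤ N 0) (ℕ.*-monoˡ-≤ Λ (ℕ.m≤n*m (2 ℕ.^ N) 2)))
    ∣onWeight∣≤ (suc N) (suc i) = ℕ.≤-trans (∣i-j∣≤ (onWeight N i) (onWeight N (suc i)) (∣onWeight∣≤ N i) (∣onWeight∣≤ N (suc i)))
      (ℕ.≤-reflexive (sym (ℕ.*-assoc 2 (2 ℕ.^ N) Λ)))

    onWeight-> : ∀ {N i} → N ℕ.< i → onWeight N i ≡ 0ℤ
    onWeight-> {zero} {suc i} _ = refl
    onWeight-> {suc N} {suc i} (ℕ.s≤s N<i) = cong₂ _-_ (onWeight-> N<i) (onWeight-> (ℕ.m<n⇒m<1+n N<i))

    prodSkip-first : ∀ N i → prodSkip (suc N) (suc i) ≡ r * + suc i * prodSkip N i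
    prodSkip-first N i = cong₂ _*_ (cong (r *_) (+-identityʳ (+ suc i)))
      (prod-cong (suc N) (λ j → cong (λ z → skip i j (r * z)) ([1+m]⊖[1+n] i j)))
      where
      [1+m]⊖[1+n] : ∀ i j → + suc i - + suc j ≡ + i - + j
      [1+m]⊖[1+n] i j = trans ([+m]-[+n]≡m⊖n (suc i) (suc j)) (trans ([1+m]⊖[1+n]≡m⊖n i j) (sym ([+m]-[+n]≡m⊖n i j)))

    prodSkip-last : ∀ {N i} → i ℕ.≤ N → prodSkip (suc N) i ≡ prodSkip N i * (r * (+ i - + suc N))
    prodSkip-last {N} {i} i≤N = trans (prod-last (suc N) (λ j → skip i j (r * (+ i - + j))))
      (cong (prodSkip N i *_) (skip-≢ i (suc N) _ (ℕ.<⇒≢ (ℕ.s≤s i≤N))))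

    -- `onWeight N i` is Λ times the binomial coefficient of N over i with sign (-1) ^ (N - i), and
    -- its recursion is Pascal's rule. The last entry of a row is treated apart because one of
    -- Pascal's two summands then lies outside the previous row.
    onWeight-* : ∀ N i → i ℕ.≤ N → onWeight N i * prodSkip N i ≡ scale N
    onWeight-* zero zero _ = *-identityʳ (+ Λ)
    onWeight-* (suc N) zero _ = trans (cong (- onWeight N 0 *_) (prodSkip-last {N} {0} ℕ.z≤n))
      (trans (alg (onWeight N 0) (prodSkip N 0) r (+ suc N)) (cong (_* (r * + suc N)) (onWeight-* N 0 ℕ.z≤n)))
      where
      alg : ∀ a p r n → - a * (p * (r * (0ℤ - n))) ≡ a * p * (r * n)
      alg = solve-∀
    onWeight-* (suc N) (suc i) (ℕ.s≤s i≤N) with i ℕ.<? N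
    ... | yes i<N = begin
      (a - b) * prodSkip (suc N) (suc i)                  ≡⟨ alg₁ a b (prodSkip (suc N) (suc i)) ⟩
      a * prodSkip (suc N) (suc i) - b * prodSkip (suc N) (suc i)
        ≡⟨ cong₂ (λ u v → a * u - b * v) (prodSkip-first N i) (prodSkip-last i<N) ⟩
      a * (r * + suc i * prodSkip N i) - b * (prodSkip N (suc i) * (r * (+ suc i - + suc N)))
        ≡⟨ alg₂ a r (+ suc i) (prodSkip N i) b (prodSkip N (suc i)) (+ suc N) ⟩
      a * prodSkip N i * (r * + suc i) - b * prodSkip N (suc i) * (r * (+ suc i - + suc N))
        ≡⟨ cong₂ (λ u v → u * (r * + suc i) - v * (r * (+ suc i - + suc N))) (onWeight-* N i i≤N) (onWeight-* N (suc i) i<N) ⟩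
      scale N * (r * + suc i) - scale N * (r * (+ suc i - + suc N))
        ≡⟨ alg₃ (scale N) r (+ suc i) (+ suc N) ⟩
      scale N * (r * + suc N) ∎
      where
      open ≡-Reasoning
      a = onWeight N i
      b = onWeight N (suc i)
      alg₁ : ∀ a b p → (a - b) * p ≡ a * p - b * p
      alg₁ = solve-∀
      alg₂ : ∀ a r i p b q n → a * (r * i * p) - b * (q * (r * (i - n))) ≡ a * p * (r * i) - b * q * (r * (i - n))
      alg₂ = solve-∀
      alg₃ : ∀ s r i n → s * (r * i) - s * (r * (i - n)) ≡ s * (r * n)
      alg₃ = solve-∀
    ... | no i≮N with ℕ.≤-antisym i≤N (ℕ.≮⇒≥ i≮N)
    ...   | refl = trans (cong₂ (λ u v → (onWeight i i - u) * v) (onWeight-> (ℕ.n<1+n i)) (prodSkip-first i i))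
      (trans (alg (onWeight i i) (r * + suc i) (prodSkip i i)) (cong (_* (r * + suc i)) (onWeight-* i i ℕ.≤-refl)))
      where
      alg : ∀ a x p → (a - 0ℤ) * (x * p) ≡ a * p * x
      alg = solve-∀

-- The grid of nodes r i + j, its weights, and nonvanishing.

module Grid (r N J M Λ : ℕ) (J<r : J ℕ.< r) (fits : r ℕ.* suc N ℕ.+ r ℕ.≤ M)
    (Λ>0 : 0 ℕ.< Λ) (∣Λ : ∀ k → 0 ℕ.< k → k ℕ.≤ M → k ℕ.∣ Λ) where

  open import Data.Integer using (ℤ; +_; 0ℤ; _+_; _-_; _*_; -_; ∣_∣; _^_)
  open import Data.Integer.Properties
  open import Data.Integer.Tactic.RingSolver using (solve-∀)
  open import Data.List using (map; upTo; cartesianProduct)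
  open import Data.List.Properties using (length-upTo)
  open import Data.List.Membership.Propositional.Properties using (∈-upTo⁺; ∈-upTo⁻; ∈-cartesianProduct⁺; ∈-cartesianProduct⁻)
  open import Data.List.Relation.Unary.Unique.Propositional.Properties using () renaming (upTo⁺ to unique-upTo; cartesianProduct⁺ to unique-cartesianProduct)
  open import Data.Product.Properties using (≡-dec)
  open Sums
  open Poly
  open Weights

  open Progression (+ r) Λ

  Index : Set
  Index = ℕ × ℕ

  abstract
    _≟I_ : DecidableEquality Index
    _≟I_ = ≡-dec ℕ._≟_ ℕ._≟_

  -- Column j is the progression j, j + r, j + 2 r, .... The condition J < r keeps the columns
  -- disjoint, so that every weight is a product over columns.
  node : Index → ℕ
  node (j , i) = r ℕ.* i ℕ.+ j

  ν : Index → ℤ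
  ν e = + node e

  open Lagrange _≟I_ ν

  columns rows : List ℕ
  columns = upTo (suc J)
  rows = upTo (suc N)

  grid : List Index
  grid = cartesianProduct columns rows

  ∈-grid⁺ : ∀ {j i} → j ℕ.≤ J → i ℕ.≤ N → (j , i) ∈ grid
  ∈-grid⁺ j≤J i≤N = ∈-cartesianProduct⁺ (∈-upTo⁺ (ℕ.s≤s j≤J)) (∈-upTo⁺ (ℕ.s≤s i≤N))

  ∈-grid⁻ : ∀ {j i} → (j , i) ∈ grid → j ℕ.≤ J × i ℕ.≤ N
  ∈-grid⁻ e∈ with ∈-cartesianProduct⁻ columns rows e∈
  ... | j∈ , i∈ = ℕ.≤-pred (∈-upTo⁻ j∈) , ℕ.≤-pred (∈-upTo⁻ i∈)

  length-grid : length grid ≡ suc J ℕ.* suc N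
  length-grid = trans (go columns) (cong₂ ℕ._*_ (length-upTo (suc J)) (length-upTo (suc N)))
    where
    open import Data.List.Properties using (length-++; length-map)
    go : ∀ (xs : List ℕ) → length (cartesianProduct xs rows) ≡ length xs ℕ.* length rows
    go [] = refl
    go (x ∷ xs) = trans (length-++ (map (x ,_) rows)) (cong₂ ℕ._+_ (length-map (x ,_) rows) (go xs))

  instance
    nonZero-r : ℕ.NonZero r
    nonZero-r = ℕ.>-nonZero (ℕ.≤-<-trans ℕ.z≤n J<r)

  node-injective : ∀ {j i j′ i′} → j ℕ.≤ J → j′ ℕ.≤ J → node (j , i) ≡ node (j′ , i′) → (j , i) ≡ (j′ , i′)
  node-injective {j} {i} {j′} {i′} j≤J j′≤J eq = cong₂ _,_ j≡j′
    (ℕ.*-cancelˡ-≡ i i′ r (ℕ.+-cancelʳ-≡ j (r ℕ.* i) (r ℕ.* i′) (trans eq (cong (r ℕ.* i′ ℕ.+_) (sym j≡j′)))))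
    where
    rem : ∀ {j} i → j ℕ.≤ J → node (j , i) ℕ.% r ≡ j
    rem {j} i j≤J = trans (cong (ℕ._% r) (trans (ℕ.+-comm (r ℕ.* i) j) (cong (j ℕ.+_) (ℕ.*-comm r i))))
      (trans (ℕ.[m+kn]%n≡m%n j i r) (ℕ.m<n⇒m%n≡m (ℕ.≤-<-trans j≤J J<r)))
    j≡j′ : j ≡ j′
    j≡j′ = trans (sym (rem i j≤J)) (trans (cong (ℕ._% r) eq) (rem i′ j′≤J))

  unique-ν : Unique (map ν grid)
  unique-ν = unique-map (unique-cartesianProduct (unique-upTo (suc J)) (unique-upTo (suc N)))
    λ a∈ b∈ eq → node-injective (proj₁ (∈-grid⁻ a∈)) (proj₁ (∈-grid⁻ b∈)) (+-injective eq)

  node≤ : ∀ {j i} → j ℕ.≤ J → i ℕ.≤ suc N → node (j , i) ℕ.≤ M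
  node≤ j≤J i≤ = ℕ.≤-trans (ℕ.+-mono-≤ (ℕ.*-monoʳ-≤ r i≤) (ℕ.≤-trans j≤J (ℕ.<⇒≤ J<r))) fits

  inverse-difference : ∀ {a b} → a ≢ b → a ℕ.≤ M → b ℕ.≤ M → inverse (+ a - + b) * (+ a - + b) ≡ + Λ
  inverse-difference {a} {b} a≢b a≤ b≤ = inverse-* (+ a - + b) ≢0
    (∣Λ _ (ℕ.n≢0⇒n>0 λ e → ≢0 (∣i∣≡0⇒i≡0 e)) ∣∣≤)
    where
    ≢0 : + a - + b ≢ 0ℤ
    ≢0 e = a≢b (+-injective (i-j≡0⇒i≡j (+ a) (+ b) e))
    ∣∣≤ : ∣ + a - + b ∣ ℕ.≤ M
    ∣∣≤ = ℕ.≤-trans (ℕ.≤-reflexive (cong ∣_∣ ([+m]-[+n]≡m⊖n a b))) (ℕ.≤-trans (∣m⊝n∣≤m⊔n a b) (ℕ.⊔-lub a≤ b≤))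

  column-difference : ∀ y j i → y - + j - + r * + i ≡ y - ν (j , i)
  column-difference y j i = trans (alg y (+ j) (+ r * + i)) (cong (λ z → y - z)
    (sym (trans (pos-+ (r ℕ.* i) j) (cong (_+ + j) (pos-* r i)))))
    where
    alg : ∀ y j x → y - j - x ≡ y - (x + j)
    alg = solve-∀

  off-column : ∀ {a j} → a ℕ.≤ M → j ℕ.≤ J → (∀ i → i ℕ.≤ N → a ≢ node (j , i)) →
               offWeight N (+ a - + j) * prod (suc N) (λ i → + a - ν (j , i)) ≡ scale N
  off-column {a} {j} a≤ j≤J ne = trans
    (cong (offWeight N (+ a - + j) *_) (sym (prod-cong (suc N) (column-difference (+ a) j))))
    (offWeight-* N (+ a - + j) λ i i≤N → trans (cong (λ z → inverse z * z) (column-difference (+ a) j i))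
      (inverse-difference (ne i i≤N) a≤ (node≤ j≤J (ℕ.m≤n⇒m≤1+n i≤N))))

  -- In the column of the node itself one factor has to be left out; in the other columns every
  -- factor is a nonzero difference of nodes.
  columnWeight : Index → ℕ → ℤ
  columnWeight (j , i) j′ with j′ ℕ.≟ j
  ... | yes _ = onWeight N i
  ... | no  _ = offWeight N (ν (j , i) - + j′)

  ∣columnWeight∣≤ : ∀ e j′ → ∣ columnWeight e j′ ∣ ℕ.≤ 2 ℕ.^ N ℕ.* Λ
  ∣columnWeight∣≤ (j , i) j′ with j′ ℕ.≟ j
  ... | yes _ = ∣onWeight∣≤ N i
  ... | no  _ = ∣offWeight∣≤ N (ν (j , i) - + j′)

  columnWeight-≡ : ∀ j i → columnWeight (j , i) j ≡ onWeight N i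
  columnWeight-≡ j i with j ℕ.≟ j
  ... | yes _ = refl
  ... | no j≢j = ⊥-elim (j≢j refl)

  columnWeight-≢ : ∀ {j i j′} → j′ ≢ j → columnWeight (j , i) j′ ≡ offWeight N (ν (j , i) - + j′)
  columnWeight-≢ {j} {i} {j′} j′≢j with j′ ℕ.≟ j
  ... | yes j′≡j = ⊥-elim (j′≢j j′≡j)
  ... | no _ = refl

  factorExcept-skip : ∀ j i i′ → factorExcept (j , i) (ν (j , i)) (j , i′) ≡ skip i i′ (+ r * (+ i - + i′))
  factorExcept-skip j i i′ = cases (i ℕ.≟ i′)
    where
    nodeℤ : ∀ i → ν (j , i) ≡ + r * + i + + j
    nodeℤ i = trans (pos-+ (r ℕ.* i) j) (cong (_+ + j) (pos-* r i))
    alg : ∀ r i j k → r * i + j - (r * k + j) ≡ r * (i - k)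
    alg = solve-∀
    cases : Dec (i ≡ i′) → factorExcept (j , i) (ν (j , i)) (j , i′) ≡ skip i i′ (+ r * (+ i - + i′))
    cases (yes refl) = trans (factorExcept-≡ (j , i) (ν (j , i))) (sym (skip-≡ i _))
    cases (no i≢i′) = trans (factorExcept-≢ {j , i} {j , i′} (ν (j , i)) (λ e → i≢i′ (sym (cong proj₂ e)))) (trans
      (trans (cong₂ _-_ (nodeℤ i) (nodeℤ i′)) (alg (+ r) (+ i) (+ j) (+ i′))) (sym (skip-≢ i i′ _ i≢i′)))

  columnWeight-* : ∀ {j i j′} → j ℕ.≤ J → i ℕ.≤ N → j′ ℕ.≤ J →
    columnWeight (j , i) j′ * prod (suc N) (λ i′ → factorExcept (j , i) (ν (j , i)) (j′ , i′)) ≡ scale N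
  columnWeight-* {j} {i} {j′} j≤J i≤N j′≤J = cases (j′ ℕ.≟ j)
    where
    cases : Dec (j′ ≡ j) → columnWeight (j , i) j′ * prod (suc N) (λ i′ → factorExcept (j , i) (ν (j , i)) (j′ , i′)) ≡ scale N
    cases (yes refl) = trans (cong₂ _*_ (columnWeight-≡ j i) (prod-cong (suc N) (factorExcept-skip j i))) (onWeight-* N i i≤N)
    cases (no j′≢j) = trans (cong₂ _*_ (columnWeight-≢ j′≢j) (prod-cong (suc N) λ i′ →
        factorExcept-≢ {j , i} {j′ , i′} (ν (j , i)) (λ e → j′≢j (cong proj₁ e))))
      (off-column (node≤ j≤J (ℕ.m≤n⇒m≤1+n i≤N)) j′≤J λ i′ _ eq → j′≢j (sym (cong proj₁ (node-injective {i = i} {i′ = i′} j≤J j′≤J eq))))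

  κ : Index → ℤ
  κ e = ∏ columns (columnWeight e)

  -- Each column contributes the same `scale N`, whichever node is singled out; hence one `Δ` serves
  -- all nodes.
  Δ : ℤ
  Δ = ∏ columns (λ _ → scale N)

  ∏-grid : ∀ (f : Index → ℤ) → ∏ grid f ≡ ∏ columns (λ j → prod (suc N) (λ i → f (j , i)))
  ∏-grid f = trans (∏-cartesianProduct columns rows f) (∏-cong columns (λ {j} _ → ∏-upTo (suc N) (λ i → f (j , i))))

  κ-ωExcept : ∀ {e} → e ∈ grid → κ e * ωExcept grid e (ν e) ≡ Δ
  κ-ωExcept {j , i} e∈ = trans (cong (κ (j , i) *_) (∏-grid (factorExcept (j , i) (ν (j , i)))))
    (trans (sym (∏-* columns (columnWeight (j , i)) _))
    (∏-cong columns λ {j′} j′∈ → columnWeight-* (proj₁ (∈-grid⁻ e∈)) (proj₂ (∈-grid⁻ e∈)) (ℕ.≤-pred (∈-upTo⁻ j′∈))))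

  open Interpolation grid unique-ν κ Δ κ-ωExcept public

  -- The extra node continues column h by one row. The choice of h stays open, since nonvanishing is
  -- only known for some h.
  module Extra (h : ℕ) (h≤J : h ℕ.≤ J) where

    extra : Index
    extra = h , suc N

    κ₀ : ℤ
    κ₀ = ∏ columns (λ j → offWeight N (ν extra - + j))

    extra≢ : ∀ {j i} → j ℕ.≤ J → i ℕ.≤ N → node extra ≢ node (j , i)
    extra≢ {j} {i} j≤J i≤N eq = ℕ.<-irrefl (sym (cong proj₂ (node-injective {i = suc N} {i′ = i} h≤J j≤J eq))) (ℕ.s≤s i≤N)

    κ₀-ω : κ₀ * ω grid (ν extra) ≡ Δ
    κ₀-ω = trans (cong (κ₀ *_) (∏-grid (λ e → ν extra - ν e)))
      (trans (sym (∏-* columns (λ j → offWeight N (ν extra - + j)) _))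
      (∏-cong columns λ {j} j∈ → let j≤J = ℕ.≤-pred (∈-upTo⁻ j∈) in
        off-column (node≤ h≤J ℕ.≤-refl) j≤J (λ i i≤N → extra≢ j≤J i≤N)))

    ρ : Index → ℤ
    ρ e = inverse (ν e - ν extra)

    ρ-extra : ∀ {e} → e ∈ grid → ρ e * (ν e - ν extra) ≡ + Λ
    ρ-extra {j , i} e∈ with ∈-grid⁻ e∈
    ... | j≤J , i≤N = inverse-difference (λ eq → extra≢ j≤J i≤N (sym eq)) (node≤ j≤J (ℕ.m≤n⇒m≤1+n i≤N)) (node≤ h≤J ℕ.≤-refl)

    open Divided (+ Λ) (ν extra) κ₀ ρ ρ-extra κ₀-ω public

  scale≢0 : ∀ n → scale n ≢ 0ℤ
  scale≢0 zero e = ℕ.>⇒≢ (Λ>0) (+-injective e)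
  scale≢0 (suc n) e with i*j≡0⇒i≡0∨j≡0 (scale n) e
  ... | inj₁ z = scale≢0 n z
  ... | inj₂ z with i*j≡0⇒i≡0∨j≡0 (+ r) z
  ...   | inj₁ w = ℕ.>⇒≢ (ℕ.≤-<-trans ℕ.z≤n J<r) (+-injective w)
  ...   | inj₂ ()

  Δ≢0 : Δ ≢ 0ℤ
  Δ≢0 = go columns where
    go : ∀ (xs : List ℕ) → ∏ xs (λ _ → scale N) ≢ 0ℤ
    go [] ()
    go (x ∷ xs) e with i*j≡0⇒i≡0∨j≡0 (scale N) e
    ... | inj₁ z = scale≢0 N z
    ... | inj₂ z = go xs z

  Λ≢0 : + Λ ≢ 0ℤ
  Λ≢0 = scale≢0 0

  -- One factor 2 ^ N · Λ for each of the J + 1 columns, and a last Λ for the distance to the extra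
  -- node. The factorial in `scale` does not enter.
  weightBound : ℕ
  weightBound = (2 ℕ.^ N ℕ.* Λ) ℕ.^ suc J ℕ.* Λ

  ∣∏columns∣≤ : ∀ f → (∀ j → ∣ f j ∣ ℕ.≤ 2 ℕ.^ N ℕ.* Λ) → ∣ ∏ columns f ∣ ℕ.≤ (2 ℕ.^ N ℕ.* Λ) ℕ.^ suc J
  ∣∏columns∣≤ f h = subst (λ n → ∣ ∏ columns f ∣ ℕ.≤ (2 ℕ.^ N ℕ.* Λ) ℕ.^ n) (length-upTo (suc J)) (∏-∣∣≤ columns f (λ {j} _ → h j))

  module _ (h : ℕ) (h≤J : h ℕ.≤ J) where
    open Extra h h≤J

    ∣divided∣≤ : ∀ F {M} → (∀ {j i} → j ℕ.≤ J → i ℕ.≤ suc N → ∣ F (j , i) ∣ ℕ.≤ M) →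
                 ∣ divided F (F extra) ∣ ℕ.≤ suc (suc J ℕ.* suc N) ℕ.* (weightBound ℕ.* M)
    ∣divided∣≤ F {M} hF = ℕ.≤-trans (∣i+j∣≤∣i∣+∣j∣ (κ₀ * + Λ * F extra) (∑ grid (λ e → κ e * ρ e * F e))) (ℕ.+-mono-≤
      (∣abc∣≤ κ₀ (+ Λ) (F extra) (∣∏columns∣≤ (λ j → offWeight N (ν extra - + j)) (λ j → ∣offWeight∣≤ N (ν extra - + j))) ℕ.≤-refl (hF h≤J ℕ.≤-refl))
      (subst (λ n → ∣ ∑ grid (λ e → κ e * ρ e * F e) ∣ ℕ.≤ n ℕ.* (weightBound ℕ.* M)) length-grid
        (∑-∣∣≤ grid (λ e → κ e * ρ e * F e) λ {e} e∈ → ∣abc∣≤ (κ e) (ρ e) (F e) (∣∏columns∣≤ (columnWeight e) (∣columnWeight∣≤ e)) (∣inverse∣≤ (ν e - ν extra))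
          (hF (proj₁ (∈-grid⁻ e∈)) (ℕ.m≤n⇒m≤1+n (proj₂ (∈-grid⁻ e∈)))))))
      where
      ∣abc∣≤ : ∀ a b c {A B C} → ∣ a ∣ ℕ.≤ A → ∣ b ∣ ℕ.≤ B → ∣ c ∣ ℕ.≤ C → ∣ a * b * c ∣ ℕ.≤ A ℕ.* B ℕ.* C
      ∣abc∣≤ a b c p q s = ℕ.≤-trans (ℕ.≤-reflexive (trans (∣i*j∣≡∣i∣*∣j∣ (a * b) c) (cong (ℕ._* ∣ c ∣) (∣i*j∣≡∣i∣*∣j∣ a b))))
        (ℕ.*-mono-≤ (ℕ.*-mono-≤ p q) s)

  -- If every divided difference vanished, F would be a polynomial of degree < |grid| on the nodes,
  -- while F (j , i) ∼ (U / V) ^ i forces that polynomial to be geometric along steps of r.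
  nonvanishing : ∀ {U V} F → U ≢ V → (∀ j i → i ℕ.≤ N → V * F (j , suc i) ≡ U * F (j , i)) → F (0 , 0) ≢ 0ℤ →
                 ∃ λ h → ∃ λ (h≤J : h ℕ.≤ J) → Extra.divided h h≤J F (F (h , suc N)) ≢ 0ℤ
  nonvanishing {U} {V} F U≢V step F≢0 = search (suc J) ℕ.≤-refl λ h h<sJ sJ≤h → ⊥-elim (ℕ.<⇒≱ h<sJ sJ≤h)
    where
    Zero : ℕ → Set
    Zero h = (h≤J : h ℕ.≤ J) → interpolate F (ν (h , suc N)) ≡ Δ * F (h , suc N)
    contradiction : (∀ h → Zero h) → ⊥
    contradiction zeros = [ Δ≢0 , F≢0 ]′ (i*j≡0⇒i≡0∨j≡0 Δ
        (trans (sym (interpolate-node F (∈-grid⁺ ℕ.z≤n ℕ.z≤n))) (all-zero (ν (0 , 0)))))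
      where
      value : ∀ {j i} → j ℕ.≤ J → i ℕ.≤ suc N → interpolate F (ν (j , i)) ≡ Δ * F (j , i)
      value {j} {i} j≤J i≤ = cases (ℕ.m≤n⇒m<n∨m≡n i≤)
        where
        cases : i ℕ.< suc N ⊎ i ≡ suc N → interpolate F (ν (j , i)) ≡ Δ * F (j , i)
        cases (inj₁ i<) = interpolate-node F (∈-grid⁺ j≤J (ℕ.≤-pred i<))
        cases (inj₂ refl) = zeros j j≤J
      ν-suc : ∀ j i → ν (j , i) + + r ≡ ν (j , suc i)
      ν-suc j i = trans (sym (pos-+ (node (j , i)) r)) (cong +_ (trans
        (trans (ℕ.+-comm (r ℕ.* i ℕ.+ j) r) (sym (ℕ.+-assoc r (r ℕ.* i) j))) (cong (ℕ._+ j) (sym (ℕ.*-suc r i)))))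
      q : ℤ → ℤ
      q x = V * interpolate F (x + + r) + - U * interpolate F x
      q≡0 : ∀ x → q x ≡ 0ℤ
      q≡0 = poly-vanishing {q}
        (poly-+ (length grid) (poly-* (length grid) V (poly-shift (length grid) (+ r) (poly-interpolate F)))
                              (poly-* (length grid) (- U) (poly-interpolate F)))
        λ { {j , i} e∈ → let j≤J , i≤N = ∈-grid⁻ e∈ in trans
          (cong₂ (λ u v → V * u + - U * v) (trans (cong (interpolate F) (ν-suc j i)) (value j≤J (ℕ.s≤s i≤N)))
                                            (value j≤J (ℕ.m≤n⇒m≤1+n i≤N)))
          (trans (alg V Δ (F (j , suc i)) U (F (j , i)))
          (trans (cong (λ z → Δ * (z - U * F (j , i))) (step j i i≤N))
          (trans (cong (Δ *_) (+-inverseʳ (U * F (j , i)))) (*-zeroʳ Δ)))) }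
        where
        alg : ∀ v d f u g → v * (d * f) + - u * (d * g) ≡ d * (v * f - u * g)
        alg = solve-∀
      all-zero : ∀ x → interpolate F x ≡ 0ℤ
      all-zero = poly-geometric (length grid) (+ r) {U} {V} (poly-interpolate F) U≢V λ x →
        i-j≡0⇒i≡j _ _ (trans (alg (V * interpolate F (x + + r)) U (interpolate F x)) (q≡0 x))
        where
        alg : ∀ a u b → a - u * b ≡ a + - u * b
        alg = solve-∀
    search : ∀ n → n ℕ.≤ suc J → (∀ h → h ℕ.< suc J → n ℕ.≤ h → Zero h) →
             ∃ λ h → ∃ λ (h≤J : h ℕ.≤ J) → Extra.divided h h≤J F (F (h , suc N)) ≢ 0ℤ
    search zero _ zeros = ⊥-elim (contradiction λ h h≤J → zeros h (ℕ.s≤s h≤J) ℕ.z≤n h≤J)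
    search (suc h) (ℕ.s≤s h≤J) zeros = cases (Extra.divided h h≤J F (F (h , suc N)) ≟ 0ℤ)
      where
      Goal : Set
      Goal = ∃ λ h → ∃ λ (h≤J : h ℕ.≤ J) → Extra.divided h h≤J F (F (h , suc N)) ≢ 0ℤ
      cases : Dec (Extra.divided h h≤J F (F (h , suc N)) ≡ 0ℤ) → Goal
      cases (no ≢0) = h , h≤J , ≢0
      cases (yes ≡0) = search h (ℕ.m≤n⇒m≤1+n h≤J) λ k k<sJ h≤k → zeros′ k k<sJ h≤k (h ℕ.≟ k)
        where
        zeros′ : ∀ k → k ℕ.< suc J → h ℕ.≤ k → Dec (h ≡ k) → Zero k
        zeros′ k k<sJ h≤k (no h≢k) = zeros k k<sJ (ℕ.≤∧≢⇒< h≤k h≢k)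
        zeros′ k k<sJ h≤k (yes refl) = λ _ → Extra.divided≡0⇒ h h≤J Λ≢0 F _ ≡0

-- Congruences modulo a fixed integer.

module Modular (n : ℤ.ℤ) where

  open import Data.Integer using (ℤ; +_; 0ℤ; _+_; _-_; _*_; -_; _^_)
  open import Data.Integer.Divisibility.Signed
  open import Data.Integer.Properties
  open import Data.Integer.Tactic.RingSolver using (solve-∀)
  open Sums

  infix 4 _≈_
  record _≈_ (a b : ℤ) : Set where
    constructor mod
    field ∣- : n ∣ a - b
  open _≈_ public

  reflexive : ∀ {a b} → a ≡ b → a ≈ b
  reflexive {a} refl = mod (divides 0ℤ (trans (+-inverseʳ a) (sym (*-zeroˡ n))))

  ≈-refl : ∀ {a} → a ≈ a
  ≈-refl = reflexive refl

  ≈-sym : ∀ {a b} → a ≈ b → b ≈ a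
  ≈-sym {a} {b} (mod d) = mod (subst (n ∣_) (alg a b) (∣m⇒∣-m d))
    where
    alg : ∀ a b → - (a - b) ≡ b - a
    alg = solve-∀

  ≈-trans : ∀ {a b c} → a ≈ b → b ≈ c → a ≈ c
  ≈-trans {a} {b} {c} (mod d) (mod e) = mod (subst (n ∣_) (alg a b c) (∣m∣n⇒∣m+n d e))
    where
    alg : ∀ a b c → a - b + (b - c) ≡ a - c
    alg = solve-∀

  +-cong : ∀ {a b c d} → a ≈ b → c ≈ d → a + c ≈ b + d
  +-cong {a} {b} {c} {d} (mod p) (mod q) = mod (subst (n ∣_) (alg a b c d) (∣m∣n⇒∣m+n p q))
    where
    alg : ∀ a b c d → a - b + (c - d) ≡ a + c - (b + d)
    alg = solve-∀

  *-cong : ∀ {a b c d} → a ≈ b → c ≈ d → a * c ≈ b * d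
  *-cong {a} {b} {c} {d} (mod p) (mod q) = mod (subst (n ∣_) (alg a b c d) (∣m∣n⇒∣m+n (∣n⇒∣m*n c p) (∣n⇒∣m*n b q)))
    where
    alg : ∀ a b c d → c * (a - b) + b * (c - d) ≡ a * c - b * d
    alg = solve-∀

  *-congˡ : ∀ c {a b} → a ≈ b → c * a ≈ c * b
  *-congˡ c = *-cong {c} {c} ≈-refl

  *-congʳ : ∀ c {a b} → a ≈ b → a * c ≈ b * c
  *-congʳ c p = *-cong p (≈-refl {c})

  ^-cong : ∀ k {a b} → a ≈ b → a ^ k ≈ b ^ k
  ^-cong zero p = ≈-refl
  ^-cong (suc k) p = *-cong p (^-cong k p)

  ∑-≈ : ∀ {A : Set} (xs : List A) {f g} → (∀ {x} → x ∈ xs → f x ≈ g x) → ∑ xs f ≈ ∑ xs g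
  ∑-≈ [] h = ≈-refl
  ∑-≈ (x ∷ xs) h = +-cong (h (here refl)) (∑-≈ xs (λ x∈ → h (there x∈)))

  ≈0⇒∣ : ∀ {a} → a ≈ 0ℤ → n ∣ a
  ≈0⇒∣ {a} (mod d) = subst (n ∣_) (+-identityʳ a) d

  ∣⇒≈0 : ∀ {a} → n ∣ a → a ≈ 0ℤ
  ∣⇒≈0 {a} d = mod (subst (n ∣_) (sym (+-identityʳ a)) d)

  infix  1 begin_
  infixr 2 step-≈ step-≡
  infix  3 _∎

  begin_ : ∀ {a b} → a ≈ b → a ≈ b
  begin p = p

  step-≈ : ∀ a {b c} → b ≈ c → a ≈ b → a ≈ c
  step-≈ a q p = ≈-trans p q
  syntax step-≈ a q p = a ≈⟨ p ⟩ q

  step-≡ : ∀ a {b c} → b ≈ c → a ≡ b → a ≈ c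
  step-≡ a q p = ≈-trans (reflexive p) q
  syntax step-≡ a q p = a ≡⟨ p ⟩ q

  _∎ : ∀ a → a ≈ a
  a ∎ = ≈-refl

-- Order of vanishing at 1 of a sparse polynomial.

module Vanishing where

  open import Data.Integer using (ℤ; +_; 0ℤ; 1ℤ; _+_; _-_; _*_; -_; _^_)
  open import Data.Integer.Properties
  open import Data.Integer.Tactic.RingSolver using (solve-∀)
  open import Function using (id)
  open Lcm using (choose; absorption)
  open Poly
  open Sums

  falling : ℕ → ℤ → ℤ
  falling zero    x = 1ℤ
  falling (suc k) x = (x - + k) * falling k x

  poly-falling : ∀ k → Poly (suc k) (falling k)
  poly-falling zero = poly-const 1ℤ
  poly-falling (suc k) = poly-linear* (suc k) (+ k) (poly-falling k)

  factorialℤ : ℕ → ℤ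
  factorialℤ zero    = 1ℤ
  factorialℤ (suc k) = + suc k * factorialℤ k

  factorialℤ≢0 : ∀ k → factorialℤ k ≢ 0ℤ
  factorialℤ≢0 zero ()
  factorialℤ≢0 (suc k) e = [ (λ ()) , factorialℤ≢0 k ]′ (i*j≡0⇒i≡0∨j≡0 (+ suc k) e)

  choose-step : ∀ e k → + suc k * + choose e (suc k) ≡ (+ e - + k) * + choose e k
  choose-step e k = begin
    + suc k * + choose e (suc k)
      ≡⟨ alg (+ suc k) (+ choose e k) (+ choose e (suc k)) ⟩
    + suc k * (+ choose e k + + choose e (suc k)) - + suc k * + choose e k
      ≡⟨ cong (λ z → + suc k * z - + suc k * + choose e k) (sym (pos-+ (choose e k) (choose e (suc k)))) ⟩
    + suc k * + choose (suc e) (suc k) - + suc k * + choose e k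
      ≡⟨ cong (λ z → z - + suc k * + choose e k) (trans (sym (pos-* (suc k) (choose (suc e) (suc k)))) (trans (cong +_ (absorption e k)) (pos-* (suc e) (choose e k)))) ⟩
    + suc e * + choose e k - + suc k * + choose e k
      ≡⟨ cong₂ (λ u v → u * + choose e k - v * + choose e k) (pos-+ 1 e) (pos-+ 1 k) ⟩
    (1ℤ + + e) * + choose e k - (1ℤ + + k) * + choose e k
      ≡⟨ alg′ (+ e) (+ k) (+ choose e k) ⟩
    (+ e - + k) * + choose e k ∎
    where
    open ≡-Reasoning
    alg : ∀ s a b → s * b ≡ s * (a + b) - s * a
    alg = solve-∀
    alg′ : ∀ e k c → (1ℤ + e) * c - (1ℤ + k) * c ≡ (e - k) * c
    alg′ = solve-∀

  factorialℤ*choose : ∀ k e → factorialℤ k * + choose e k ≡ falling k (+ e)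
  factorialℤ*choose zero e = refl
  factorialℤ*choose (suc k) e = begin
    + suc k * factorialℤ k * + choose e (suc k)    ≡⟨ alg (+ suc k) (factorialℤ k) (+ choose e (suc k)) ⟩
    factorialℤ k * (+ suc k * + choose e (suc k))  ≡⟨ cong (factorialℤ k *_) (choose-step e k) ⟩
    factorialℤ k * ((+ e - + k) * + choose e k)    ≡⟨ alg′ (factorialℤ k) (+ e - + k) (+ choose e k) ⟩
    (+ e - + k) * (factorialℤ k * + choose e k)    ≡⟨ cong ((+ e - + k) *_) (factorialℤ*choose k e) ⟩
    (+ e - + k) * falling k (+ e) ∎
    where
    open ≡-Reasoning
    alg : ∀ a b c → a * b * c ≡ b * (a * c)
    alg = solve-∀
    alg′ : ∀ a b c → a * (b * c) ≡ b * (a * c)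
    alg′ = solve-∀

  -- t ^ e = ∑ (k < D) choose e k (t - 1) ^ k + (t - 1) ^ D * binomialTail t D e
  binomialTail : ℤ → ℕ → ℕ → ℤ
  binomialTail t zero    e       = t ^ e
  binomialTail t (suc D) zero    = 0ℤ
  binomialTail t (suc D) (suc e) = binomialTail t (suc D) e + binomialTail t D e

  binomialTail-step : ∀ t D e → binomialTail t D e ≡ + choose e D + (t - 1ℤ) * binomialTail t (suc D) e
  binomialTail-step t zero zero = sym (trans (cong (λ z → 1ℤ + z) (*-zeroʳ (t - 1ℤ))) refl)
  binomialTail-step t (suc D) zero = sym (trans (+-identityˡ _) (*-zeroʳ (t - 1ℤ)))
  binomialTail-step t zero (suc e) = trans (cong (t *_) (binomialTail-step t 0 e))
      (trans (alg t (binomialTail t 1 e)) (cong (λ z → 1ℤ + (t - 1ℤ) * (binomialTail t 1 e + z)) (sym (binomialTail-step t 0 e))))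
    where
    alg : ∀ t b → t * (1ℤ + (t - 1ℤ) * b) ≡ 1ℤ + (t - 1ℤ) * (b + (1ℤ + (t - 1ℤ) * b))
    alg = solve-∀
  binomialTail-step t (suc D) (suc e) = trans (cong₂ _+_ (binomialTail-step t (suc D) e) (binomialTail-step t D e))
      (trans (alg (+ choose e (suc D)) t (binomialTail t (suc (suc D)) e) (+ choose e D) (binomialTail t (suc D) e))
             (cong (_+ (t - 1ℤ) * (binomialTail t (suc (suc D)) e + binomialTail t (suc D) e)) (sym (pos-+ (choose e D) (choose e (suc D))))))
    where
    alg : ∀ c t b d a → c + (t - 1ℤ) * b + (d + (t - 1ℤ) * a) ≡ d + c + (t - 1ℤ) * (b + a)
    alg = solve-∀

  -- A pair (w , e) stands for the term w · t ^ e. Annihilating all q of degree < D says that the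
  -- derivatives of order < D of the resulting sparse polynomial vanish at t = 1.
  Annihilates : ℕ → List (ℤ × ℕ) → Set
  Annihilates D ts = ∀ {q} → Poly D q → ∑ ts (λ (p : ℤ × ℕ) → proj₁ p * q (+ proj₂ p)) ≡ 0ℤ

  poly-mono-≤ : ∀ {m n} → m ℕ.≤ n → ∀ {q} → Poly m q → Poly n q
  poly-mono-≤ {m} {n} m≤n {q} p = subst (λ k → Poly k q) (ℕ.m∸n+n≡m m≤n) (go (n ℕ.∸ m))
    where
    go : ∀ k → Poly (k ℕ.+ m) q
    go zero = p
    go (suc k) = poly-mono (k ℕ.+ m) (go k)

  -- As a function of e the binomial coefficient has fractional coefficients, so the hypothesis is
  -- applied to the falling factorial, k! times as large, and k! is cancelled afterwards.
  annihilates-choose : ∀ {D} ts → Annihilates D ts → ∀ {k} → k ℕ.< D → ∑ ts (λ (p : ℤ × ℕ) → proj₁ p * + choose (proj₂ p) k) ≡ 0ℤ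
  annihilates-choose {D} ts ann {k} k<D = [ (λ e → ⊥-elim (factorialℤ≢0 k e)) , id ]′ (i*j≡0⇒i≡0∨j≡0 (factorialℤ k) (trans
    (sym (∑-* (factorialℤ k) ts (λ (p : ℤ × ℕ) → proj₁ p * + choose (proj₂ p) k)))
    (trans (∑-cong ts (λ { {w , e} _ → trans (alg (factorialℤ k) w (+ choose e k)) (cong (w *_) (factorialℤ*choose k e)) }))
           (ann (poly-mono-≤ k<D (poly-falling k))))))
    where
    alg : ∀ f w c → f * (w * c) ≡ w * (f * c)
    alg = solve-∀

  -- Taylor expansion at 1: the coefficient of (t - 1) ^ k is the weighted sum of the binomial
  -- coefficients of e over k. It is 0 for k < D, so each step extracts one more factor t - 1.
  annihilates⇒vanishing : ∀ {D} ts → Annihilates D ts → ∀ t → ∃ λ ρ → ∑ ts (λ (p : ℤ × ℕ) → proj₁ p * t ^ proj₂ p) ≡ (t - 1ℤ) ^ D * ρ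
  annihilates⇒vanishing {D} ts ann t = tail D , go D ℕ.≤-refl
    where
    tail : ℕ → ℤ
    tail k = ∑ ts (λ (p : ℤ × ℕ) → proj₁ p * binomialTail t k (proj₂ p))
    step : ∀ {k} → k ℕ.< D → tail k ≡ (t - 1ℤ) * tail (suc k)
    step {k} k<D = begin
      tail k ≡⟨ ∑-cong ts (λ { {w , e} _ → trans (cong (w *_) (binomialTail-step t k e)) (alg w (+ choose e k) (t - 1ℤ) (binomialTail t (suc k) e)) }) ⟩
      ∑ ts (λ (p : ℤ × ℕ) → proj₁ p * + choose (proj₂ p) k + (t - 1ℤ) * (proj₁ p * binomialTail t (suc k) (proj₂ p)))
        ≡⟨ ∑-+ ts (λ (p : ℤ × ℕ) → proj₁ p * + choose (proj₂ p) k) (λ (p : ℤ × ℕ) → (t - 1ℤ) * (proj₁ p * binomialTail t (suc k) (proj₂ p))) ⟩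
      ∑ ts (λ (p : ℤ × ℕ) → proj₁ p * + choose (proj₂ p) k) + ∑ ts (λ (p : ℤ × ℕ) → (t - 1ℤ) * (proj₁ p * binomialTail t (suc k) (proj₂ p)))
        ≡⟨ cong₂ _+_ (annihilates-choose ts ann k<D) (∑-* (t - 1ℤ) ts (λ (p : ℤ × ℕ) → proj₁ p * binomialTail t (suc k) (proj₂ p))) ⟩
      0ℤ + (t - 1ℤ) * tail (suc k) ≡⟨ +-identityˡ _ ⟩
      (t - 1ℤ) * tail (suc k) ∎
      where
      open ≡-Reasoning
      alg : ∀ w c y b → w * (c + y * b) ≡ w * c + y * (w * b)
      alg = solve-∀
    go : ∀ k → k ℕ.≤ D → ∑ ts (λ (p : ℤ × ℕ) → proj₁ p * t ^ proj₂ p) ≡ (t - 1ℤ) ^ k * tail k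
    go zero _ = sym (*-identityˡ _)
    go (suc k) k<D = trans (go k (ℕ.<⇒≤ k<D)) (trans (cong ((t - 1ℤ) ^ k *_) (step k<D)) (alg ((t - 1ℤ) ^ k) (t - 1ℤ) (tail (suc k))))
      where
      alg : ∀ a b c → a * (b * c) ≡ b * a * c
      alg = solve-∀

-- Divisibility of a combination of approximate powers.

module Combination where

  open import Data.Integer using (ℤ; +_; 0ℤ; 1ℤ; _+_; _-_; _*_; -_; _^_; ∣_∣)
  open import Data.Integer.Divisibility.Signed
  open import Data.Integer.Properties
  open import Data.Integer.Tactic.RingSolver using (solve-∀)
  open import Data.List using (map)
  open Sums
  open Poly
  open Vanishing

  ∑-map : ∀ {A B : Set} (g : A → B) xs f → ∑ (map g xs) f ≡ ∑ xs (λ x → f (g x))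
  ∑-map g [] f = refl
  ∑-map g (x ∷ xs) f = cong (λ z → f (g x) + z) (∑-map g xs f)

  ^-*ℤ : ∀ a b k → (a * b) ^ k ≡ a ^ k * b ^ k
  ^-*ℤ a b zero = refl
  ^-*ℤ a b (suc k) = trans (cong (a * b *_) (^-*ℤ a b k)) (alg a b (a ^ k) (b ^ k))
    where
    alg : ∀ a b c d → a * b * (c * d) ≡ a * c * (b * d)
    alg = solve-∀

  1^ℤ : ∀ k → 1ℤ ^ k ≡ 1ℤ
  1^ℤ zero = refl
  1^ℤ (suc k) = trans (*-identityˡ (1ℤ ^ k)) (1^ℤ k)

  ∣^∣ : ∀ x k → ∣ x ^ k ∣ ≡ ∣ x ∣ ℕ.^ k
  ∣^∣ x zero = refl
  ∣^∣ x (suc k) = trans (∣i*j∣≡∣i∣*∣j∣ x (x ^ k)) (cong (∣ x ∣ ℕ.*_) (∣^∣ x k))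

  module _ (n : ℤ) where
    open Modular n

    -- Modulo n the values are W times powers of a single t, so the combination becomes W times a
    -- polynomial with a zero of order D at t = 1. The factor g allows for the case where only g (t
    -- - 1) is known to be small.
    combination-small : ∀ {A : Set} {D} g t W (c₀ : ℤ) (n₀ : ℕ) (v₀ : ℤ) (I : List A) (c : A → ℤ) (nd : A → ℕ) (v : A → ℤ) →
      (∀ {q} → Poly D q → c₀ * q (+ n₀) + ∑ I (λ e → c e * q (+ nd e)) ≡ 0ℤ) →
      v₀ ≈ W * t ^ n₀ → (∀ {e} → e ∈ I → v e ≈ W * t ^ nd e) → (g * (t - 1ℤ)) ^ D ≈ 0ℤ →
      n ∣ g ^ D * (c₀ * v₀ + ∑ I (λ e → c e * v e))
    combination-small {A} {D} g t W c₀ n₀ v₀ I c nd v ann v₀≈ v≈ t≈1 = ≈0⇒∣ (begin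
      g ^ D * (c₀ * v₀ + ∑ I (λ e → c e * v e))
        ≈⟨ *-congˡ (g ^ D) {c₀ * v₀ + ∑ I (λ e → c e * v e)} {c₀ * (W * t ^ n₀) + ∑ I (λ e → c e * (W * t ^ nd e))}
             (+-cong (*-congˡ c₀ v₀≈) (∑-≈ I λ {e} e∈ → *-congˡ (c e) (v≈ e∈))) ⟩
      g ^ D * (c₀ * (W * t ^ n₀) + ∑ I (λ e → c e * (W * t ^ nd e)))
        ≡⟨ cong (g ^ D *_) (cong₂ _+_ (alg c₀ W (t ^ n₀))
             (trans (∑-cong I (λ {e} _ → alg (c e) W (t ^ nd e))) (∑-* W I (λ e → c e * t ^ nd e)))) ⟩
      g ^ D * (W * (c₀ * t ^ n₀) + W * ∑ I (λ e → c e * t ^ nd e))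
        ≡⟨ cong (g ^ D *_) (sym (*-distribˡ-+ W (c₀ * t ^ n₀) (∑ I (λ e → c e * t ^ nd e)))) ⟩
      g ^ D * (W * (c₀ * t ^ n₀ + ∑ I (λ e → c e * t ^ nd e)))
        ≡⟨ cong (λ y → g ^ D * (W * y)) (trans (sym (∑-terms (t ^_))) (proj₂ vanishing)) ⟩
      g ^ D * (W * ((t - 1ℤ) ^ D * ρ))             ≡⟨ alg′ (g ^ D) W ((t - 1ℤ) ^ D) ρ ⟩
      g ^ D * (t - 1ℤ) ^ D * (W * ρ)               ≡⟨ cong (_* (W * ρ)) (sym (^-*ℤ g (t - 1ℤ) D)) ⟩
      (g * (t - 1ℤ)) ^ D * (W * ρ)                 ≈⟨ *-congʳ (W * ρ) t≈1 ⟩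
      0ℤ * (W * ρ)                                 ≡⟨ *-zeroˡ (W * ρ) ⟩
      0ℤ ∎)
      where
      terms : List (ℤ × ℕ)
      terms = (c₀ , n₀) ∷ map (λ e → c e , nd e) I
      ∑-terms : ∀ (f : ℕ → ℤ) → ∑ terms (λ (p : ℤ × ℕ) → proj₁ p * f (proj₂ p)) ≡ c₀ * f n₀ + ∑ I (λ e → c e * f (nd e))
      ∑-terms f = cong (λ z → c₀ * f n₀ + z) (∑-map (λ e → c e , nd e) I (λ p → proj₁ p * f (proj₂ p)))
      vanishing = annihilates⇒vanishing terms (λ {q} p → trans (∑-terms (λ e → q (+ e))) (ann p)) t
      ρ = proj₁ vanishing
      alg : ∀ k w x → k * (w * x) ≡ w * (k * x)
      alg = solve-∀
      alg′ : ∀ g w y p → g * (w * (y * p)) ≡ g * y * (w * p)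
      alg′ = solve-∀

-- The auxiliary value: nonzero, bounded, and highly divisible.

module Auxiliary (r N J M Λ : ℕ) (J<r : J ℕ.< r) (fits : r ℕ.* suc N ℕ.+ r ℕ.≤ M)
    (Λ>0 : 0 ℕ.< Λ) (∣Λ : ∀ k → 0 ℕ.< k → k ℕ.≤ M → k ℕ.∣ Λ) where

  open import Data.Integer using (ℤ; +_; 0ℤ; 1ℤ; _+_; _-_; _*_; -_; _^_; ∣_∣)
  open import Data.Integer.Divisibility.Signed
  open import Data.Integer.Properties
  open import Data.Integer.Tactic.RingSolver using (solve-∀)
  open Sums
  open Poly
  open Combination
  open Grid r N J M Λ J<r fits Λ>0 ∣Λ

  ≢0-^ : ∀ {x} k → x ≢ 0ℤ → x ^ k ≢ 0ℤ
  ≢0-^ {x} k x≢0 e = x≢0 (i^n≡0⇒i≡0 x k e)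

  ≢0-* : ∀ {x y} → x ≢ 0ℤ → y ≢ 0ℤ → x * y ≢ 0ℤ
  ≢0-* {x} x≢0 y≢0 e = [ x≢0 , y≢0 ]′ (i*j≡0⇒i≡0∨j≡0 x e)

  L D : ℕ
  L = suc N
  D = suc J ℕ.* suc N

  module Value (U V P Q : ℤ) where

    -- This is (U / V) ^ i · (P / Q) ^ j with its denominators cleared by V ^ L · Q ^ J; i reaches L
    -- = N + 1 at the extra node.
    value : Index → ℤ
    value (j , i) = U ^ i * V ^ (L ℕ.∸ i) * (P ^ j * Q ^ (J ℕ.∸ j))

    value-step : ∀ j i → i ℕ.≤ N → V * value (j , suc i) ≡ U * value (j , i)
    value-step j i i≤N = trans (alg V (U ^ i) U (V ^ (N ℕ.∸ i)) (P ^ j * Q ^ (J ℕ.∸ j)))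
      (cong (λ k → U * (U ^ i * V ^ k * (P ^ j * Q ^ (J ℕ.∸ j)))) (sym (ℕ.+-∸-assoc 1 i≤N)))
      where
      alg : ∀ v a u b c → v * (u * a * b * c) ≡ u * (a * (v * b) * c)
      alg = solve-∀

    value-bound : ∀ {A B} → ∣ U ∣ ℕ.≤ A → ∣ V ∣ ℕ.≤ A → ∣ P ∣ ℕ.≤ B → ∣ Q ∣ ℕ.≤ B →
                  ∀ {j i} → j ℕ.≤ J → i ℕ.≤ L → ∣ value (j , i) ∣ ℕ.≤ A ℕ.^ L ℕ.* B ℕ.^ J
    value-bound {A} {B} u v p q {j} {i} j≤J i≤L = ℕ.≤-trans
      (ℕ.≤-reflexive (∣i*j∣≡∣i∣*∣j∣ (U ^ i * V ^ (L ℕ.∸ i)) (P ^ j * Q ^ (J ℕ.∸ j))))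
      (ℕ.*-mono-≤ (pair U V u v i≤L) (pair P Q p q j≤J))
      where
      pair : ∀ x y {C i n} → ∣ x ∣ ℕ.≤ C → ∣ y ∣ ℕ.≤ C → i ℕ.≤ n → ∣ x ^ i * y ^ (n ℕ.∸ i) ∣ ℕ.≤ C ℕ.^ n
      pair x y {C} {i} {n} x≤ y≤ i≤n = ℕ.≤-trans
        (ℕ.≤-reflexive (trans (∣i*j∣≡∣i∣*∣j∣ (x ^ i) (y ^ (n ℕ.∸ i))) (cong₂ ℕ._*_ (∣^∣ x i) (∣^∣ y (n ℕ.∸ i)))))
        (ℕ.≤-trans (ℕ.*-mono-≤ (ℕ.^-monoˡ-≤ i x≤) (ℕ.^-monoˡ-≤ (n ℕ.∸ i) y≤))
          (ℕ.≤-reflexive (trans (sym (ℕ.^-distribˡ-+-* C i (n ℕ.∸ i))) (cong (C ℕ.^_) (ℕ.m+[n∸m]≡n i≤n)))))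

    value≢0 : U ≢ 0ℤ → V ≢ 0ℤ → P ≢ 0ℤ → Q ≢ 0ℤ → ∀ e → value e ≢ 0ℤ
    value≢0 u v p q (j , i) = ≢0-* (≢0-* (≢0-^ i u) (≢0-^ (L ℕ.∸ i) v)) (≢0-* (≢0-^ j p) (≢0-^ (J ℕ.∸ j) q))

    module Small (n g Q⁻¹ V⁻¹ : ℤ) (Q-unit : n ∣ Q * Q⁻¹ - 1ℤ) (V-unit : n ∣ V * V⁻¹ - 1ℤ)
                 (P≈Q : n ∣ (g * (P - Q)) ^ D) (U/V≈Pʳ/Qʳ : n ∣ P ^ r * V - Q ^ r * U) where
      open Modular n

      t z : ℤ
      t = P * Q⁻¹
      z = U * V⁻¹

      QQ⁻¹ : Q * Q⁻¹ ≈ 1ℤ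
      QQ⁻¹ = mod Q-unit

      VV⁻¹ : V * V⁻¹ ≈ 1ℤ
      VV⁻¹ = mod V-unit

      one^ : ∀ {x} k → x ≈ 1ℤ → x ^ k ≈ 1ℤ
      one^ {x} k p = ≈-trans (^-cong k p) (reflexive (1^ℤ k))

      z≈tʳ : z ≈ t ^ r
      z≈tʳ = begin
        U * V⁻¹                            ≡⟨ sym (*-identityʳ (U * V⁻¹)) ⟩
        U * V⁻¹ * 1ℤ                       ≈⟨ *-congˡ (U * V⁻¹) (≈-sym (one^ r QQ⁻¹)) ⟩
        U * V⁻¹ * (Q * Q⁻¹) ^ r            ≡⟨ cong (U * V⁻¹ *_) (^-*ℤ Q Q⁻¹ r) ⟩
        U * V⁻¹ * (Q ^ r * Q⁻¹ ^ r)        ≡⟨ alg U V⁻¹ (Q ^ r) (Q⁻¹ ^ r) ⟩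
        V⁻¹ * Q⁻¹ ^ r * (Q ^ r * U)        ≈⟨ *-congˡ (V⁻¹ * Q⁻¹ ^ r) (≈-sym (mod U/V≈Pʳ/Qʳ)) ⟩
        V⁻¹ * Q⁻¹ ^ r * (P ^ r * V)        ≡⟨ alg′ V⁻¹ (Q⁻¹ ^ r) (P ^ r) V ⟩
        V * V⁻¹ * (P ^ r * Q⁻¹ ^ r)        ≈⟨ *-congʳ (P ^ r * Q⁻¹ ^ r) VV⁻¹ ⟩
        1ℤ * (P ^ r * Q⁻¹ ^ r)             ≡⟨ *-identityˡ (P ^ r * Q⁻¹ ^ r) ⟩
        P ^ r * Q⁻¹ ^ r                    ≡⟨ sym (^-*ℤ P Q⁻¹ r) ⟩
        t ^ r ∎
        where
        alg : ∀ u v a b → u * v * (a * b) ≡ v * b * (a * u)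
        alg = solve-∀
        alg′ : ∀ v b p w → v * b * (p * w) ≡ w * v * (p * b)
        alg′ = solve-∀

      homogenise : ∀ x y y⁻¹ → y * y⁻¹ ≈ 1ℤ → ∀ {i n} → i ℕ.≤ n → x ^ i * y ^ (n ℕ.∸ i) ≈ y ^ n * (x * y⁻¹) ^ i
      homogenise x y y⁻¹ unit {i} {n} i≤n = ≈-sym (begin
        y ^ n * (x * y⁻¹) ^ i                       ≡⟨ cong₂ _*_ (trans (cong (y ^_) (sym (ℕ.m∸n+n≡m i≤n))) (^-distribˡ-+-* y (n ℕ.∸ i) i)) (^-*ℤ x y⁻¹ i) ⟩
        y ^ (n ℕ.∸ i) * y ^ i * (x ^ i * y⁻¹ ^ i)   ≡⟨ alg (y ^ (n ℕ.∸ i)) (y ^ i) (x ^ i) (y⁻¹ ^ i) ⟩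
        x ^ i * y ^ (n ℕ.∸ i) * (y ^ i * y⁻¹ ^ i)   ≡⟨ cong (x ^ i * y ^ (n ℕ.∸ i) *_) (sym (^-*ℤ y y⁻¹ i)) ⟩
        x ^ i * y ^ (n ℕ.∸ i) * (y * y⁻¹) ^ i       ≈⟨ *-congˡ (x ^ i * y ^ (n ℕ.∸ i)) (one^ i unit) ⟩
        x ^ i * y ^ (n ℕ.∸ i) * 1ℤ                  ≡⟨ *-identityʳ (x ^ i * y ^ (n ℕ.∸ i)) ⟩
        x ^ i * y ^ (n ℕ.∸ i) ∎)
        where
        alg : ∀ a b c d → a * b * (c * d) ≡ c * a * (b * d)
        alg = solve-∀

      value≈ : ∀ {j i} → j ℕ.≤ J → i ℕ.≤ L → value (j , i) ≈ V ^ L * Q ^ J * t ^ node (j , i)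
      value≈ {j} {i} j≤J i≤L = begin
        U ^ i * V ^ (L ℕ.∸ i) * (P ^ j * Q ^ (J ℕ.∸ j))
          ≈⟨ *-cong (homogenise U V V⁻¹ VV⁻¹ i≤L) (homogenise P Q Q⁻¹ QQ⁻¹ j≤J) ⟩
        V ^ L * z ^ i * (Q ^ J * t ^ j)          ≡⟨ alg (V ^ L) (z ^ i) (Q ^ J) (t ^ j) ⟩
        V ^ L * Q ^ J * (z ^ i * t ^ j)          ≈⟨ *-congˡ (V ^ L * Q ^ J) (*-congʳ (t ^ j) (^-cong i z≈tʳ)) ⟩
        V ^ L * Q ^ J * ((t ^ r) ^ i * t ^ j)    ≡⟨ cong (V ^ L * Q ^ J *_) (trans (cong (_* t ^ j) (^-*-assoc t r i)) (sym (^-distribˡ-+-* t (r ℕ.* i) j))) ⟩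
        V ^ L * Q ^ J * t ^ node (j , i) ∎
        where
        alg : ∀ a b c d → a * b * (c * d) ≡ a * c * (b * d)
        alg = solve-∀

      t≈1 : (g * (t - 1ℤ)) ^ D ≈ 0ℤ
      t≈1 = begin
        x                                        ≡⟨ sym (*-identityʳ x) ⟩
        x * 1ℤ                                   ≈⟨ *-congˡ x (≈-sym (one^ D QQ⁻¹)) ⟩
        x * (Q * Q⁻¹) ^ D                        ≡⟨ sym (^-*ℤ (g * (t - 1ℤ)) (Q * Q⁻¹) D) ⟩
        (g * (t - 1ℤ) * (Q * Q⁻¹)) ^ D           ≡⟨ cong (_^ D) (alg g P Q⁻¹ Q) ⟩
        (g * (P * (Q * Q⁻¹) - Q) * Q⁻¹) ^ D      ≡⟨ ^-*ℤ (g * (P * (Q * Q⁻¹) - Q)) Q⁻¹ D ⟩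
        (g * (P * (Q * Q⁻¹) - Q)) ^ D * Q⁻¹ ^ D  ≈⟨ *-congʳ (Q⁻¹ ^ D) (^-cong D (*-congˡ g (+-cong (*-congˡ P QQ⁻¹) (≈-refl { - Q})))) ⟩
        (g * (P * 1ℤ - Q)) ^ D * Q⁻¹ ^ D         ≡⟨ cong (λ y → (g * (y - Q)) ^ D * Q⁻¹ ^ D) (*-identityʳ P) ⟩
        (g * (P - Q)) ^ D * Q⁻¹ ^ D              ≈⟨ *-congʳ (Q⁻¹ ^ D) (∣⇒≈0 P≈Q) ⟩
        0ℤ * Q⁻¹ ^ D                             ≡⟨ *-zeroˡ (Q⁻¹ ^ D) ⟩
        0ℤ ∎
        where
        x = (g * (t - 1ℤ)) ^ D
        alg : ∀ g p s q → g * (p * s - 1ℤ) * (q * s) ≡ g * (p * (q * s) - q) * s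
        alg = solve-∀

      module _ (h : ℕ) (h≤J : h ℕ.≤ J) where
        open Extra h h≤J

        small : n ∣ g ^ D * divided value (value extra)
        small = combination-small n {D = D} g t (V ^ L * Q ^ J) (κ₀ * + Λ) (node extra) (value extra)
          grid (λ e → κ e * ρ e) node value
          (λ {q} p → divided-poly Δ≢0 {q} (subst (λ n → Poly n q) (sym length-grid) p))
          (value≈ h≤J ℕ.≤-refl)
          (λ e∈ → value≈ (proj₁ (∈-grid⁻ e∈)) (ℕ.m≤n⇒m≤1+n (proj₂ (∈-grid⁻ e∈))))
          t≈1

  record AuxiliaryValue (n g : ℤ) (A B : ℕ) : Set where
    field
      G     : ℤ
      G≢0   : G ≢ 0ℤ
      n∣G   : n ∣ g ^ D * G
      ∣G∣≤  : ∣ G ∣ ℕ.≤ suc D ℕ.* (weightBound ℕ.* (A ℕ.^ L ℕ.* B ℕ.^ J))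

  auxiliary : ∀ U V P Q n g Q⁻¹ V⁻¹ {A B} →
    n ∣ Q * Q⁻¹ - 1ℤ → n ∣ V * V⁻¹ - 1ℤ → n ∣ (g * (P - Q)) ^ D → n ∣ P ^ r * V - Q ^ r * U →
    U ≢ 0ℤ → V ≢ 0ℤ → P ≢ 0ℤ → Q ≢ 0ℤ → U ≢ V →
    ∣ U ∣ ℕ.≤ A → ∣ V ∣ ℕ.≤ A → ∣ P ∣ ℕ.≤ B → ∣ Q ∣ ℕ.≤ B →
    AuxiliaryValue n g A B
  auxiliary U V P Q n g Q⁻¹ V⁻¹ qu vu pq uv u≢0 v≢0 p≢0 q≢0 u≢v u≤ v≤ p≤ q≤ =
    result (nonvanishing value u≢v value-step (value≢0 u≢0 v≢0 p≢0 q≢0 (0 , 0)))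
    where
    open Value U V P Q
    open Small n g Q⁻¹ V⁻¹ qu vu pq uv
    result : (∃ λ h → ∃ λ (h≤J : h ℕ.≤ J) → Extra.divided h h≤J value (value (h , suc N)) ≢ 0ℤ) → AuxiliaryValue n g _ _
    result (h , h≤J , ≢0) = record
      { G    = Extra.divided h h≤J value (value (h , suc N))
      ; G≢0  = ≢0
      ; n∣G  = small h h≤J
      ; ∣G∣≤ = ∣divided∣≤ h h≤J value (value-bound u≤ v≤ p≤ q≤)
      }

-- Iterated squaring.

module Squaring where

  open import Data.Integer using (ℤ; +_; _*_; _^_; ∣_∣)
  open import Data.Integer.Properties
  open Combination using (∣^∣)

  abstract
    pow : ℤ → ℕ → ℤ
    pow x n = x ^ (2 ℕ.^ n)

    pow-+ : ∀ x n j → pow x (n ℕ.+ j) ≡ pow x n ^ (2 ℕ.^ j)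
    pow-+ x n j = trans (cong (x ^_) (ℕ.^-distribˡ-+-* 2 n j)) (sym (^-*-assoc x (2 ℕ.^ n) (2 ℕ.^ j)))

    pow-def : ∀ x n → pow x n ≡ x ^ (2 ℕ.^ n)
    pow-def x n = refl

  pow-suc : ∀ x n → pow x (suc n) ≡ pow x n * pow x n
  pow-suc x n = trans (cong (pow x) (ℕ.+-comm 1 n)) (trans (pow-+ x n 1) (cong (pow x n *_) (*-identityʳ (pow x n))))

  ∣pow∣ : ∀ x n → ∣ pow x n ∣ ≡ ∣ x ∣ ℕ.^ (2 ℕ.^ n)
  ∣pow∣ x n = trans (cong ∣_∣ (pow-def x n)) (∣^∣ x (2 ℕ.^ n))

-- Congruences along orbits and descent through p-adic square roots.

module Orbit (a b c d : ℤ.ℤ) (coprime-ab : Coprime ℤ.∣ a ∣ ℤ.∣ b ∣) (coprime-cd : Coprime ℤ.∣ c ∣ ℤ.∣ d ∣) where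

  open import Data.Integer using (ℤ; +_; 0ℤ; _+_; _-_; _*_; -_; _^_; ∣_∣)
  open import Data.Integer.Divisibility.Signed
  open import Data.Integer.Properties
  open import Data.Integer.Tactic.RingSolver using (solve-∀)
  open import Data.Nat.Divisibility using (divides)
  open import Data.Nat.Primality using (¬prime[1]; euclidsLemma; prime⇒nonZero)
  open Lcm using (coprime-^; prime∤⇒coprime)
  open Combination using (^-*ℤ)
  open Squaring

  coprime-pow : ∀ n → Coprime ∣ pow a n ∣ ∣ pow b n ∣
  coprime-pow n = subst₂ Coprime (sym (∣pow∣ a n)) (sym (∣pow∣ b n))
    (coprime-^ (2 ℕ.^ n) (Coprimality.sym (coprime-^ (2 ℕ.^ n) (Coprimality.sym coprime-ab))))

  -- The numerator of φⁿ(a / b) - c / d.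
  ξ : ℕ → ℤ
  ξ n = pow a n * d - c * pow b n

  -- (x , y) and (z , w) are the same point of the projective line modulo n.
  record SamePoint (n x y z w : ℤ) : Set where
    constructor same
    field cross : n ∣ x * w - z * y
  open SamePoint

  module _ {n : ℤ} where
    open Modular n

    same-sym : ∀ {x y z w} → SamePoint n x y z w → SamePoint n z w x y
    same-sym {x} {y} {z} {w} (same h) = same (subst (n ∣_) (alg x y z w) (∣m⇒∣-m h))
      where
      alg : ∀ x y z w → - (x * w - z * y) ≡ z * y - x * w
      alg = solve-∀

    coprime-cancel : ∀ {z w X} → Coprime ∣ z ∣ ∣ w ∣ → n ∣ z * X → n ∣ w * X → n ∣ X
    coprime-cancel {z} {w} {X} cop p q = ∣ᵤ⇒∣ (Coprimality.coprime-factors cop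
      (subst (∣ n ∣ ℕ.∣_) (∣i*j∣≡∣i∣*∣j∣ z X) (∣⇒∣ᵤ p) , subst (∣ n ∣ ℕ.∣_) (∣i*j∣≡∣i∣*∣j∣ w X) (∣⇒∣ᵤ q)))

    -- With zero divisors modulo n the middle coordinates cannot be divided out. Elimination shows
    -- that both z and w times the wanted cross difference are divisible by n, and their coprimality
    -- removes them.
    same-trans : ∀ {x y z w u v} → Coprime ∣ z ∣ ∣ w ∣ → SamePoint n x y z w → SamePoint n z w u v → SamePoint n x y u v
    same-trans {x} {y} {z} {w} {u} {v} cop (same p) (same q) = same (coprime-cancel {z} {w} cop
      (subst (n ∣_) (alg₁ x y z w u v) (∣m∣n⇒∣m+n (∣n⇒∣m*n u p) (∣n⇒∣m*n x q)))
      (subst (n ∣_) (alg₂ x y z w u v) (∣m∣n⇒∣m+n (∣n⇒∣m*n v p) (∣n⇒∣m*n y q))))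
      where
      alg₁ : ∀ x y z w u v → u * (x * w - z * y) + x * (z * v - u * w) ≡ z * (x * v - u * y)
      alg₁ = solve-∀
      alg₂ : ∀ x y z w u v → v * (x * w - z * y) + y * (z * v - u * w) ≡ w * (x * v - u * y)
      alg₂ = solve-∀

    same-^ : ∀ {x y z w} k → SamePoint n x y z w → SamePoint n (x ^ k) (y ^ k) (z ^ k) (w ^ k)
    same-^ {x} {y} {z} {w} k (same p) = same (subst (n ∣_) (cong₂ _-_ (^-*ℤ x w k) (^-*ℤ z y k)) (∣- (^-cong k (mod p))))

    orbit-^ : ∀ m j → n ∣ ξ m → SamePoint n (pow a (m ℕ.+ j)) (pow b (m ℕ.+ j)) (pow c j) (pow d j)
    orbit-^ m j h = subst₂ (λ x y → SamePoint n x y (pow c j) (pow d j)) (sym (pow-+ a m j)) (sym (pow-+ b m j))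
      (subst₂ (λ x y → SamePoint n (pow a m ^ (2 ℕ.^ j)) (pow b m ^ (2 ℕ.^ j)) x y) (sym (pow-def c j)) (sym (pow-def d j))
        (same-^ (2 ℕ.^ j) (same h)))

    -- Both points equal φ ^ (m + j) (α) modulo n: one because α meets β after m steps, the other
    -- because it meets β again after m + j steps.
    target-periodic : ∀ m j → n ∣ ξ m → n ∣ ξ (m ℕ.+ j) → SamePoint n (pow c j) (pow d j) c d
    target-periodic m j p q = same-trans (coprime-pow (m ℕ.+ j)) (same-sym (orbit-^ m j p)) (same q)

    orbit-same : ∀ m m′ → n ∣ ξ m → n ∣ ξ m′ → SamePoint n (pow a m) (pow b m) (pow a m′) (pow b m′)
    orbit-same m m′ p q = same-trans {z = c} {w = d} coprime-cd (same p) (same-sym (same q))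

    coprime-pow-cd : ∀ s → Coprime ∣ pow c s ∣ ∣ pow d s ∣
    coprime-pow-cd s = subst₂ Coprime (sym (∣pow∣ c s)) (sym (∣pow∣ d s))
      (coprime-^ (2 ℕ.^ s) (Coprimality.sym (coprime-^ (2 ℕ.^ s) (Coprimality.sym coprime-cd))))

    -- From index m₁ on, α follows the orbit of β modulo n, and the hits at m₂ and m₂ + j make β
    -- periodic. Since m₁ may lie far below m₂, this carries periodicity down to the levels where
    -- square roots are taken.
    orbit-periodic : ∀ m₁ s m₂ j → n ∣ ξ m₁ → n ∣ ξ m₂ → n ∣ ξ (m₂ ℕ.+ j) →
      SamePoint n (pow a (m₁ ℕ.+ s ℕ.+ j)) (pow b (m₁ ℕ.+ s ℕ.+ j)) (pow a (m₁ ℕ.+ s)) (pow b (m₁ ℕ.+ s))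
    orbit-periodic m₁ s m₂ j h₁ h₂ h₃ = subst (λ k → SamePoint n (pow a k) (pow b k) (pow a (m₁ ℕ.+ s)) (pow b (m₁ ℕ.+ s)))
      (trans (cong (m₁ ℕ.+_) (ℕ.+-comm j s)) (sym (ℕ.+-assoc m₁ s j)))
      (same-trans (coprime-pow-cd (j ℕ.+ s)) (orbit-^ m₁ (j ℕ.+ s) h₁)
        (same-trans (coprime-pow-cd s) periodic (same-sym (orbit-^ m₁ s h₁))))
      where
      periodic : SamePoint n (pow c (j ℕ.+ s)) (pow d (j ℕ.+ s)) (pow c s) (pow d s)
      periodic = subst₂ (λ x y → SamePoint n x y (pow c s) (pow d s)) (sym (pow-+ c j s)) (sym (pow-+ d j s))
        (subst₂ (λ x y → SamePoint n (pow c j ^ (2 ℕ.^ s)) (pow d j ^ (2 ℕ.^ s)) x y) (sym (pow-def c s)) (sym (pow-def d s))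
          (same-^ (2 ℕ.^ s) (target-periodic m₂ j h₂ h₃)))

  -- Cross difference of φ ^ (m + j) (α) and φ ^ m (α); raising m by one turns it into a difference
  -- of squares.
  diff : ℕ → ℕ → ℤ
  diff j m = pow a (m ℕ.+ j) * pow b m - pow a m * pow b (m ℕ.+ j)

  diff-suc : ∀ j m → diff j (suc m) ≡ diff j m * (pow a (m ℕ.+ j) * pow b m + pow a m * pow b (m ℕ.+ j))
  diff-suc j m = trans (cong₂ _-_ (cong₂ _*_ (pow-suc a (m ℕ.+ j)) (pow-suc b m)) (cong₂ _*_ (pow-suc a m) (pow-suc b (m ℕ.+ j))))
    (alg (pow a (m ℕ.+ j)) (pow b m) (pow a m) (pow b (m ℕ.+ j)))
    where
    alg : ∀ x y z w → x * x * (y * y) - z * z * (w * w) ≡ (x * y - z * w) * (x * y + z * w)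
    alg = solve-∀

  targetDiff : ℕ → ℤ
  targetDiff j = pow c j * d - c * pow d j

  ∣∣⇒≤ : ∀ {n x} → x ≢ 0ℤ → + n ∣ x → n ℕ.≤ ∣ x ∣
  ∣∣⇒≤ {n} {x} x≢0 h = ℕ.∣⇒≤ {{ℕ.≢-nonZero (λ e → x≢0 (∣i∣≡0⇒i≡0 e))}} (∣⇒∣ᵤ h)

  module PrimePower {p : ℕ} (prime : Prime p) where

    instance
      nonZero-p : ℕ.NonZero p
      nonZero-p = prime⇒nonZero prime

    -- Euclid's lemma deals the K factors p out one at a time to X or to S, and f counts those that
    -- go to S.
    splitPower : ∀ K X S → p ℕ.^ K ℕ.∣ X ℕ.* S → ∃ λ f → p ℕ.^ f ℕ.∣ S × p ℕ.^ K ℕ.∣ p ℕ.^ f ℕ.* X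
    splitPower zero X S _ = 0 , ℕ.1∣ S , ℕ.1∣ _
    splitPower (suc K) X S h with euclidsLemma X S prime (ℕ.∣-trans (ℕ.m∣m*n (p ℕ.^ K)) h)
    ... | inj₁ (divides X′ refl) with splitPower K X′ S (ℕ.*-cancelˡ-∣ p (subst (p ℕ.^ suc K ℕ.∣_) eq h))
      where
      eq : X′ ℕ.* p ℕ.* S ≡ p ℕ.* (X′ ℕ.* S)
      eq = trans (cong (ℕ._* S) (ℕ.*-comm X′ p)) (ℕ.*-assoc p X′ S)
    ...   | f , d₁ , d₂ = f , d₁ , subst (p ℕ.^ suc K ℕ.∣_) eq′ (ℕ.*-monoʳ-∣ p d₂)
      where
      eq′ : p ℕ.* (p ℕ.^ f ℕ.* X′) ≡ p ℕ.^ f ℕ.* (X′ ℕ.* p)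
      eq′ = trans (ℕ.*-comm p _) (ℕ.*-assoc (p ℕ.^ f) X′ p)
    splitPower (suc K) X S h | inj₂ (divides S′ refl) with splitPower K X S′ (ℕ.*-cancelˡ-∣ p (subst (p ℕ.^ suc K ℕ.∣_) eq h))
      where
      eq : X ℕ.* (S′ ℕ.* p) ≡ p ℕ.* (X ℕ.* S′)
      eq = trans (sym (ℕ.*-assoc X S′ p)) (ℕ.*-comm (X ℕ.* S′) p)
    ...   | f , d₁ , d₂ = suc f , subst (p ℕ.^ suc f ℕ.∣_) (ℕ.*-comm p S′) (ℕ.*-monoʳ-∣ p d₁) ,
      subst (p ℕ.^ suc K ℕ.∣_) (sym (ℕ.*-assoc p (p ℕ.^ f) X)) (ℕ.*-monoʳ-∣ p d₂)

    ^-mono-∣ : ∀ {e f} → e ℕ.≤ f → p ℕ.^ e ℕ.∣ p ℕ.^ f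
    ^-mono-∣ {e} {f} e≤f = subst (p ℕ.^ e ℕ.∣_) (trans (sym (ℕ.^-distribˡ-+-* p e (f ℕ.∸ e))) (cong (p ℕ.^_) (ℕ.m+[n∸m]≡n e≤f)))
      (ℕ.m∣m*n (p ℕ.^ (f ℕ.∸ e)))

    ∣-cancelʳ : ∀ {κ} x y → ¬ p ℕ.∣ ∣ y ∣ → + (p ℕ.^ κ) ∣ x * y → + (p ℕ.^ κ) ∣ x
    ∣-cancelʳ {κ} x y p∤y h = ∣ᵤ⇒∣ (Coprimality.coprime-divisor (coprime-^ κ (prime∤⇒coprime prime p∤y))
      (subst (p ℕ.^ κ ℕ.∣_) (trans (∣i*j∣≡∣i∣*∣j∣ x y) (ℕ.*-comm ∣ x ∣ ∣ y ∣)) (∣⇒∣ᵤ h)))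

    ∤-* : ∀ {x y} → ¬ p ℕ.∣ x → ¬ p ℕ.∣ y → ¬ p ℕ.∣ x ℕ.* y
    ∤-* {x} {y} p∤x p∤y h = [ p∤x , p∤y ]′ (euclidsLemma x y prime h)

    ∤-1 : ¬ p ℕ.∣ 1
    ∤-1 h = ¬prime[1] (subst Prime (ℕ.∣1⇒≡1 h) prime)

    ∤-^ : ∀ {x} k → ¬ p ℕ.∣ x → ¬ p ℕ.∣ x ℕ.^ k
    ∤-^ zero p∤x = ∤-1
    ∤-^ (suc k) p∤x = ∤-* p∤x (∤-^ k p∤x)

    ∤-pow : ∀ {x} n → ¬ p ℕ.∣ ∣ x ∣ → ¬ p ℕ.∣ ∣ pow x n ∣
    ∤-pow {x} n p∤x = subst (λ y → ¬ p ℕ.∣ y) (sym (∣pow∣ x n)) (∤-^ (2 ℕ.^ n) p∤x)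

    -- For p = 2 the factor S may contribute one factor 2, which 2 * X absorbs.
    cancel-2 : ∀ {κ K} X S → (∀ f → f ℕ.≤ κ → p ℕ.^ f ℕ.∣ S → p ℕ.^ f ℕ.∣ 2) → ¬ p ℕ.^ κ ℕ.∣ 2 →
               p ℕ.^ K ℕ.∣ X ℕ.* S → p ℕ.^ K ℕ.∣ 2 ℕ.* X
    cancel-2 {κ} {K} X S bounded ∤2 h with splitPower K X S h
    ... | f , d₁ , d₂ with ℕ.≤-total f κ
    ...   | inj₁ f≤κ = ℕ.∣-trans d₂ (ℕ.*-monoˡ-∣ X (bounded f f≤κ d₁))
    ...   | inj₂ κ≤f = ⊥-elim (∤2 (bounded κ ℕ.≤-refl (ℕ.∣-trans (^-mono-∣ κ≤f) d₁)))

    -- The exponent 2 ^ (j + 1) is at least 2, so the cofactor of x still contains x; this is what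
    -- `∤-difference` relies on.
    pow-pred : ∀ x j → ∃ λ e → pow x (suc j) ≡ x * x ^ suc e
    pow-pred x j with 2 ℕ.^ j in eq | ℕ.m^n>0 2 j
    ... | suc e | _ = e ℕ.+ (e ℕ.+ 0) , trans (pow-def x (suc j)) (cong (x ^_) (trans (cong (λ y → y ℕ.+ (y ℕ.+ 0)) eq)
      (cong suc (ℕ.+-suc e (e ℕ.+ 0)))))

    ∤-difference : ∀ x y k → ¬ p ℕ.∣ ∣ x ∣ → p ℕ.∣ ∣ y ∣ → ∀ z → ¬ p ℕ.∣ ∣ x - z * y ^ suc k ∣
    ∤-difference x y k p∤x p∣y z h = p∤x (∣⇒∣ᵤ {+ p} {x} (subst (+ p ∣_) (alg x (z * y ^ suc k))
      (∣m∣n⇒∣m+n (∣ᵤ⇒∣ {+ p} {x - z * y ^ suc k} h) (∣n⇒∣m*n z (∣m⇒∣m*n (y ^ k) (∣ᵤ⇒∣ {+ p} {y} p∣y))))))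
      where
      alg : ∀ x y → x - y + y ≡ x
      alg = solve-∀

    -- After extracting d from `targetDiff`, the cofactor is prime to p if p divides d, because then
    -- p does not divide c. All of p ^ κ would have to divide d, which is too small.
    target-unit-d : ∀ {κ} j → + (p ℕ.^ κ) ∣ targetDiff (suc j) → ∣ d ∣ ℕ.< p ℕ.^ κ → d ≢ 0ℤ → ¬ p ℕ.∣ ∣ d ∣
    target-unit-d {κ} j h T< d≢0 p∣d with pow-pred d j
    ... | e , eq = ℕ.<⇒≱ T< (∣∣⇒≤ d≢0 (∣-cancelʳ {κ} d (pow c (suc j) - c * d ^ suc e) p∤ (subst (+ (p ℕ.^ κ) ∣_) eq′ h)))
      where
      p∤c : ¬ p ℕ.∣ ∣ c ∣
      p∤c p∣c = ∤-1 (ℕ.∣-reflexive (coprime-cd (p∣c , p∣d)))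
      p∤ = ∤-difference (pow c (suc j)) d e (∤-pow (suc j) p∤c) p∣d c
      eq′ : targetDiff (suc j) ≡ d * (pow c (suc j) - c * d ^ suc e)
      eq′ = trans (cong (λ z → pow c (suc j) * d - c * z) eq) (alg (pow c (suc j)) d c (d ^ suc e))
        where
        alg : ∀ x d c y → x * d - c * (d * y) ≡ d * (x - c * y)
        alg = solve-∀

    target-unit-c : ∀ {κ} j → + (p ℕ.^ κ) ∣ targetDiff (suc j) → ∣ c ∣ ℕ.< p ℕ.^ κ → c ≢ 0ℤ → ¬ p ℕ.∣ ∣ c ∣
    target-unit-c {κ} j h T< c≢0 p∣c with pow-pred c j
    ... | e , eq = ℕ.<⇒≱ T< (∣∣⇒≤ c≢0 (∣-cancelʳ {κ} c (pow d (suc j) - d * c ^ suc e) p∤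
        (subst (+ (p ℕ.^ κ) ∣_) eq′ (∣m⇒∣-m h))))
      where
      p∤d : ¬ p ℕ.∣ ∣ d ∣
      p∤d p∣d = ∤-1 (ℕ.∣-reflexive (coprime-cd (p∣c , p∣d)))
      p∤ = ∤-difference (pow d (suc j)) c e (∤-pow (suc j) p∤d) p∣c d
      eq′ : - targetDiff (suc j) ≡ c * (pow d (suc j) - d * c ^ suc e)
      eq′ = trans (cong (λ z → - (z * d - c * pow d (suc j))) eq) (alg (pow d (suc j)) d c (c ^ suc e))
        where
        alg : ∀ x d c y → - (c * y * d - c * x) ≡ c * (x - d * y)
        alg = solve-∀

    -- Modulo p, ξ n ≡ 0 with c and d units: a prime dividing one of a, b would divide the other,
    -- against coprimality.
    module Unit (p∤c : ¬ p ℕ.∣ ∣ c ∣) (p∤d : ¬ p ℕ.∣ ∣ d ∣) {κ n} (0<κ : 0 ℕ.< κ) (κ∣ξ : + (p ℕ.^ κ) ∣ ξ n) where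

      p∣ξ : + p ∣ ξ n
      p∣ξ = ∣-trans (∣ᵤ⇒∣ {+ p} {+ (p ℕ.^ κ)} (subst (ℕ._∣ p ℕ.^ κ) (ℕ.*-identityʳ p) (^-mono-∣ 0<κ))) κ∣ξ

      ∣-^ : ∀ {x} → p ℕ.∣ ∣ x ∣ → + p ∣ pow x n
      ∣-^ {x} h = subst (+ p ∣_) (sym (pow-def x n)) (go (2 ℕ.^ n) (ℕ.m^n>0 2 n))
        where
        go : ∀ k → 0 ℕ.< k → + p ∣ x ^ k
        go (suc k) _ = ∣m⇒∣m*n (x ^ k) (∣ᵤ⇒∣ {+ p} {x} h)

      p∤a : ¬ p ℕ.∣ ∣ a ∣
      p∤a p∣a = ∤-* p∤c (∤-pow n p∤b) (subst (p ℕ.∣_) (∣i*j∣≡∣i∣*∣j∣ c (pow b n)) (∣⇒∣ᵤ {+ p}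
        (subst (+ p ∣_) (alg (pow a n * d) (c * pow b n)) (∣m∣n⇒∣m-n (∣m⇒∣m*n d (∣-^ p∣a)) p∣ξ))))
        where
        p∤b : ¬ p ℕ.∣ ∣ b ∣
        p∤b p∣b = ∤-1 (ℕ.∣-reflexive (coprime-ab (p∣a , p∣b)))
        alg : ∀ x y → x - (x - y) ≡ y
        alg = solve-∀

      p∤b : ¬ p ℕ.∣ ∣ b ∣
      p∤b p∣b = ∤-* (∤-pow n p∤a′) p∤d (subst (p ℕ.∣_) (∣i*j∣≡∣i∣*∣j∣ (pow a n) d) (∣⇒∣ᵤ {+ p}
        (subst (+ p ∣_) (alg (pow a n * d) (c * pow b n)) (∣m∣n⇒∣m+n p∣ξ (∣n⇒∣m*n c (∣-^ p∣b))))))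
        where
        p∤a′ : ¬ p ℕ.∣ ∣ a ∣
        p∤a′ p∣a = ∤-1 (ℕ.∣-reflexive (coprime-ab (p∣a , p∣b)))
        alg : ∀ x y → x - y + y ≡ x
        alg = solve-∀

    power-∣ : ∀ {e f x} → e ℕ.≤ f → + (p ℕ.^ f) ∣ x → + (p ℕ.^ e) ∣ x
    power-∣ {e} {f} e≤f h = ∣-trans (∣ᵤ⇒∣ {+ (p ℕ.^ e)} {+ (p ℕ.^ f)} (^-mono-∣ e≤f)) h

    module Descent (p∤a : ¬ p ℕ.∣ ∣ a ∣) (p∤b : ¬ p ℕ.∣ ∣ b ∣) {κ} (∤2 : ¬ p ℕ.^ κ ℕ.∣ 2)
                   (n₁ n₂ j : ℕ) (h₁ : + (p ℕ.^ κ) ∣ ξ n₁) (h₂ : + (p ℕ.^ κ) ∣ ξ n₂) (h₃ : + (p ℕ.^ κ) ∣ ξ (n₂ ℕ.+ j)) where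

      sum : ℕ → ℤ
      sum m = pow a (m ℕ.+ j) * pow b m + pow a m * pow b (m ℕ.+ j)

      -- The congruence inherited from n₁ says that the two summands of `sum` agree modulo p ^ f.
      -- Hence p ^ f divides twice a p-adic unit; this is how n₁ decides the sign of the square
      -- root.
      sum-bounded : ∀ s f → f ℕ.≤ κ → p ℕ.^ f ℕ.∣ ∣ sum (n₁ ℕ.+ s) ∣ → p ℕ.^ f ℕ.∣ 2
      sum-bounded s f f≤κ h = ∣⇒∣ᵤ {+ (p ℕ.^ f)} {+ 2} (∣-cancelʳ {f} (+ 2) (pow a (m ℕ.+ j) * pow b m)
        (subst (λ y → ¬ p ℕ.∣ y) (sym (∣i*j∣≡∣i∣*∣j∣ (pow a (m ℕ.+ j)) (pow b m))) (∤-* (∤-pow (m ℕ.+ j) p∤a) (∤-pow m p∤b)))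
        (subst (+ (p ℕ.^ f) ∣_) (alg (pow a (m ℕ.+ j) * pow b m) (pow a m * pow b (m ℕ.+ j)))
          (∣m∣n⇒∣m+n (∣ᵤ⇒∣ {+ (p ℕ.^ f)} {sum m} h)
            (SamePoint.cross (orbit-periodic n₁ s n₂ j (power-∣ f≤κ h₁) (power-∣ f≤κ h₂) (power-∣ f≤κ h₃))))))
        where
        m = n₁ ℕ.+ s
        alg : ∀ x y → x + y + (x - y) ≡ + 2 * x
        alg = solve-∀

      -- Each level undoes one squaring and costs at most a factor 2, which matters for p = 2. The
      -- accumulated 2 ^ k becomes the factor g of the auxiliary value.
      descend : ∀ {K} s k X → p ℕ.^ K ℕ.∣ X ℕ.* ∣ diff j (n₁ ℕ.+ s ℕ.+ k) ∣ → p ℕ.^ K ℕ.∣ 2 ℕ.^ k ℕ.* X ℕ.* ∣ diff j (n₁ ℕ.+ s) ∣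
      descend {K} s zero X h = subst₂ (λ y z → p ℕ.^ K ℕ.∣ y ℕ.* ∣ diff j z ∣) (sym (ℕ.+-identityʳ X)) (ℕ.+-identityʳ (n₁ ℕ.+ s)) h
      descend {K} s (suc k) X h = subst (λ y → p ℕ.^ K ℕ.∣ y ℕ.* ∣ diff j (n₁ ℕ.+ s) ∣)
        (trans (sym (ℕ.*-assoc (2 ℕ.^ k) 2 X)) (cong (ℕ._* X) (ℕ.*-comm (2 ℕ.^ k) 2)))
        (descend {K} s k (2 ℕ.* X) (subst (p ℕ.^ K ℕ.∣_) (sym (ℕ.*-assoc 2 X ∣ diff j (n₁ ℕ.+ s ℕ.+ k) ∣))
          (cancel-2 {κ} {K} (X ℕ.* ∣ diff j (n₁ ℕ.+ s ℕ.+ k) ∣) ∣ sum (n₁ ℕ.+ s ℕ.+ k) ∣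
            (λ f f≤κ h′ → sum-bounded (s ℕ.+ k) f f≤κ (subst (λ y → p ℕ.^ f ℕ.∣ ∣ sum y ∣) (ℕ.+-assoc n₁ s k) h′)) ∤2
            (subst (p ℕ.^ K ℕ.∣_) eq h))))
        where
        eq : X ℕ.* ∣ diff j (n₁ ℕ.+ s ℕ.+ suc k) ∣ ≡ X ℕ.* ∣ diff j (n₁ ℕ.+ s ℕ.+ k) ∣ ℕ.* ∣ sum (n₁ ℕ.+ s ℕ.+ k) ∣
        eq = trans (cong (X ℕ.*_) (trans (cong (λ y → ∣ diff j y ∣) (ℕ.+-suc (n₁ ℕ.+ s) k))
          (trans (cong ∣_∣ (diff-suc j (n₁ ℕ.+ s ℕ.+ k))) (∣i*j∣≡∣i∣*∣j∣ (diff j (n₁ ℕ.+ s ℕ.+ k)) (sum (n₁ ℕ.+ s ℕ.+ k))))))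
          (sym (ℕ.*-assoc X _ _))

-- The p-adic input of the Thue-Siegel argument.

module Approximation (a b c d : ℤ.ℤ) (coprime-ab : Coprime ℤ.∣ a ∣ ℤ.∣ b ∣) (coprime-cd : Coprime ℤ.∣ c ∣ ℤ.∣ d ∣) where

  open import Data.Integer using (ℤ; +_; 0ℤ; 1ℤ; _+_; _-_; _*_; -_; _^_; ∣_∣)
  open import Data.Integer.Divisibility.Signed
  open import Data.Integer.Properties
  open import Data.Integer.Tactic.RingSolver using (solve-∀)
  open import Data.Nat.Divisibility using (divides)
  open import Data.Nat.GCD using (module Bézout)
  open Lcm using (coprime-^; prime∤⇒coprime)
  open Combination using (^-*ℤ)
  open Orbit a b c d coprime-ab coprime-cd
  open Squaring

  modularInverse : ∀ n x → Coprime n ∣ x ∣ → ∃ λ y → + n ∣ x * y - 1ℤ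
  modularInverse n x cop with natural (Coprimality.coprime-Bézout cop)
    where
    natural : Bézout.Identity 1 n ∣ x ∣ → ∃ λ y → + n ∣ + ∣ x ∣ * y - 1ℤ
    natural (Bézout.+- u v eq) = - + v , divides (- + u) (trans (alg (+ ∣ x ∣) (+ v))
      (cong -_ (trans (cong (λ y → 1ℤ + y) (sym (pos-* v ∣ x ∣))) (trans (sym (pos-+ 1 (v ℕ.* ∣ x ∣))) (trans (cong +_ eq) (pos-* u n)))))
      ■ neg-distribˡ-* (+ u) (+ n))
      where
      infixl 1 _■_
      _■_ = trans
      alg : ∀ x v → x * - v - 1ℤ ≡ - (1ℤ + v * x)
      alg = solve-∀
    natural (Bézout.-+ u v eq) = + v , divides (+ u) (trans (alg (+ ∣ x ∣) (+ v))
      (trans (cong (_- 1ℤ) (trans (sym (pos-* v ∣ x ∣)) (trans (cong +_ (sym eq)) (trans (pos-+ 1 (u ℕ.* n)) (cong (λ y → 1ℤ + y) (pos-* u n))))))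
        (alg′ (+ u * + n))))
      where
      alg : ∀ x v → x * v - 1ℤ ≡ v * x - 1ℤ
      alg = solve-∀
      alg′ : ∀ y → 1ℤ + y - 1ℤ ≡ y
      alg′ = solve-∀
  ... | y , h with +∣i∣≡i⊎+∣i∣≡-i x
  ...   | inj₁ eq = y , subst (λ z → + n ∣ z * y - 1ℤ) eq h
  ...   | inj₂ eq = - y , subst (+ n ∣_) (cong (_- 1ℤ) (trans (cong (_* y) eq) (alg x y))) h
    where
    alg : ∀ x y → - x * y ≡ x * - y
    alg = solve-∀

  ∣-^ℤ : ∀ {x y} k → x ∣ y → x ^ k ∣ y ^ k
  ∣-^ℤ {x} k (divides q eq) = divides (q ^ k) (trans (cong (_^ k) eq) (^-*ℤ q x k))

  pos-^ : ∀ m k → + (m ℕ.^ k) ≡ (+ m) ^ k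
  pos-^ m zero = refl
  pos-^ m (suc k) = trans (pos-* m (m ℕ.^ k)) (cong (+ m *_) (pos-^ m k))

  pow≢0 : ∀ {x} n → x ≢ 0ℤ → pow x n ≢ 0ℤ
  pow≢0 {x} n x≢0 e = x≢0 (i^n≡0⇒i≡0 x (2 ℕ.^ n) (trans (sym (pow-def x n)) e))

  ∣pow∣≤ : ∀ {x H} n → ∣ x ∣ ℕ.≤ H → ∣ pow x n ∣ ℕ.≤ H ℕ.^ (2 ℕ.^ n)
  ∣pow∣≤ {x} n h = ℕ.≤-trans (ℕ.≤-reflexive (∣pow∣ x n)) (ℕ.^-monoˡ-≤ (2 ℕ.^ n) h)

  ∣*∣≤ : ∀ x y {A B} → ∣ x ∣ ℕ.≤ A → ∣ y ∣ ℕ.≤ B → ∣ x * y ∣ ℕ.≤ A ℕ.* B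
  ∣*∣≤ x y p q = ℕ.≤-trans (ℕ.≤-reflexive (∣i*j∣≡∣i∣*∣j∣ x y)) (ℕ.*-mono-≤ p q)

  module Siegel {H T : ℕ} (a≢0 : a ≢ 0ℤ) (b≢0 : b ≢ 0ℤ) (c≢0 : c ≢ 0ℤ) (d≢0 : d ≢ 0ℤ)
                (a≤H : ∣ a ∣ ℕ.≤ H) (b≤H : ∣ b ∣ ℕ.≤ H) (c≤T : ∣ c ∣ ℕ.≤ T) (d≤T : ∣ d ∣ ℕ.≤ T) (2≤T : 2 ℕ.≤ T)
                {p : ℕ} (prime : Prime p) {κ K K₃ : ℕ} (n₁ s k j₀ : ℕ) where

    open PrimePower prime

    m n₂ j n₃ : ℕ
    m  = n₁ ℕ.+ s
    n₂ = m ℕ.+ k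
    j  = suc j₀
    n₃ = n₂ ℕ.+ j

    module Bound (T<pκ : T ℕ.< p ℕ.^ κ)
                 (κ₁ : + (p ℕ.^ κ) ∣ ξ n₁) (κ₂ : + (p ℕ.^ κ) ∣ ξ n₂) (κ₃ : + (p ℕ.^ κ) ∣ ξ n₃)
                 (K∣ξ₂ : + (p ℕ.^ K) ∣ ξ n₂) (K∣ξ₃ : + (p ℕ.^ K) ∣ ξ n₃) (K₃∣ξ₃ : + (p ℕ.^ K₃) ∣ ξ n₃) (ξ₂≢0 : ξ n₂ ≢ 0ℤ)
                 (N J M Λ : ℕ) (J<r : J ℕ.< 2 ℕ.^ k) (fits : 2 ℕ.^ k ℕ.* suc N ℕ.+ 2 ℕ.^ k ℕ.≤ M)
                 (Λ>0 : 0 ℕ.< Λ) (∣Λ : ∀ l → 0 ℕ.< l → l ℕ.≤ M → l ℕ.∣ Λ) where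

      open Auxiliary (2 ℕ.^ k) N J M Λ J<r fits Λ>0 ∣Λ
      open Grid (2 ℕ.^ k) N J M Λ J<r fits Λ>0 ∣Λ using (weightBound)

      target : + (p ℕ.^ κ) ∣ targetDiff j
      target = SamePoint.cross (target-periodic n₂ j κ₂ κ₃)

      p∤c = target-unit-c {κ} j₀ target (ℕ.≤-<-trans c≤T T<pκ) c≢0
      p∤d = target-unit-d {κ} j₀ target (ℕ.≤-<-trans d≤T T<pκ) d≢0

      0<κ : 0 ℕ.< κ
      0<κ = positive κ T<pκ
        where
        positive : ∀ κ → T ℕ.< p ℕ.^ κ → 0 ℕ.< κ
        positive zero T<1 with ℕ.≤-trans 2≤T (ℕ.≤-pred T<1)
        ... | ()
        positive (suc κ) _ = ℕ.s≤s ℕ.z≤n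

      open Unit p∤c p∤d {κ} {n₂} 0<κ κ₂
      open Descent p∤a p∤b {κ} (λ h → ℕ.<⇒≱ T<pκ (ℕ.≤-trans (ℕ.∣⇒≤ h) 2≤T)) n₁ n₂ j κ₁ κ₂ κ₃

      -- (P / Q) ^ (2 ^ k) and U / V are p-adically close, and P / Q is p-adically close to 1.
      P Q U V : ℤ
      P = pow a (m ℕ.+ j) * pow b m
      Q = pow a m * pow b (m ℕ.+ j)
      U = c * pow b n₂
      V = d * pow a n₂

      -- K * D stems from the zero of order D at s = 1, K₃ from replacing s ^ r by U / V; the
      -- smaller of the two exponents survives.
      μ : ℕ
      μ = K ℕ.* D ℕ.⊓ K₃

      unit : ∀ x y → ¬ p ℕ.∣ ∣ x ∣ → ¬ p ℕ.∣ ∣ y ∣ → ∃ λ z → + (p ℕ.^ μ) ∣ x * y * z - 1ℤ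
      unit x y p∤x p∤y = modularInverse (p ℕ.^ μ) (x * y) (coprime-^ μ (prime∤⇒coprime prime
        (subst (λ z → ¬ p ℕ.∣ z) (sym (∣i*j∣≡∣i∣*∣j∣ x y)) (∤-* p∤x p∤y))))

      Q-inverse = unit (pow a m) (pow b (m ℕ.+ j)) (∤-pow m p∤a) (∤-pow (m ℕ.+ j) p∤b)
      V-inverse = unit d (pow a n₂) p∤d (∤-pow n₂ p∤a)

      P≈Q : + (p ℕ.^ μ) ∣ (+ (2 ℕ.^ k) * (P - Q)) ^ D
      P≈Q = power-∣ (ℕ.m⊓n≤m (K ℕ.* D) K₃) (subst (_∣ (+ (2 ℕ.^ k) * (P - Q)) ^ D) pᴷ^D (∣-^ℤ D base))
        where
        pᴷ^D : (+ (p ℕ.^ K)) ^ D ≡ + (p ℕ.^ (K ℕ.* D))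
        pᴷ^D = trans (sym (pos-^ (p ℕ.^ K) D)) (cong +_ (ℕ.^-*-assoc p K D))
        start : p ℕ.^ K ℕ.∣ 1 ℕ.* ∣ diff j n₂ ∣
        start = subst (p ℕ.^ K ℕ.∣_) (sym (ℕ.*-identityˡ _)) (∣⇒∣ᵤ (SamePoint.cross (orbit-same n₃ n₂ K∣ξ₃ K∣ξ₂)))
        base : + (p ℕ.^ K) ∣ + (2 ℕ.^ k) * (P - Q)
        base = ∣ᵤ⇒∣ {+ (p ℕ.^ K)} {+ (2 ℕ.^ k) * (P - Q)} (subst (p ℕ.^ K ℕ.∣_)
          (trans (cong (ℕ._* ∣ P - Q ∣) (ℕ.*-identityʳ (2 ℕ.^ k))) (sym (∣i*j∣≡∣i∣*∣j∣ (+ (2 ℕ.^ k)) (P - Q))))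
          (descend {K} s k 1 start))

      pow-r : ∀ x n → pow x n ^ (2 ℕ.^ k) ≡ pow x (n ℕ.+ k)
      pow-r x n = sym (pow-+ x n k)

      m+j+k : m ℕ.+ j ℕ.+ k ≡ n₃
      m+j+k = trans (ℕ.+-assoc m j k) (trans (cong (m ℕ.+_) (ℕ.+-comm j k)) (sym (ℕ.+-assoc m k j)))

      -- (P / Q) ^ (2 ^ k) is α ^ (2 ^ n₃) / α ^ (2 ^ n₂), and U / V is β / α ^ (2 ^ n₂); their
      -- cross difference is therefore a multiple of `ξ n₃`.
      U/V≈Pʳ/Qʳ : + (p ℕ.^ μ) ∣ P ^ (2 ℕ.^ k) * V - Q ^ (2 ℕ.^ k) * U
      U/V≈Pʳ/Qʳ = power-∣ (ℕ.m⊓n≤n (K ℕ.* D) K₃) (subst (+ (p ℕ.^ K₃) ∣_) eq (∣n⇒∣m*n (pow a n₂ * pow b n₂) K₃∣ξ₃))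
        where
        alg : ∀ x y z w c d → z * w * (x * d - c * y) ≡ x * w * (d * z) - z * y * (c * w)
        alg = solve-∀
        eq : pow a n₂ * pow b n₂ * ξ n₃ ≡ P ^ (2 ℕ.^ k) * V - Q ^ (2 ℕ.^ k) * U
        eq = trans (alg (pow a n₃) (pow b n₃) (pow a n₂) (pow b n₂) c d) (sym (cong₂ (λ x y → x * V - y * U)
          (trans (^-*ℤ (pow a (m ℕ.+ j)) (pow b m) (2 ℕ.^ k)) (cong₂ _*_ (trans (pow-r a (m ℕ.+ j)) (cong (pow a) m+j+k)) (pow-r b m)))
          (trans (^-*ℤ (pow a m) (pow b (m ℕ.+ j)) (2 ℕ.^ k)) (cong₂ _*_ (pow-r a m) (trans (pow-r b (m ℕ.+ j)) (cong (pow b) m+j+k))))))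

      A B : ℕ
      A = T ℕ.* H ℕ.^ (2 ℕ.^ n₂)
      B = H ℕ.^ (2 ℕ.^ (m ℕ.+ j)) ℕ.* H ℕ.^ (2 ℕ.^ m)

      U≢V : U ≢ V
      U≢V e = ξ₂≢0 (trans (cong (λ z → z - c * pow b n₂) (trans (*-comm (pow a n₂) d) (sym e))) (+-inverseʳ U))

      auxiliaryValue : AuxiliaryValue (+ (p ℕ.^ μ)) (+ (2 ℕ.^ k)) A B
      auxiliaryValue = auxiliary U V P Q (+ (p ℕ.^ μ)) (+ (2 ℕ.^ k)) (proj₁ Q-inverse) (proj₁ V-inverse)
        (proj₂ Q-inverse) (proj₂ V-inverse) P≈Q U/V≈Pʳ/Qʳ
        (≢0-* c≢0 (pow≢0 n₂ b≢0)) (≢0-* d≢0 (pow≢0 n₂ a≢0)) (≢0-* (pow≢0 (m ℕ.+ j) a≢0) (pow≢0 m b≢0)) (≢0-* (pow≢0 m a≢0) (pow≢0 (m ℕ.+ j) b≢0)) U≢V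
        (∣*∣≤ c (pow b n₂) c≤T (∣pow∣≤ n₂ b≤H)) (∣*∣≤ d (pow a n₂) d≤T (∣pow∣≤ n₂ a≤H))
        (∣*∣≤ (pow a (m ℕ.+ j)) (pow b m) (∣pow∣≤ (m ℕ.+ j) a≤H) (∣pow∣≤ m b≤H))
        (ℕ.≤-trans (∣*∣≤ (pow a m) (pow b (m ℕ.+ j)) (∣pow∣≤ m a≤H) (∣pow∣≤ (m ℕ.+ j) b≤H)) (ℕ.≤-reflexive (ℕ.*-comm (H ℕ.^ (2 ℕ.^ m)) _)))

      -- The Liouville step: a nonzero integer divisible by `p ^ μ` has at least that absolute
      -- value.
      auxiliary-bound : p ℕ.^ μ ℕ.≤ (2 ℕ.^ k) ℕ.^ D ℕ.* (suc D ℕ.* (weightBound ℕ.* (A ℕ.^ L ℕ.* B ℕ.^ J)))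
      auxiliary-bound = ℕ.≤-trans (∣∣⇒≤ (≢0-* (≢0-^ D 2ᵏ≢0) G≢0) n∣G)
        (ℕ.≤-trans (ℕ.≤-reflexive (trans (∣i*j∣≡∣i∣*∣j∣ ((+ (2 ℕ.^ k)) ^ D) G) (cong (ℕ._* ∣ G ∣) (cong ∣_∣ (sym (pos-^ (2 ℕ.^ k) D))))))
          (ℕ.*-monoʳ-≤ ((2 ℕ.^ k) ℕ.^ D) ∣G∣≤))
        where
        open AuxiliaryValue auxiliaryValue
        2ᵏ≢0 : + (2 ℕ.^ k) ≢ 0ℤ
        2ᵏ≢0 e = ℕ.>⇒≢ (ℕ.m^n>0 2 k) (+-injective e)

-- Numerical estimates for the auxiliary value.

module Sizes where

  open import Data.Nat
  open import Data.Nat.Properties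
  open import Data.Nat.Tactic.RingSolver using (solve-∀)

  n<2^n : ∀ n → n < 2 ^ n
  n<2^n zero = s≤s z≤n
  n<2^n (suc n) = ≤-trans (s≤s (n<2^n n)) (≤-trans (+-monoˡ-≤ (2 ^ n) (m^n>0 2 n)) (≤-reflexive (cong (2 ^ n +_) (sym (+-identityʳ (2 ^ n))))))

  ^-*-dist : ∀ x y n → (x * y) ^ n ≡ x ^ n * y ^ n
  ^-*-dist x y zero = refl
  ^-*-dist x y (suc n) = trans (cong (x * y *_) (^-*-dist x y n)) (alg x y (x ^ n) (y ^ n))
    where
    alg : ∀ x y a b → x * y * (a * b) ≡ x * a * (y * b)
    alg = solve-∀

  -- The summands belong to (2 ^ k) ^ D, to suc D ≤ 2 ^ D, to the 8 q column weights and to the last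
  -- Λ; κ will be 2 ^ k. They add up to at most 60 q κ L, rounded to 64 so that the threshold for
  -- the height can be a power of two.
  exponent : ∀ q κ k L → 1 ≤ q → 1 ≤ κ → k ≤ κ →
             k * (8 * q * L) + (8 * q * L + ((L + 4 * (κ * L)) * (8 * q) + 4 * (κ * L))) ≤ 64 * (q * κ * L)
  exponent q κ k L 1≤q 1≤κ k≤κ = begin
    k * (8 * q * L) + (8 * q * L + ((L + 4 * (κ * L)) * (8 * q) + 4 * (κ * L)))
      ≤⟨ +-mono-≤ (*-monoˡ-≤ (8 * q * L) k≤κ) (+-mono-≤ (m≤n*m (8 * q * L) κ)
           (+-mono-≤ (*-monoˡ-≤ (8 * q) (+-monoˡ-≤ (4 * (κ * L)) (m≤n*m L κ))) (*-monoʳ-≤ 4 (m≤n*m (κ * L) q)))) ⟩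
    κ * (8 * q * L) + (κ * (8 * q * L) + ((κ * L + 4 * (κ * L)) * (8 * q) + 4 * (q * (κ * L))))
      ≡⟨ alg q κ L ⟩
    60 * (q * κ * L)
      ≤⟨ *-monoˡ-≤ (q * κ * L) (m≤m+n 60 4) ⟩
    64 * (q * κ * L) ∎
    where
    open ≤-Reasoning
    instance
      _ = >-nonZero 1≤q
      _ = >-nonZero 1≤κ
    alg : ∀ q κ L → κ * (8 * q * L) + (κ * (8 * q * L) + ((κ * L + 4 * (κ * L)) * (8 * q) + 4 * (q * (κ * L)))) ≡ 60 * (q * κ * L)
    alg = solve-∀

  module _ {q κ k L N J : ℕ} (1≤q : 1 ≤ q) (1≤κ : 1 ≤ κ) (k≤κ : k ≤ κ) (L≡ : suc N ≡ L) (J≡ : suc J ≡ 8 * q) where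

    private
      D = suc J * suc N

      D≡ : D ≡ 8 * q * L
      D≡ = cong₂ _*_ J≡ L≡

    -- The exponent is linear in L, so X ^ L absorbs all constants as soon as X ≥ 2 ^ (64 q κ),
    -- however large L is.
    constants-bound : ∀ {Λ} → Λ ≤ 2 ^ (4 * (κ * L)) →
      (2 ^ k) ^ D * (suc D * ((2 ^ N * Λ) ^ suc J * Λ)) ≤ 2 ^ (64 * (q * κ * L))
    constants-bound {Λ} Λ≤ = begin
      (2 ^ k) ^ D * (suc D * ((2 ^ N * Λ) ^ suc J * Λ))
        ≤⟨ *-monoʳ-≤ ((2 ^ k) ^ D) (*-mono-≤ (n<2^n D) (*-mono-≤ (^-monoˡ-≤ (suc J)
             (*-mono-≤ (^-monoʳ-≤ 2 (≤-trans (n≤1+n N) (≤-reflexive L≡))) Λ≤)) Λ≤)) ⟩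
      (2 ^ k) ^ D * (2 ^ D * ((2 ^ L * 2 ^ w) ^ suc J * 2 ^ w))
        ≡⟨ cong₂ (λ x y → (2 ^ k) ^ x * (2 ^ x * ((2 ^ L * 2 ^ w) ^ y * 2 ^ w))) D≡ J≡ ⟩
      (2 ^ k) ^ (8 * q * L) * (2 ^ (8 * q * L) * ((2 ^ L * 2 ^ w) ^ (8 * q) * 2 ^ w))
        ≡⟨ cong₂ _*_ (^-*-assoc 2 k (8 * q * L)) (cong (2 ^ (8 * q * L) *_) (cong (_* 2 ^ w)
             (trans (cong (_^ (8 * q)) (sym (^-distribˡ-+-* 2 L w))) (^-*-assoc 2 (L + w) (8 * q))))) ⟩
      2 ^ (k * (8 * q * L)) * (2 ^ (8 * q * L) * (2 ^ ((L + w) * (8 * q)) * 2 ^ w))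
        ≡⟨ cong (2 ^ (k * (8 * q * L)) *_) (trans (cong (2 ^ (8 * q * L) *_) (sym (^-distribˡ-+-* 2 ((L + w) * (8 * q)) w)))
             (sym (^-distribˡ-+-* 2 (8 * q * L) _))) ⟩
      2 ^ (k * (8 * q * L)) * 2 ^ (8 * q * L + ((L + w) * (8 * q) + w))
        ≡⟨ sym (^-distribˡ-+-* 2 (k * (8 * q * L)) _) ⟩
      2 ^ (k * (8 * q * L) + (8 * q * L + ((L + w) * (8 * q) + w)))
        ≤⟨ ^-monoʳ-≤ 2 (exponent q κ k L 1≤q 1≤κ k≤κ) ⟩
      2 ^ (64 * (q * κ * L)) ∎
      where
      open ≤-Reasoning
      w = 4 * (κ * L)

    -- D = 8 q L, while the auxiliary value Z is at most X ^ (5 L).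
    size-contradiction : ∀ {Λ X T B Z} → Λ ≤ 2 ^ (4 * (κ * L)) → 2 ^ (64 * (q * κ)) ≤ X → T ≤ X → B ^ J ≤ X ^ (2 * L) →
      Z ≤ (2 ^ k) ^ D * (suc D * ((2 ^ N * Λ) ^ suc J * Λ * ((T * X) ^ suc N * B ^ J))) → X ^ D ≤ Z ^ q → ⊥
    size-contradiction {Λ} {X} {T} {B} {Z} Λ≤ X≥ T≤ B≤ Z≤ low = <⇒≱ smaller (≤-trans low (≤-trans (^-monoˡ-≤ q Z≤X) (≤-reflexive (^-*-assoc X (5 * L) q))))
      where
      open ≤-Reasoning
      1≤L : 1 ≤ L
      1≤L = subst (1 ≤_) L≡ (s≤s z≤n)
      1<X : 1 < X
      1<X = ≤-trans (^-monoʳ-≤ 2 (≤-trans (s≤s z≤n) (*-mono-≤ {1} {64} (s≤s z≤n) (*-mono-≤ 1≤q 1≤κ)))) X≥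
      instance
        _ = >-nonZero (<-trans (s≤s z≤n) 1<X)
        _ = >-nonZero 1≤q
        _ = >-nonZero 1≤L
      Z≤X : Z ≤ X ^ (5 * L)
      Z≤X = begin
        Z ≤⟨ Z≤ ⟩
        (2 ^ k) ^ D * (suc D * ((2 ^ N * Λ) ^ suc J * Λ * ((T * X) ^ suc N * B ^ J)))
          ≡⟨ alg ((2 ^ k) ^ D) (suc D) ((2 ^ N * Λ) ^ suc J * Λ) ((T * X) ^ suc N * B ^ J) ⟩
        (2 ^ k) ^ D * (suc D * ((2 ^ N * Λ) ^ suc J * Λ)) * ((T * X) ^ suc N * B ^ J)
          ≤⟨ *-mono-≤ (constants-bound Λ≤) (*-mono-≤ (^-monoˡ-≤ (suc N) (*-monoˡ-≤ X T≤)) B≤) ⟩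
        2 ^ (64 * (q * κ * L)) * ((X * X) ^ suc N * X ^ (2 * L))
          ≡⟨ cong₂ (λ x y → x * (y * X ^ (2 * L)))
               (trans (cong (2 ^_) (sym (*-assoc 64 (q * κ) L))) (sym (^-*-assoc 2 (64 * (q * κ)) L)))
               (trans (cong ((X * X) ^_) L≡) (trans (^-*-dist X X L) (sym (^-distribˡ-+-* X L L)))) ⟩
        (2 ^ (64 * (q * κ))) ^ L * (X ^ (L + L) * X ^ (2 * L))
          ≤⟨ *-monoˡ-≤ (X ^ (L + L) * X ^ (2 * L)) (^-monoˡ-≤ L X≥) ⟩
        X ^ L * (X ^ (L + L) * X ^ (2 * L))
          ≡⟨ trans (cong (X ^ L *_) (sym (^-distribˡ-+-* X (L + L) (2 * L)))) (sym (^-distribˡ-+-* X L _)) ⟩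
        X ^ (L + (L + L + 2 * L))
          ≡⟨ cong (X ^_) (alg′ L) ⟩
        X ^ (5 * L) ∎
        where
        alg : ∀ a b c e → a * (b * (c * e)) ≡ a * (b * c) * e
        alg = solve-∀
        alg′ : ∀ L → L + (L + L + 2 * L) ≡ 5 * L
        alg′ = solve-∀
      smaller : X ^ (5 * L * q) < X ^ D
      smaller = ^-monoʳ-< X 1<X (subst (5 * L * q <_) (sym D≡) (subst₂ _<_ (alg₅ L q) (alg₈ L q) (*-monoˡ-< (L * q) {{m*n≢0 L q}} (m≤m+n 6 2))))
        where
        alg₅ : ∀ L q → 5 * (L * q) ≡ 5 * L * q
        alg₅ = solve-∀
        alg₈ : ∀ L q → 8 * (L * q) ≡ 8 * q * L
        alg₈ = solve-∀

-- Heights, dominated indices, and uniqueness of small ones.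

module Places (a b c d : ℤ.ℤ) (coprime-ab : Coprime ℤ.∣ a ∣ ℤ.∣ b ∣) (coprime-cd : Coprime ℤ.∣ c ∣ ℤ.∣ d ∣)
    (a≢0 : a ≢ ℤ.0ℤ) (b≢0 : b ≢ ℤ.0ℤ) (c≢0 : c ≢ ℤ.0ℤ) (d≢0 : d ≢ ℤ.0ℤ)
    (∣a∣≢∣b∣ : ℤ.∣ a ∣ ≢ ℤ.∣ b ∣) (∣c∣≢∣d∣ : ℤ.∣ c ∣ ≢ ℤ.∣ d ∣) where

  open import Data.Integer using (ℤ; +_; 0ℤ; _+_; _-_; _*_; -_; ∣_∣)
  open import Data.Integer.Divisibility.Signed using (_∣_)
  open import Data.Integer.Properties
  open import Data.Nat.Tactic.RingSolver using (solve-∀)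
  open Sizes
  open Orbit a b c d coprime-ab coprime-cd
  open Squaring
  open Combination using (∣^∣)
  open Approximation a b c d coprime-ab coprime-cd using (∣pow∣≤; ∣*∣≤; pow≢0)

  H T : ℕ
  H = ∣ a ∣ ℕ.⊔ ∣ b ∣
  T = ∣ c ∣ ℕ.⊔ ∣ d ∣

  abs>0 : ∀ {x} → x ≢ 0ℤ → 0 ℕ.< ∣ x ∣
  abs>0 x≢0 = ℕ.n≢0⇒n>0 (λ e → x≢0 (∣i∣≡0⇒i≡0 e))

  distinct⇒1<⊔ : ∀ {m n} → 0 ℕ.< m → 0 ℕ.< n → m ≢ n → 1 ℕ.< m ℕ.⊔ n
  distinct⇒1<⊔ {m} {n} 0<m 0<n m≢n with ℕ.<-cmp m n
  ... | tri< m<n _ _ = ℕ.≤-trans (ℕ.≤-<-trans 0<m m<n) (ℕ.m≤n⊔m m n)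
  ... | tri≈ _ m≡n _ = ⊥-elim (m≢n m≡n)
  ... | tri> _ _ n<m = ℕ.≤-trans (ℕ.≤-<-trans 0<n n<m) (ℕ.m≤m⊔n m n)

  1<H : 1 ℕ.< H
  1<H = distinct⇒1<⊔ (abs>0 a≢0) (abs>0 b≢0) ∣a∣≢∣b∣

  1<T : 1 ℕ.< T
  1<T = distinct⇒1<⊔ (abs>0 c≢0) (abs>0 d≢0) ∣c∣≢∣d∣

  instance
    nonZero-H : ℕ.NonZero H
    nonZero-H = ℕ.>-nonZero (ℕ.<-trans (ℕ.s≤s ℕ.z≤n) 1<H)
    nonZero-T : ℕ.NonZero T
    nonZero-T = ℕ.>-nonZero (ℕ.<-trans (ℕ.s≤s ℕ.z≤n) 1<T)

  abstract
    X : ℕ → ℕ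
    X n = H ℕ.^ (2 ℕ.^ n)

    X-def : ∀ n → X n ≡ H ℕ.^ (2 ℕ.^ n)
    X-def n = refl

  X-+ : ∀ n j → X (n ℕ.+ j) ≡ X n ℕ.^ (2 ℕ.^ j)
  X-+ n j = trans (X-def (n ℕ.+ j)) (trans (cong (H ℕ.^_) (ℕ.^-distribˡ-+-* 2 n j))
    (trans (sym (ℕ.^-*-assoc H (2 ℕ.^ n) (2 ℕ.^ j))) (cong (ℕ._^ (2 ℕ.^ j)) (sym (X-def n)))))

  X-mono : ∀ {m n} → m ℕ.≤ n → X m ℕ.≤ X n
  X-mono {m} {n} m≤n = subst₂ ℕ._≤_ (sym (X-def m)) (sym (X-def n)) (ℕ.^-monoʳ-≤ H (ℕ.^-monoʳ-≤ 2 m≤n))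

  H²≤X : ∀ {n} → 1 ℕ.≤ n → H ℕ.* H ℕ.≤ X n
  H²≤X {n} 1≤n = ℕ.≤-trans (ℕ.≤-reflexive (trans (cong (H ℕ.*_) (sym (ℕ.*-identityʳ H))) (sym (X-def 1)))) (X-mono 1≤n)

  H≤X : ∀ n → H ℕ.≤ X n
  H≤X n = ℕ.≤-trans (ℕ.≤-reflexive (trans (sym (ℕ.*-identityʳ H)) (sym (X-def 0)))) (X-mono (ℕ.z≤n {n}))

  X>0 : ∀ n → 0 ℕ.< X n
  X>0 n = ℕ.<-≤-trans (ℕ.<-trans (ℕ.s≤s ℕ.z≤n) 1<H) (H≤X n)

  instance
    nonZero-X : ∀ {n} → ℕ.NonZero (X n)
    nonZero-X {n} = ℕ.>-nonZero (X>0 n)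

  ∣powa∣≤X : ∀ n → ∣ pow a n ∣ ℕ.≤ X n
  ∣powa∣≤X n = subst (∣ pow a n ∣ ℕ.≤_) (sym (X-def n)) (∣pow∣≤ n (ℕ.m≤m⊔n ∣ a ∣ ∣ b ∣))

  ∣powb∣≤X : ∀ n → ∣ pow b n ∣ ℕ.≤ X n
  ∣powb∣≤X n = subst (∣ pow b n ∣ ℕ.≤_) (sym (X-def n)) (∣pow∣≤ n (ℕ.m≤n⊔m ∣ a ∣ ∣ b ∣))

  -- Cancelling one x and one y leaves powers of x and of y with the same positive exponent. For
  -- exponent 2 ^ 0 both sides would agree, hence `suc k`.
  powers-≢ : ∀ {x y} k → 0 ℕ.< x → 0 ℕ.< y → x ≢ y → x ℕ.^ (2 ℕ.^ suc k) ℕ.* y ≢ x ℕ.* y ℕ.^ (2 ℕ.^ suc k)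
  powers-≢ {x} {y} k 0<x 0<y x≢y = go (2 ℕ.^ suc k) (ℕ.*-monoʳ-≤ 2 (ℕ.m^n>0 2 k))
    where
    instance
      _ = ℕ.>-nonZero 0<x
      _ = ℕ.>-nonZero 0<y
    cancelled : ∀ e → x ℕ.^ suc e ≢ y ℕ.^ suc e
    cancelled e eq with ℕ.<-cmp x y
    ... | tri< x<y _ _ = ℕ.<⇒≢ (ℕ.^-monoˡ-< (suc e) x<y) eq
    ... | tri≈ _ x≡y _ = x≢y x≡y
    ... | tri> _ _ y<x = ℕ.<⇒≢ (ℕ.^-monoˡ-< (suc e) y<x) (sym eq)
    go : ∀ K → 2 ℕ.≤ K → x ℕ.^ K ℕ.* y ≢ x ℕ.* y ℕ.^ K
    go (suc zero) (ℕ.s≤s ())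
    go (suc (suc e)) _ eq = cancelled e (ℕ.*-cancelˡ-≡ _ _ x (ℕ.*-cancelʳ-≡ _ _ y (trans eq (alg x y (y ℕ.^ suc e)))))
      where
      alg : ∀ x y z → x ℕ.* (y ℕ.* z) ≡ x ℕ.* z ℕ.* y
      alg = solve-∀

  difference-≢0 : ∀ x y z w {X Y Z W} → ∣ x ∣ ≡ X → ∣ y ∣ ≡ Y → ∣ z ∣ ≡ Z → ∣ w ∣ ≡ W → X ℕ.* Y ≢ Z ℕ.* W → x * y - z * w ≢ 0ℤ
  difference-≢0 x y z w refl refl refl refl ne e = ne (trans (sym (∣i*j∣≡∣i∣*∣j∣ x y))
    (trans (cong ∣_∣ (i-j≡0⇒i≡j (x * y) (z * w) e)) (∣i*j∣≡∣i∣*∣j∣ z w)))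

  targetDiff≢0 : ∀ j → targetDiff (suc j) ≢ 0ℤ
  targetDiff≢0 j = difference-≢0 (pow c (suc j)) d c (pow d (suc j)) (∣pow∣ c (suc j)) refl refl (∣pow∣ d (suc j))
    (powers-≢ j (abs>0 c≢0) (abs>0 d≢0) ∣c∣≢∣d∣)

  diff≢0 : ∀ j m → diff (suc j) m ≢ 0ℤ
  diff≢0 j m = difference-≢0 (pow a (m ℕ.+ suc j)) (pow b m) (pow a m) (pow b (m ℕ.+ suc j))
    (∣pow-+∣ a) refl refl (∣pow-+∣ b)
    (powers-≢ j (abs>0 (pow≢0 m a≢0)) (abs>0 (pow≢0 m b≢0)) ne)
    where
    ∣pow-+∣ : ∀ x → ∣ pow x (m ℕ.+ suc j) ∣ ≡ ∣ pow x m ∣ ℕ.^ (2 ℕ.^ suc j)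
    ∣pow-+∣ x = trans (cong ∣_∣ (pow-+ x m (suc j))) (∣^∣ (pow x m) (2 ℕ.^ suc j))
    ne : ∣ pow a m ∣ ≢ ∣ pow b m ∣
    ne eq with ℕ.<-cmp ∣ a ∣ ∣ b ∣ | trans (sym (∣pow∣ a m)) (trans eq (∣pow∣ b m))
    ... | tri< lt _ _ | e = ℕ.<⇒≢ (ℕ.^-monoˡ-< (2 ℕ.^ m) {{ℕ.>-nonZero (ℕ.m^n>0 2 m)}} lt) e
    ... | tri≈ _ e′ _ | _ = ∣a∣≢∣b∣ e′
    ... | tri> _ _ gt | e = ℕ.<⇒≢ (ℕ.^-monoˡ-< (2 ℕ.^ m) {{ℕ.>-nonZero (ℕ.m^n>0 2 m)}} gt) (sym e)

  ∣x-y∣≤ : ∀ x y {B} → ∣ x ∣ ℕ.≤ B → ∣ y ∣ ℕ.≤ B → ∣ x - y ∣ ℕ.≤ 2 ℕ.* B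
  ∣x-y∣≤ x y {B} p q = ℕ.≤-trans (∣i-j∣≤∣i∣+∣j∣ x y) (ℕ.≤-trans (ℕ.+-mono-≤ p q) (ℕ.≤-reflexive (cong (B ℕ.+_) (sym (ℕ.+-identityʳ B)))))

  ∣targetDiff∣≤ : ∀ j → ∣ targetDiff j ∣ ℕ.≤ T ℕ.^ (2 ℕ.^ (j ℕ.+ 2))
  ∣targetDiff∣≤ j = begin
    ∣ targetDiff j ∣ ≤⟨ ∣x-y∣≤ (pow c j * d) (c * pow d j)
        (∣*∣≤ (pow c j) d (∣pow∣≤ j c≤T) d≤T)
        (ℕ.≤-trans (∣*∣≤ c (pow d j) c≤T (∣pow∣≤ j d≤T)) (ℕ.≤-reflexive (ℕ.*-comm T (T ℕ.^ (2 ℕ.^ j))))) ⟩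
    2 ℕ.* (T ℕ.^ (2 ℕ.^ j) ℕ.* T)  ≤⟨ ℕ.*-monoˡ-≤ (T ℕ.^ (2 ℕ.^ j) ℕ.* T) 1<T ⟩
    T ℕ.* (T ℕ.^ (2 ℕ.^ j) ℕ.* T)  ≡⟨ cong (T ℕ.*_) (ℕ.*-comm (T ℕ.^ (2 ℕ.^ j)) T) ⟩
    T ℕ.^ (2 ℕ.+ 2 ℕ.^ j)          ≤⟨ ℕ.^-monoʳ-≤ T exponent≤ ⟩
    T ℕ.^ (2 ℕ.^ (j ℕ.+ 2)) ∎
    where
    open ℕ.≤-Reasoning
    c≤T = ℕ.m≤m⊔n ∣ c ∣ ∣ d ∣
    d≤T = ℕ.m≤n⊔m ∣ c ∣ ∣ d ∣
    alg : ∀ x → 2 ℕ.* x ℕ.+ 2 ℕ.* x ≡ x ℕ.* 4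
    alg = solve-∀
    exponent≤ : 2 ℕ.+ 2 ℕ.^ j ℕ.≤ 2 ℕ.^ (j ℕ.+ 2)
    exponent≤ = begin
      2 ℕ.+ 2 ℕ.^ j                       ≤⟨ ℕ.+-mono-≤ (ℕ.*-monoʳ-≤ 2 (ℕ.m^n>0 2 j)) (ℕ.m≤n*m (2 ℕ.^ j) 2) ⟩
      2 ℕ.* 2 ℕ.^ j ℕ.+ 2 ℕ.* 2 ℕ.^ j     ≡⟨ alg (2 ℕ.^ j) ⟩
      2 ℕ.^ j ℕ.* 4                       ≡⟨ sym (ℕ.^-distribˡ-+-* 2 j 2) ⟩
      2 ℕ.^ (j ℕ.+ 2) ∎

  -- The factor H is what the archimedean estimate costs; for n ≥ 1 it is at most the square root of
  -- `X n`. The comparison with T serves the indices where X n is small.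
  Good : ℕ → Set
  Good n = X n ℕ.≤ H ℕ.* ∣ ξ n ∣ × T ℕ.≤ H ℕ.* ∣ ξ n ∣

  record Dominated (q p n : ℕ) : Set where
    field
      K       : ℕ
      K∣ξ     : + (p ℕ.^ K) ∣ ξ n
      ξ≤      : ∣ ξ n ∣ ℕ.≤ (p ℕ.^ K) ℕ.^ q

  record Candidate (τ p n : ℕ) : Set where
    field
      prime     : Prime p
      1≤n       : 1 ℕ.≤ n
      good      : Good n
      dominated : Dominated (2 ℕ.^ τ) p n
    open Dominated dominated public

    -- For n ≥ 1, H ^ 2 ≤ X n turns X n ≤ H |ξ n| into X n ≤ |ξ n| ^ 2. The square accounts for
    -- `suc τ`, the t of the large case.
    X≤ : X n ℕ.≤ (p ℕ.^ K) ℕ.^ (2 ℕ.^ suc τ)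
    X≤ = ℕ.*-cancelˡ-≤ (X n) (begin
      X n ℕ.* X n                        ≤⟨ ℕ.*-mono-≤ (proj₁ good) (proj₁ good) ⟩
      H ℕ.* ∣ ξ n ∣ ℕ.* (H ℕ.* ∣ ξ n ∣)    ≤⟨ ℕ.*-mono-≤ (ℕ.*-monoʳ-≤ H ξ≤) (ℕ.*-monoʳ-≤ H ξ≤) ⟩
      H ℕ.* z ℕ.* (H ℕ.* z)              ≡⟨ alg H z ⟩
      H ℕ.* H ℕ.* (z ℕ.* z)              ≤⟨ ℕ.*-mono-≤ (H²≤X 1≤n) (ℕ.≤-reflexive (trans (sym (ℕ.^-distribˡ-+-* (p ℕ.^ K) (2 ℕ.^ τ) (2 ℕ.^ τ)))
                                               (cong (λ e → (p ℕ.^ K) ℕ.^ (2 ℕ.^ τ ℕ.+ e)) (sym (ℕ.+-identityʳ (2 ℕ.^ τ)))))) ⟩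
      X n ℕ.* (p ℕ.^ K) ℕ.^ (2 ℕ.^ suc τ) ∎)
      where
      open ℕ.≤-Reasoning
      z = (p ℕ.^ K) ℕ.^ (2 ℕ.^ τ)
      alg : ∀ h z → h ℕ.* z ℕ.* (h ℕ.* z) ≡ h ℕ.* h ℕ.* (z ℕ.* z)
      alg = solve-∀

    ξ≢0 : ξ n ≢ 0ℤ
    ξ≢0 e = ℕ.<⇒≱ (X>0 n) (ℕ.≤-trans (proj₁ good) (ℕ.≤-reflexive (trans (cong (λ x → H ℕ.* ∣ x ∣) e) (ℕ.*-zeroʳ H))))

  ⊓-power : ∀ p {K L} q {B} → B ℕ.≤ (p ℕ.^ K) ℕ.^ q → B ℕ.≤ (p ℕ.^ L) ℕ.^ q → B ℕ.≤ (p ℕ.^ (K ℕ.⊓ L)) ℕ.^ q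
  ⊓-power p {K} {L} q {B} h₁ h₂ with ℕ.⊓-sel K L
  ... | inj₁ e = subst (λ m → B ℕ.≤ (p ℕ.^ m) ℕ.^ q) (sym e) h₁
  ... | inj₂ e = subst (λ m → B ℕ.≤ (p ℕ.^ m) ℕ.^ q) (sym e) h₂

  Small : ℕ → ℕ → Set
  Small τ n = X n ℕ.^ (2 ℕ.^ (τ ℕ.+ 2)) ℕ.< T

  -- The smaller of the two powers of p divides the nonzero `diff`, so it is at most 2 (X m) ^ 2 ≤
  -- (X m) ^ 3, while T is at most H times its 2 ^ τ-th power. The total exponent 1 + 3 · 2 ^ τ ≤ 4
  -- · 2 ^ τ gives the threshold in `Small`.
  small-unique : ∀ {τ p n m} → Candidate τ p n → Candidate τ p m → Small τ m → n ℕ.< m → ⊥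
  small-unique {τ} {p} {n} {m} C C′ small n<m = ℕ.<⇒≱ small (begin
    T                                              ≤⟨ T≤ ⟩
    H ℕ.* (p ℕ.^ κ) ℕ.^ (2 ℕ.^ τ)                  ≤⟨ ℕ.*-mono-≤ (H≤X m) (ℕ.^-monoˡ-≤ (2 ℕ.^ τ) pκ≤) ⟩
    X m ℕ.* (X m ℕ.^ 3) ℕ.^ (2 ℕ.^ τ)              ≡⟨ cong (X m ℕ.*_) (ℕ.^-*-assoc (X m) 3 (2 ℕ.^ τ)) ⟩
    X m ℕ.^ (1 ℕ.+ 3 ℕ.* 2 ℕ.^ τ)                  ≤⟨ ℕ.^-monoʳ-≤ (X m) (ℕ.+-monoˡ-≤ (3 ℕ.* 2 ℕ.^ τ) (ℕ.m^n>0 2 τ)) ⟩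
    X m ℕ.^ (2 ℕ.^ τ ℕ.+ 3 ℕ.* 2 ℕ.^ τ)            ≡⟨ cong (X m ℕ.^_) (trans (alg (2 ℕ.^ τ)) (sym (ℕ.^-distribˡ-+-* 2 τ 2))) ⟩
    X m ℕ.^ (2 ℕ.^ (τ ℕ.+ 2)) ∎)
    where
    open ℕ.≤-Reasoning
    module C = Candidate C
    module C′ = Candidate C′
    open PrimePower C.prime using (power-∣)
    κ = C.K ℕ.⊓ C′.K
    j = m ℕ.∸ suc n
    n+j : n ℕ.+ suc j ≡ m
    n+j = trans (ℕ.+-suc n j) (ℕ.m+[n∸m]≡n n<m)
    alg : ∀ x → x ℕ.+ 3 ℕ.* x ≡ x ℕ.* 4
    alg = solve-∀
    T≤ : T ℕ.≤ H ℕ.* (p ℕ.^ κ) ℕ.^ (2 ℕ.^ τ)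
    T≤ with ℕ.⊓-sel C.K C′.K
    ... | inj₁ e = subst (λ k → T ℕ.≤ H ℕ.* (p ℕ.^ k) ℕ.^ (2 ℕ.^ τ)) (sym e) (ℕ.≤-trans (proj₂ C.good) (ℕ.*-monoʳ-≤ H C.ξ≤))
    ... | inj₂ e = subst (λ k → T ℕ.≤ H ℕ.* (p ℕ.^ k) ℕ.^ (2 ℕ.^ τ)) (sym e) (ℕ.≤-trans (proj₂ C′.good) (ℕ.*-monoʳ-≤ H C′.ξ≤))
    ∣diff : + (p ℕ.^ κ) ∣ diff (suc j) n
    ∣diff = SamePoint.cross (subst (λ k → SamePoint (+ (p ℕ.^ κ)) (pow a k) (pow b k) (pow a n) (pow b n)) (sym n+j)
      (orbit-same m n (power-∣ (ℕ.m⊓n≤n C.K C′.K) C′.K∣ξ) (power-∣ (ℕ.m⊓n≤m C.K C′.K) C.K∣ξ)))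
    pκ≤ : p ℕ.^ κ ℕ.≤ X m ℕ.^ 3
    pκ≤ = begin
      p ℕ.^ κ                  ≤⟨ ∣∣⇒≤ (diff≢0 j n) ∣diff ⟩
      ∣ diff (suc j) n ∣       ≤⟨ ∣x-y∣≤ (pow a (n ℕ.+ suc j) * pow b n) (pow a n * pow b (n ℕ.+ suc j))
        (∣*∣≤ (pow a (n ℕ.+ suc j)) (pow b n) (le a ∣powa∣≤X) (ℕ.≤-trans (∣powb∣≤X n) (X-mono (ℕ.<⇒≤ n<m))))
        (∣*∣≤ (pow a n) (pow b (n ℕ.+ suc j)) (ℕ.≤-trans (∣powa∣≤X n) (X-mono (ℕ.<⇒≤ n<m))) (le b ∣powb∣≤X)) ⟩
      2 ℕ.* (X m ℕ.* X m)      ≤⟨ ℕ.*-monoˡ-≤ (X m ℕ.* X m) (ℕ.≤-trans 1<H (H≤X m)) ⟩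
      X m ℕ.* (X m ℕ.* X m)    ≡⟨ cong (λ y → X m ℕ.* (X m ℕ.* y)) (sym (ℕ.*-identityʳ (X m))) ⟩
      X m ℕ.^ 3 ∎
      where
      le : ∀ x → (∀ k → ∣ pow x k ∣ ℕ.≤ X k) → ∣ pow x (n ℕ.+ suc j) ∣ ℕ.≤ X m
      le x h = subst (λ k → ∣ pow x k ∣ ℕ.≤ X m) (sym n+j) (h m)

-- At most two large indices for each prime.

module Large (a b c d : ℤ.ℤ) (coprime-ab : Coprime ℤ.∣ a ∣ ℤ.∣ b ∣) (coprime-cd : Coprime ℤ.∣ c ∣ ℤ.∣ d ∣)
    (a≢0 : a ≢ ℤ.0ℤ) (b≢0 : b ≢ ℤ.0ℤ) (c≢0 : c ≢ ℤ.0ℤ) (d≢0 : d ≢ ℤ.0ℤ)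
    (∣a∣≢∣b∣ : ℤ.∣ a ∣ ≢ ℤ.∣ b ∣) (∣c∣≢∣d∣ : ℤ.∣ c ∣ ≢ ℤ.∣ d ∣) (τ : ℕ) where

  open import Data.Integer using (ℤ; +_; 0ℤ; _+_; _*_; ∣_∣)
  open import Data.Integer.Divisibility.Signed using (_∣_)
  open import Data.Nat.Tactic.RingSolver using (solve-∀)
  open Lcm using (commonMultiple; commonMultiple>0; commonMultiple≤; ∣commonMultiple)
  open Sizes
  open Orbit a b c d coprime-ab coprime-cd
  open Approximation a b c d coprime-ab coprime-cd using (module Siegel)
  open Places a b c d coprime-ab coprime-cd a≢0 b≢0 c≢0 d≢0 ∣a∣≢∣b∣ ∣c∣≢∣d∣

  -- With q = 2 ^ t these say r = 2 ^ k = 64 q ^ 2 and 2 ^ E = 64 q r. The first makes D = 8 q L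
  -- equal to 2 ^ (k + v) for L = 8 q · 2 ^ v; the second is the exponent of the constants, which T
  -- ^ (2 ^ E) beats because T ≥ 2.
  t k E : ℕ
  t = suc τ
  k = t ℕ.+ (t ℕ.+ 6)
  E = t ℕ.+ (t ℕ.+ (t ℕ.+ 12))

  Large : ℕ → Set
  Large n = T ℕ.^ (2 ℕ.^ E) ℕ.≤ X n

  large-mono : ∀ {m n} → m ℕ.≤ n → Large m → Large n
  large-mono m≤n h = ℕ.≤-trans h (X-mono m≤n)

  ^-cancelʳ-≤ : ∀ {x} m n → 1 ℕ.< x → x ℕ.^ m ℕ.≤ x ℕ.^ n → m ℕ.≤ n
  ^-cancelʳ-≤ {x} m n 1<x h = ℕ.≮⇒≥ (λ n<m → ℕ.<⇒≱ (ℕ.^-monoʳ-< x 1<x n<m) h)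

  module _ {p : ℕ} where

    -- A common power of p divides the nonzero `targetDiff (suc j)`, whose size depends only on T
    -- and j. As X n is bounded by a power of it, a large X n pushes the two candidates far apart.
    gap : ∀ {n} j → Candidate τ p n → Candidate τ p (n ℕ.+ suc j) → Large n → E ℕ.≤ suc j ℕ.+ 2 ℕ.+ t
    gap {n} j C C′ large = ^-cancelʳ-≤ E (suc j ℕ.+ 2 ℕ.+ t) (ℕ.s≤s (ℕ.s≤s ℕ.z≤n))
      (^-cancelʳ-≤ (2 ℕ.^ E) (2 ℕ.^ (suc j ℕ.+ 2 ℕ.+ t)) 1<T (begin
        T ℕ.^ (2 ℕ.^ E)                                     ≤⟨ large ⟩
        X n                                                 ≤⟨ ⊓-power p {C.K} {C′.K} (2 ℕ.^ t) C.X≤ (ℕ.≤-trans (X-mono (ℕ.m≤m+n n (suc j))) C′.X≤) ⟩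
        (p ℕ.^ κ) ℕ.^ (2 ℕ.^ t)                             ≤⟨ ℕ.^-monoˡ-≤ (2 ℕ.^ t) (ℕ.≤-trans (∣∣⇒≤ (targetDiff≢0 j) ∣target) (∣targetDiff∣≤ (suc j))) ⟩
        (T ℕ.^ (2 ℕ.^ (suc j ℕ.+ 2))) ℕ.^ (2 ℕ.^ t)         ≡⟨ trans (ℕ.^-*-assoc T (2 ℕ.^ (suc j ℕ.+ 2)) (2 ℕ.^ t)) (cong (T ℕ.^_) (sym (ℕ.^-distribˡ-+-* 2 (suc j ℕ.+ 2) t))) ⟩
        T ℕ.^ (2 ℕ.^ (suc j ℕ.+ 2 ℕ.+ t)) ∎))
      where
      open ℕ.≤-Reasoning
      module C = Candidate C
      module C′ = Candidate C′
      open PrimePower C.prime using (power-∣)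
      κ = C.K ℕ.⊓ C′.K
      ∣target : + (p ℕ.^ κ) ∣ targetDiff (suc j)
      ∣target = SamePoint.cross (target-periodic n (suc j) (power-∣ (ℕ.m⊓n≤m C.K C′.K) C.K∣ξ) (power-∣ (ℕ.m⊓n≤n C.K C′.K) C′.K∣ξ))

    module Three (n₁ s j₀ v : ℕ) (j≡ : suc j₀ ≡ k ℕ.+ v)
                 (C₁ : Candidate τ p n₁) (C₂ : Candidate τ p (n₁ ℕ.+ s ℕ.+ k)) (C₃ : Candidate τ p (n₁ ℕ.+ s ℕ.+ k ℕ.+ suc j₀))
                 (large : Large n₁) where

      module C₁ = Candidate C₁
      module C₂ = Candidate C₂
      module C₃ = Candidate C₃
      open PrimePower C₁.prime using (power-∣)

      n₂ n₃ K κ q L N J i : ℕ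
      n₂ = n₁ ℕ.+ s ℕ.+ k
      n₃ = n₂ ℕ.+ suc j₀
      K = C₂.K ℕ.⊓ C₃.K
      κ = C₁.K ℕ.⊓ K
      q = 2 ℕ.^ t
      -- L = 8 q · 2 ^ v: as B is at most X n₂ ^ (2 · 2 ^ v) and J < 8 q, this gives B ^ J ≤ X n₂ ^
      -- (2 L).
      L = 2 ℕ.^ (t ℕ.+ (3 ℕ.+ v))
      N = ℕ.pred L
      J = ℕ.pred (8 ℕ.* q)
      -- 2 ^ i = 2 r L, enough for r L + r, which bounds all nodes including the extra row.
      i = suc (k ℕ.+ (t ℕ.+ (3 ℕ.+ v)))

      n₁≤n₂ : n₁ ℕ.≤ n₂
      n₁≤n₂ = ℕ.≤-trans (ℕ.m≤m+n n₁ s) (ℕ.m≤m+n _ k)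

      L≡ : suc N ≡ L
      L≡ = ℕ.suc-pred L {{ℕ.m^n≢0 2 (t ℕ.+ (3 ℕ.+ v))}}

      J≡ : suc J ≡ 8 ℕ.* q
      J≡ = ℕ.suc-pred (8 ℕ.* q) {{ℕ.m*n≢0 8 q {{_}} {{ℕ.m^n≢0 2 t}}}}

      X≤K : X n₂ ℕ.≤ (p ℕ.^ K) ℕ.^ q
      X≤K = ⊓-power p {C₂.K} {C₃.K} q C₂.X≤ (ℕ.≤-trans (X-mono (ℕ.m≤m+n n₂ (suc j₀))) C₃.X≤)

      X≤κ : X n₁ ℕ.≤ (p ℕ.^ κ) ℕ.^ q
      X≤κ = ⊓-power p {C₁.K} {K} q C₁.X≤ (ℕ.≤-trans (X-mono n₁≤n₂) X≤K)

      T<pκ : T ℕ.< p ℕ.^ κ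
      T<pκ = ℕ.≰⇒> λ pκ≤T → ℕ.<⇒≱ (ℕ.^-monoʳ-< T 1<T (ℕ.^-monoʳ-< 2 (ℕ.s≤s (ℕ.s≤s ℕ.z≤n)) t<E))
        (ℕ.≤-trans large (ℕ.≤-trans X≤κ (ℕ.^-monoˡ-≤ q pκ≤T)))
        where
        t<E : t ℕ.< E
        t<E = ℕ.m<m+n t (ℕ.s≤s ℕ.z≤n)

      2^κL : 2 ℕ.^ i ≡ 2 ℕ.* (2 ℕ.^ k ℕ.* L)
      2^κL = cong (2 ℕ.*_) (ℕ.^-distribˡ-+-* 2 k _)

      fits : 2 ℕ.^ k ℕ.* suc N ℕ.+ 2 ℕ.^ k ℕ.≤ 2 ℕ.^ i
      fits = begin
        2 ℕ.^ k ℕ.* suc N ℕ.+ 2 ℕ.^ k                  ≤⟨ ℕ.+-monoʳ-≤ (2 ℕ.^ k ℕ.* suc N) (ℕ.m≤m*n (2 ℕ.^ k) (suc N)) ⟩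
        2 ℕ.^ k ℕ.* suc N ℕ.+ 2 ℕ.^ k ℕ.* suc N        ≡⟨ cong (2 ℕ.^ k ℕ.* suc N ℕ.+_) (sym (ℕ.+-identityʳ _)) ⟩
        2 ℕ.* (2 ℕ.^ k ℕ.* suc N)                      ≡⟨ trans (cong (λ l → 2 ℕ.* (2 ℕ.^ k ℕ.* l)) L≡) (sym 2^κL) ⟩
        2 ℕ.^ i ∎
        where open ℕ.≤-Reasoning

      κ≡ : 2 ℕ.^ k ≡ q ℕ.* (q ℕ.* 64)
      κ≡ = trans (ℕ.^-distribˡ-+-* 2 t (t ℕ.+ 6)) (cong (q ℕ.*_) (ℕ.^-distribˡ-+-* 2 t 6))

      1≤q : 1 ℕ.≤ q
      1≤q = ℕ.m^n>0 2 t

      J<r : J ℕ.< 2 ℕ.^ k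
      J<r = begin
        suc J                 ≡⟨ trans J≡ (ℕ.*-comm 8 q) ⟩
        q ℕ.* 8               ≤⟨ ℕ.*-monoʳ-≤ q (ℕ.≤-trans (ℕ.m≤m+n 8 56) (ℕ.m≤n*m 64 q {{ℕ.>-nonZero 1≤q}})) ⟩
        q ℕ.* (q ℕ.* 64)      ≡⟨ sym κ≡ ⟩
        2 ℕ.^ k ∎
        where open ℕ.≤-Reasoning

      open Siegel {H} {T} a≢0 b≢0 c≢0 d≢0 (ℕ.m≤m⊔n ∣ a ∣ ∣ b ∣) (ℕ.m≤n⊔m ∣ a ∣ ∣ b ∣) (ℕ.m≤m⊔n ∣ c ∣ ∣ d ∣) (ℕ.m≤n⊔m ∣ c ∣ ∣ d ∣) 1<T
        C₁.prime {κ} {K} {C₃.K} n₁ s k j₀ using (module Bound)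

      K∣ξ₂ : + (p ℕ.^ K) ∣ ξ n₂
      K∣ξ₂ = power-∣ (ℕ.m⊓n≤m C₂.K C₃.K) C₂.K∣ξ

      K∣ξ₃ : + (p ℕ.^ K) ∣ ξ n₃
      K∣ξ₃ = power-∣ (ℕ.m⊓n≤n C₂.K C₃.K) C₃.K∣ξ

      open Bound T<pκ (power-∣ (ℕ.m⊓n≤m C₁.K K) C₁.K∣ξ) (power-∣ (ℕ.m⊓n≤n C₁.K K) K∣ξ₂) (power-∣ (ℕ.m⊓n≤n C₁.K K) K∣ξ₃)
        K∣ξ₂ K∣ξ₃ C₃.K∣ξ C₂.ξ≢0 N J (2 ℕ.^ i) (commonMultiple i) J<r fits (commonMultiple>0 i) (λ l → ∣commonMultiple i)
        using (μ; auxiliary-bound; B)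

      D : ℕ
      D = suc J ℕ.* suc N

      D≡2ʲ : D ≡ 2 ℕ.^ suc j₀
      D≡2ʲ = begin
        suc J ℕ.* suc N                        ≡⟨ cong₂ ℕ._*_ J≡ L≡ ⟩
        8 ℕ.* q ℕ.* L                          ≡⟨ cong (8 ℕ.* q ℕ.*_) (trans (ℕ.^-distribˡ-+-* 2 t (3 ℕ.+ v)) (cong (q ℕ.*_) (ℕ.^-distribˡ-+-* 2 3 v))) ⟩
        8 ℕ.* q ℕ.* (q ℕ.* (8 ℕ.* 2 ℕ.^ v))    ≡⟨ alg q (2 ℕ.^ v) ⟩
        q ℕ.* (q ℕ.* 64) ℕ.* 2 ℕ.^ v           ≡⟨ cong (ℕ._* 2 ℕ.^ v) (sym κ≡) ⟩
        2 ℕ.^ k ℕ.* 2 ℕ.^ v                    ≡⟨ sym (ℕ.^-distribˡ-+-* 2 k v) ⟩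
        2 ℕ.^ (k ℕ.+ v)                        ≡⟨ cong (2 ℕ.^_) (sym j≡) ⟩
        2 ℕ.^ suc j₀ ∎
        where
        open ≡-Reasoning
        alg : ∀ q w → 8 ℕ.* q ℕ.* (q ℕ.* (8 ℕ.* w)) ≡ q ℕ.* (q ℕ.* 64) ℕ.* w
        alg = solve-∀

      -- Both p ^ (K * D) and p ^ C₃.K reach the size X n₂ ^ D because X n₃ = X n₂ ^ (2 ^ j) and D = 2 ^ j.
      low : X n₂ ℕ.^ D ℕ.≤ (p ℕ.^ μ) ℕ.^ q
      low = ⊓-power p {K ℕ.* D} {C₃.K} q (begin
          X n₂ ℕ.^ D                       ≤⟨ ℕ.^-monoˡ-≤ D X≤K ⟩
          ((p ℕ.^ K) ℕ.^ q) ℕ.^ D          ≡⟨ trans (ℕ.^-*-assoc (p ℕ.^ K) q D) (trans (cong ((p ℕ.^ K) ℕ.^_) (ℕ.*-comm q D)) (sym (ℕ.^-*-assoc (p ℕ.^ K) D q))) ⟩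
          ((p ℕ.^ K) ℕ.^ D) ℕ.^ q          ≡⟨ cong (ℕ._^ q) (ℕ.^-*-assoc p K D) ⟩
          (p ℕ.^ (K ℕ.* D)) ℕ.^ q ∎)
        (begin
          X n₂ ℕ.^ D                       ≡⟨ trans (cong (X n₂ ℕ.^_) D≡2ʲ) (sym (X-+ n₂ (suc j₀))) ⟩
          X n₃                             ≤⟨ C₃.X≤ ⟩
          (p ℕ.^ C₃.K) ℕ.^ q ∎)
        where open ℕ.≤-Reasoning

      Λ≤ : commonMultiple i ℕ.≤ 2 ℕ.^ (4 ℕ.* (2 ℕ.^ k ℕ.* L))
      Λ≤ = ℕ.≤-trans (commonMultiple≤ i) (ℕ.≤-reflexive (cong (2 ℕ.^_) (trans (cong (2 ℕ.*_) 2^κL) (alg (2 ℕ.^ k ℕ.* L)))))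
        where
        alg : ∀ x → 2 ℕ.* (2 ℕ.* x) ≡ 4 ℕ.* x
        alg = solve-∀

      X≥ : 2 ℕ.^ (64 ℕ.* (q ℕ.* 2 ℕ.^ k)) ℕ.≤ X n₂
      X≥ = begin
        2 ℕ.^ (64 ℕ.* (q ℕ.* 2 ℕ.^ k))   ≡⟨ cong (2 ℕ.^_) exponent≡ ⟩
        2 ℕ.^ (2 ℕ.^ E)                  ≤⟨ ℕ.^-monoˡ-≤ (2 ℕ.^ E) 1<T ⟩
        T ℕ.^ (2 ℕ.^ E)                  ≤⟨ large-mono n₁≤n₂ large ⟩
        X n₂ ∎
        where
        open ℕ.≤-Reasoning
        alg : ∀ q → 64 ℕ.* (q ℕ.* (q ℕ.* (q ℕ.* 64))) ≡ q ℕ.* (q ℕ.* (q ℕ.* 4096))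
        alg = solve-∀
        exponent≡ : 64 ℕ.* (q ℕ.* 2 ℕ.^ k) ≡ 2 ℕ.^ E
        exponent≡ = trans (cong (λ x → 64 ℕ.* (q ℕ.* x)) κ≡) (trans (alg q) (sym
          (trans (ℕ.^-distribˡ-+-* 2 t _) (cong (q ℕ.*_) (trans (ℕ.^-distribˡ-+-* 2 t _) (cong (q ℕ.*_) (ℕ.^-distribˡ-+-* 2 t 12)))))))

      T≤X : T ℕ.≤ X n₂
      T≤X = ℕ.≤-trans (ℕ.≤-trans (ℕ.≤-reflexive (sym (ℕ.*-identityʳ T))) (ℕ.^-monoʳ-≤ T (ℕ.m^n>0 2 E))) (large-mono n₁≤n₂ large)

      B≤ : B ℕ.^ J ℕ.≤ X n₂ ℕ.^ (2 ℕ.* L)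
      B≤ = begin
        B ℕ.^ J                                       ≤⟨ ℕ.^-monoˡ-≤ J B≤X ⟩
        (X n₂ ℕ.^ (2 ℕ.* 2 ℕ.^ v)) ℕ.^ J              ≡⟨ ℕ.^-*-assoc (X n₂) (2 ℕ.* 2 ℕ.^ v) J ⟩
        X n₂ ℕ.^ (2 ℕ.* 2 ℕ.^ v ℕ.* J)                ≤⟨ ℕ.^-monoʳ-≤ (X n₂) (ℕ.*-monoʳ-≤ (2 ℕ.* 2 ℕ.^ v) (ℕ.≤-trans (ℕ.n≤1+n J) (ℕ.≤-reflexive J≡))) ⟩
        X n₂ ℕ.^ (2 ℕ.* 2 ℕ.^ v ℕ.* (8 ℕ.* q))        ≡⟨ cong (X n₂ ℕ.^_) (trans (alg (2 ℕ.^ v) q) (cong (2 ℕ.*_) (sym (trans (ℕ.^-distribˡ-+-* 2 t (3 ℕ.+ v)) (cong (q ℕ.*_) (ℕ.^-distribˡ-+-* 2 3 v)))))) ⟩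
        X n₂ ℕ.^ (2 ℕ.* L) ∎
        where
        open ℕ.≤-Reasoning
        alg : ∀ w q → 2 ℕ.* w ℕ.* (8 ℕ.* q) ≡ 2 ℕ.* (q ℕ.* (8 ℕ.* w))
        alg = solve-∀
        m = n₁ ℕ.+ s
        m+j : m ℕ.+ suc j₀ ≡ n₂ ℕ.+ v
        m+j = trans (cong (m ℕ.+_) j≡) (sym (ℕ.+-assoc m k v))
        B≤X : B ℕ.≤ X n₂ ℕ.^ (2 ℕ.* 2 ℕ.^ v)
        B≤X = begin
          H ℕ.^ (2 ℕ.^ (m ℕ.+ suc j₀)) ℕ.* H ℕ.^ (2 ℕ.^ m)   ≡⟨ cong₂ ℕ._*_ (sym (X-def (m ℕ.+ suc j₀))) (sym (X-def m)) ⟩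
          X (m ℕ.+ suc j₀) ℕ.* X m                           ≤⟨ ℕ.*-monoʳ-≤ (X (m ℕ.+ suc j₀)) (X-mono (ℕ.m≤m+n m (suc j₀))) ⟩
          X (m ℕ.+ suc j₀) ℕ.* X (m ℕ.+ suc j₀)              ≡⟨ cong (λ n → X n ℕ.* X n) m+j ⟩
          X (n₂ ℕ.+ v) ℕ.* X (n₂ ℕ.+ v)                      ≡⟨ cong (λ x → x ℕ.* x) (X-+ n₂ v) ⟩
          X n₂ ℕ.^ (2 ℕ.^ v) ℕ.* X n₂ ℕ.^ (2 ℕ.^ v)          ≡⟨ sym (ℕ.^-distribˡ-+-* (X n₂) (2 ℕ.^ v) (2 ℕ.^ v)) ⟩
          X n₂ ℕ.^ (2 ℕ.^ v ℕ.+ 2 ℕ.^ v)                     ≡⟨ cong (λ e → X n₂ ℕ.^ (2 ℕ.^ v ℕ.+ e)) (sym (ℕ.+-identityʳ (2 ℕ.^ v))) ⟩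
          X n₂ ℕ.^ (2 ℕ.* 2 ℕ.^ v) ∎

      contradiction : ⊥
      contradiction = size-contradiction {q} {2 ℕ.^ k} {k} {L} {N} {J} 1≤q (ℕ.m^n>0 2 k) (ℕ.<⇒≤ (n<2^n k)) L≡ J≡
        Λ≤ X≥ T≤X B≤ (subst (λ x → p ℕ.^ μ ℕ.≤ (2 ℕ.^ k) ℕ.^ D ℕ.* (suc D ℕ.* (weight ℕ.* ((T ℕ.* x) ℕ.^ suc N ℕ.* B ℕ.^ J)))) (sym (X-def n₂)) auxiliary-bound) low
        where
        weight = (2 ℕ.^ N ℕ.* commonMultiple i) ℕ.^ suc J ℕ.* commonMultiple i

    -- `gap` makes both distances at least E - 2 - t = 2 t + 10, hence at least k. The first leaves
    -- room for k square roots without descending below n₁, the second makes v = (n₃ - n₂) - k a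
    -- natural number.
    no-three-large : ∀ {n₁ n₂ n₃} → Candidate τ p n₁ → Candidate τ p n₂ → Candidate τ p n₃ → Large n₁ → n₁ ℕ.< n₂ → n₂ ℕ.< n₃ → ⊥
    no-three-large {n₁} {n₂} {n₃} C₁ C₂ C₃ large n₁<n₂ n₂<n₃ = Three.contradiction n₁ s j₀ v j≡
      C₁ (subst (Candidate τ p) n₂≡ C₂) (subst (Candidate τ p) n₃≡ C₃) large
      where
      i₀ j₀ s v : ℕ
      i₀ = n₂ ℕ.∸ suc n₁
      j₀ = n₃ ℕ.∸ suc n₂
      n₁+ : n₁ ℕ.+ suc i₀ ≡ n₂
      n₁+ = trans (ℕ.+-suc n₁ i₀) (ℕ.m+[n∸m]≡n n₁<n₂)
      n₂+ : n₂ ℕ.+ suc j₀ ≡ n₃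
      n₂+ = trans (ℕ.+-suc n₂ j₀) (ℕ.m+[n∸m]≡n n₂<n₃)
      k≤ : ∀ j → E ℕ.≤ suc j ℕ.+ 2 ℕ.+ t → k ℕ.≤ suc j
      k≤ j h = ℕ.≤-trans (ℕ.m≤m+n k 4) (ℕ.+-cancelʳ-≤ (2 ℕ.+ t) (k ℕ.+ 4) (suc j)
        (ℕ.≤-trans (ℕ.≤-reflexive (alg t)) (ℕ.≤-trans h (ℕ.≤-reflexive (ℕ.+-assoc (suc j) 2 t)))))
        where
        alg : ∀ t → t ℕ.+ (t ℕ.+ 6) ℕ.+ 4 ℕ.+ (2 ℕ.+ t) ≡ t ℕ.+ (t ℕ.+ (t ℕ.+ 12))
        alg = solve-∀
      k≤i : k ℕ.≤ suc i₀
      k≤i = k≤ i₀ (gap i₀ C₁ (subst (Candidate τ p) (sym n₁+) C₂) large)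
      k≤j : k ℕ.≤ suc j₀
      k≤j = k≤ j₀ (gap j₀ C₂ (subst (Candidate τ p) (sym n₂+) C₃) (large-mono (ℕ.<⇒≤ n₁<n₂) large))
      s = suc i₀ ℕ.∸ k
      v = suc j₀ ℕ.∸ k
      j≡ : suc j₀ ≡ k ℕ.+ v
      j≡ = sym (ℕ.m+[n∸m]≡n k≤j)
      n₂≡ : n₂ ≡ n₁ ℕ.+ s ℕ.+ k
      n₂≡ = trans (sym n₁+) (trans (cong (n₁ ℕ.+_) (sym (ℕ.m∸n+n≡m k≤i))) (sym (ℕ.+-assoc n₁ s k)))
      n₃≡ : n₃ ≡ n₁ ℕ.+ s ℕ.+ k ℕ.+ suc j₀
      n₃≡ = trans (sym n₂+) (cong (ℕ._+ suc j₀) n₂≡)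

-- Archimedean lower bounds for a difference of two terms.

module Arch where

  open import Data.Nat
  open import Data.Nat.Properties
  open import Data.Nat.Tactic.RingSolver using (solve-∀)

  -- For integers y < x every positive power of y / x is at most 1 - 1 / x; this is the source of
  -- the factor H in the lower bounds.
  power-gap : ∀ {x y} k → y < x → x * y ^ suc k + x ^ suc k ≤ x * x ^ suc k
  power-gap {suc x} {y} k (s≤s y≤x) = begin
    suc x * y ^ suc k + suc x ^ suc k
      ≤⟨ +-monoˡ-≤ (suc x ^ suc k) (*-monoʳ-≤ (suc x) (*-mono-≤ y≤x (^-monoˡ-≤ k (m≤n⇒m≤1+n y≤x)))) ⟩
    suc x * (x * suc x ^ k) + suc x * suc x ^ k ≡⟨ alg x (suc x ^ k) ⟩
    suc x * (suc x * suc x ^ k) ∎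
    where
    open ≤-Reasoning
    alg : ∀ x z → (1 + x) * (x * z) + (1 + x) * z ≡ (1 + x) * ((1 + x) * z)
    alg = solve-∀

  double-^ : ∀ x n → x ^ (2 ^ suc n) ≡ x ^ (2 ^ n) * x ^ (2 ^ n)
  double-^ x n = trans (cong (λ k → x ^ (2 ^ n + k)) (+-identityʳ (2 ^ n))) (^-distribˡ-+-* x (2 ^ n) (2 ^ n))

  module _ {x y c d : ℕ} (y<x : y < x) (0<y : 0 < y) (0<c : 0 < c) (0<d : 0 < d) where

    private
      u w : ℕ → ℕ
      u n = x ^ (2 ^ n)
      w n = y ^ (2 ^ n)

      instance
        _ = >-nonZero 0<c
        _ = >-nonZero 0<d
        nonZero-y = >-nonZero 0<y
        nonZero-x = >-nonZero (<-trans 0<y y<x)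

      u≢0 : ∀ n → NonZero (u n)
      u≢0 n = m^n≢0 x (2 ^ n)

      w≢0 : ∀ n → NonZero (w n)
      w≢0 n = m^n≢0 y (2 ^ n)

      gap : ∀ n → x * w n + u n ≤ x * u n
      gap n = go (2 ^ n) (m^n>0 2 n)
        where
        go : ∀ k → 0 < k → x * y ^ k + x ^ k ≤ x * x ^ k
        go (suc k) _ = power-gap k y<x

      w≤u : ∀ n → w n ≤ u n
      w≤u n = ^-monoˡ-≤ (2 ^ n) (<⇒≤ y<x)

    module _ (N : ℕ → ℕ) (above : ∀ n → u n * d ≤ N n + c * w n) (below : ∀ n → c * w n ≤ N n + u n * d) where

      Good : ℕ → Set
      Good n = u n ≤ x * N n × c ≤ x * N n × d ≤ x * N n

      private
        cancel : ∀ {s t n g} → x * s + g ≤ x * t → t ≤ n + s → g ≤ x * n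
        cancel {s} {t} {n} {g} p q = +-cancelˡ-≤ (x * s) g (x * n) (≤-trans p (≤-trans (*-monoʳ-≤ x q)
          (≤-reflexive (trans (*-distribˡ-+ x n s) (+-comm (x * n) (x * s))))))

        -- One squaring after u d has caught up with c w, the quotient c w / (u d) has gained a
        -- factor (y / x) ^ (2 ^ n), so it is at most 1 - 1 / x.
        after : ∀ n → c * w n ≤ u n * d → Good (suc n)
        after n h = ≤-trans (m≤m*n _ d) big , ≤-trans c≤ big , ≤-trans (m≤n*m d (u (suc n)) {{u≢0 (suc n)}}) big
          where
          open ≤-Reasoning
          alg : ∀ x c w u d → x * (c * (w * w)) + u * u * d ≡ x * (c * w * w) + u * u * d
          alg = solve-∀
          alg′ : ∀ x w u d → x * (u * d * w) + u * u * d ≡ u * d * (x * w + u)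
          alg′ = solve-∀
          alg″ : ∀ x u d → u * d * (x * u) ≡ x * (u * u * d)
          alg″ = solve-∀
          big : u (suc n) * d ≤ x * N (suc n)
          big = cancel {c * w (suc n)} {u (suc n) * d} (begin
            x * (c * w (suc n)) + u (suc n) * d
              ≡⟨ cong₂ (λ s t → x * (c * s) + t * d) (double-^ y n) (double-^ x n) ⟩
            x * (c * (w n * w n)) + u n * u n * d    ≡⟨ alg x c (w n) (u n) d ⟩
            x * (c * w n * w n) + u n * u n * d      ≤⟨ +-monoˡ-≤ _ (*-monoʳ-≤ x (*-monoˡ-≤ (w n) h)) ⟩
            x * (u n * d * w n) + u n * u n * d      ≡⟨ alg′ x (w n) (u n) d ⟩
            u n * d * (x * w n + u n)                ≤⟨ *-monoʳ-≤ (u n * d) (gap n) ⟩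
            u n * d * (x * u n)                      ≡⟨ alg″ x (u n) d ⟩
            x * (u n * u n * d)                      ≡⟨ cong (λ t → x * (t * d)) (sym (double-^ x n)) ⟩
            x * (u (suc n) * d) ∎) (above (suc n))
          c≤ : c ≤ u (suc n) * d
          c≤ = begin
            c                   ≤⟨ m≤m*n c (w n) {{w≢0 n}} ⟩
            c * w n             ≤⟨ h ⟩
            u n * d             ≤⟨ *-monoˡ-≤ d (m≤m*n (u n) (u n) {{u≢0 n}}) ⟩
            u n * u n * d       ≡⟨ cong (_* d) (sym (double-^ x n)) ⟩
            u (suc n) * d ∎

        -- The mirror case: if c w still leads after squaring, then already before it u d / (c w) is
        -- at most (y / x) ^ (2 ^ n).
        before : ∀ n → u (suc n) * d ≤ c * w (suc n) → Good n
        before n h = ≤-trans (m≤m*n (u n) d) (≤-trans ud≤cw big) , ≤-trans (m≤m*n c (w n) {{w≢0 n}}) big , ≤-trans (m≤n*m d (u n) {{u≢0 n}}) (≤-trans ud≤cw big)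
          where
          open ≤-Reasoning
          h′ : u n * u n * d ≤ c * (w n * w n)
          h′ = subst₂ (λ s t → s * d ≤ c * t) (double-^ x n) (double-^ y n) h
          alg : ∀ u x c w d → u * (x * (u * d) + c * w) ≡ x * (u * u * d) + u * (c * w)
          alg = solve-∀
          alg′ : ∀ u x c w → x * (c * (w * w)) + u * (c * w) ≡ c * w * (x * w + u)
          alg′ = solve-∀
          alg″ : ∀ u x c w → c * w * (x * u) ≡ u * (x * (c * w))
          alg″ = solve-∀
          alg‴ : ∀ u c w → c * (w * u) ≡ u * (c * w)
          alg‴ = solve-∀
          big : c * w n ≤ x * N n
          big = cancel {u n * d} {c * w n} (*-cancelˡ-≤ (u n) {{u≢0 n}} (begin
            u n * (x * (u n * d) + c * w n)          ≡⟨ alg (u n) x c (w n) d ⟩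
            x * (u n * u n * d) + u n * (c * w n)    ≤⟨ +-monoˡ-≤ _ (*-monoʳ-≤ x h′) ⟩
            x * (c * (w n * w n)) + u n * (c * w n)  ≡⟨ alg′ (u n) x c (w n) ⟩
            c * w n * (x * w n + u n)                ≤⟨ *-monoʳ-≤ (c * w n) (gap n) ⟩
            c * w n * (x * u n)                      ≡⟨ alg″ (u n) x c (w n) ⟩
            u n * (x * (c * w n)) ∎)) (below n)
          ud≤cw : u n * d ≤ c * w n
          ud≤cw = *-cancelˡ-≤ (u n) {{u≢0 n}} (begin
            u n * (u n * d)     ≡⟨ sym (*-assoc (u n) (u n) d) ⟩
            u n * u n * d       ≤⟨ h′ ⟩
            c * (w n * w n)     ≤⟨ *-monoʳ-≤ c (*-monoʳ-≤ (w n) (w≤u n)) ⟩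
            c * (w n * u n)     ≡⟨ alg‴ (u n) c (w n) ⟩
            u n * (c * w n) ∎)

        persists : ∀ n k → c * w n ≤ u n * d → c * w (k + n) ≤ u (k + n) * d
        persists n zero h = h
        persists n (suc k) h = begin
          c * w (suc (k + n))            ≡⟨ cong (c *_) (double-^ y (k + n)) ⟩
          c * (w (k + n) * w (k + n))    ≡⟨ sym (*-assoc c _ _) ⟩
          c * w (k + n) * w (k + n)      ≤⟨ *-mono-≤ (persists n k h) (w≤u (k + n)) ⟩
          u (k + n) * d * u (k + n)      ≡⟨ alg (u (k + n)) d ⟩
          u (k + n) * u (k + n) * d      ≡⟨ cong (_* d) (sym (double-^ x (k + n))) ⟩
          u (suc (k + n)) * d ∎
          where
          open ≤-Reasoning
          alg : ∀ u d → u * d * u ≡ u * u * d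
          alg = solve-∀

      -- The ratio u n * d / (c * w n) is increasing, so it can be close to 1 only at its crossing of 1.
      good-or-good : ∀ n m → suc n < m → Good n ⊎ Good m
      good-or-good n (suc m) (s≤s n<m) with c * w (suc n) ≤? u (suc n) * d
      ... | yes h = inj₂ (after m (subst (λ k → c * w k ≤ u k * d) (m∸n+n≡m n<m) (persists (suc n) (m ∸ suc n) h)))
      ... | no ≰ = inj₁ (before n (<⇒≤ (≰⇒> ≰)))

-- A prime power that dominates an integer supported on few primes.

module Dominant where

  open import Data.Nat
  open import Data.Nat.Divisibility
  open import Data.Nat.Primality
  open import Data.Nat.Properties
  open Lcm using (primeFactor; primePart)
  open Sizes using (^-*-dist)

  ^-cancel-≤ : ∀ l {m n} → m ^ suc l ≤ n ^ suc l → m ≤ n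
  ^-cancel-≤ l {m} {n} h with m ≤? n
  ... | yes m≤n = m≤n
  ... | no m≰n = ⊥-elim (<⇒≱ (^-monoˡ-< (suc l) (≰⇒> m≰n)) h)

  -- Split off P = p ^ K with cofactor y. If P is too small, then P ^ (l + 1) ≤ P y, and the power z
  -- found for y with y ≤ z ^ l serves: (P y) ^ (l + 1) ≤ P y · z ^ (l (l + 1)), and an l-th root
  -- remains after cancelling P y.
  dominantPrime : ∀ ps → All Prime ps → ∀ x → 1 < x → (∀ p → Prime p → p ∣ x → p ∈ ps) →
                  ∃₂ λ p K → p ∈ ps × Prime p × p ^ K ∣ x × x ≤ (p ^ K) ^ length ps
  dominantPrime [] [] x 1<x support with primeFactor x 1<x
  ... | q , pr , q∣x with support q pr q∣x
  ... | ()
  dominantPrime (p ∷ ps) (pr ∷ prs) x 1<x support with primePart pr x (<-trans (s≤s z≤n) 1<x)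
  ... | K , zero , refl , p∤y = ⊥-elim (p∤y (p ∣0))
  ... | K , suc zero , refl , p∤y = p , K , here refl , pr , m∣m*n 1 ,
    ≤-trans (≤-reflexive (*-identityʳ (p ^ K))) (m≤m*n (p ^ K) ((p ^ K) ^ length ps) {{m^n≢0 (p ^ K) (length ps) {{m^n≢0 p K {{prime⇒nonZero pr}}}}}})
  ... | K , suc (suc y′) , refl , p∤y = choose (p ^ K * y ≤? (p ^ K) ^ suc l)
    where
    l = length ps
    y = suc (suc y′)
    support′ : ∀ q → Prime q → q ∣ y → q ∈ ps
    support′ q qr q∣y with support q qr (∣n⇒∣m*n (p ^ K) q∣y)
    ... | here refl = ⊥-elim (p∤y q∣y)
    ... | there q∈ = q∈
    choose : Dec (p ^ K * y ≤ (p ^ K) ^ suc l) → ∃₂ λ q K′ → q ∈ p ∷ ps × Prime q × q ^ K′ ∣ p ^ K * y × p ^ K * y ≤ (q ^ K′) ^ suc l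
    choose (yes h) = p , K , here refl , pr , m∣m*n y , h
    choose (no h) with dominantPrime ps prs y (s≤s (s≤s z≤n)) support′
    ... | q , K′ , q∈ , qr , q∣y , y≤ = q , K′ , there q∈ , qr , ∣n⇒∣m*n (p ^ K) q∣y , conclude l y≤ (<⇒≤ (≰⇒> h))
      where
      z = q ^ K′
      P = p ^ K
      open ≤-Reasoning
      conclude : ∀ l → y ≤ z ^ l → P ^ suc l ≤ P * y → P * y ≤ z ^ suc l
      conclude zero (s≤s ())
      conclude l@(suc k) y≤ P≤ = ^-cancel-≤ k (*-cancelˡ-≤ (P * y) {{>-nonZero (<-trans (s≤s z≤n) 1<x)}} (begin
        (P * y) ^ suc l                        ≡⟨ ^-*-dist P y (suc l) ⟩
        P ^ suc l * y ^ suc l                  ≤⟨ *-mono-≤ P≤ (^-monoˡ-≤ (suc l) y≤) ⟩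
        (P * y) * (z ^ l) ^ suc l              ≡⟨ cong (P * y *_) (trans (^-*-assoc z l (suc l)) (trans (cong (z ^_) (*-comm l (suc l))) (sym (^-*-assoc z (suc l) l)))) ⟩
        (P * y) * (z ^ suc l) ^ l ∎))

-- Assembling the count for integer coordinates.

module Orbits (a b c d : ℤ.ℤ) (coprime-ab : Coprime ℤ.∣ a ∣ ℤ.∣ b ∣) (coprime-cd : Coprime ℤ.∣ c ∣ ℤ.∣ d ∣)
    (a≢0 : a ≢ ℤ.0ℤ) (b≢0 : b ≢ ℤ.0ℤ) (c≢0 : c ≢ ℤ.0ℤ) (d≢0 : d ≢ ℤ.0ℤ)
    (∣a∣≢∣b∣ : ℤ.∣ a ∣ ≢ ℤ.∣ b ∣) (∣c∣≢∣d∣ : ℤ.∣ c ∣ ≢ ℤ.∣ d ∣)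
    (ps : List ℕ) (primes : All Prime ps) (σ : ℕ) (ps< : length ps ℕ.< 2 ℕ.^ suc σ) where

  open import Data.Integer using (ℤ; +_; 0ℤ; _+_; _-_; _*_; -_; ∣_∣)
  open import Data.Integer.Divisibility.Signed using (∣ᵤ⇒∣)
  open import Data.Integer.Properties
  open import Function using (_∘_)
  open import Relation.Nullary using (_×-dec_)
  open import Relation.Unary using (Decidable)
  open Arch using (good-or-good)
  open Counting
  open Dominant
  open Sizes using (n<2^n)
  open Orbit a b c d coprime-ab coprime-cd using (ξ)
  open Squaring
  open Places a b c d coprime-ab coprime-cd a≢0 b≢0 c≢0 d≢0 ∣a∣≢∣b∣ ∣c∣≢∣d∣

  -- The number of finite places is rounded up to 2 ^ τ, so that height comparisons reduce to adding
  -- exponents of 2.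
  τ : ℕ
  τ = suc σ

  open Large a b c d coprime-ab coprime-cd a≢0 b≢0 c≢0 d≢0 ∣a∣≢∣b∣ ∣c∣≢∣d∣ τ using (Large; E; no-three-large)

  Supported : ℕ → Set
  Supported n = ∀ p → Prime p → p ℕ.∣ ∣ ξ n ∣ → p ∈ ps

  Bad : ℕ → Set
  Bad n = ¬ Good n

  good? : ∀ n → Dec (Good n)
  good? n = (X n ℕ.≤? H ℕ.* ∣ ξ n ∣) ×-dec (T ℕ.≤? H ℕ.* ∣ ξ n ∣)

  ∣i∣≤∣i-j∣+∣j∣ : ∀ i j → ∣ i ∣ ℕ.≤ ∣ i - j ∣ ℕ.+ ∣ j ∣
  ∣i∣≤∣i-j∣+∣j∣ i j = ℕ.≤-trans (ℕ.≤-reflexive (cong ∣_∣ (alg i j))) (∣i+j∣≤∣i∣+∣j∣ (i - j) j)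
    where
    open import Data.Integer.Tactic.RingSolver using () renaming (solve-∀ to solveℤ)
    alg : ∀ i j → i ≡ i - j + j
    alg = solveℤ

  ∣ad∣ : ∀ n → ∣ pow a n * d ∣ ≡ ∣ a ∣ ℕ.^ (2 ℕ.^ n) ℕ.* ∣ d ∣
  ∣ad∣ n = trans (∣i*j∣≡∣i∣*∣j∣ (pow a n) d) (cong (ℕ._* ∣ d ∣) (∣pow∣ a n))

  ∣cb∣ : ∀ n → ∣ c * pow b n ∣ ≡ ∣ c ∣ ℕ.* ∣ b ∣ ℕ.^ (2 ℕ.^ n)
  ∣cb∣ n = trans (∣i*j∣≡∣i∣*∣j∣ c (pow b n)) (cong (∣ c ∣ ℕ.*_) (∣pow∣ b n))

  ad≤ : ∀ n → ∣ a ∣ ℕ.^ (2 ℕ.^ n) ℕ.* ∣ d ∣ ℕ.≤ ∣ ξ n ∣ ℕ.+ ∣ c ∣ ℕ.* ∣ b ∣ ℕ.^ (2 ℕ.^ n)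
  ad≤ n = subst₂ (λ x y → x ℕ.≤ ∣ ξ n ∣ ℕ.+ y) (∣ad∣ n) (∣cb∣ n) (∣i∣≤∣i-j∣+∣j∣ (pow a n * d) (c * pow b n))

  cb≤ : ∀ n → ∣ c ∣ ℕ.* ∣ b ∣ ℕ.^ (2 ℕ.^ n) ℕ.≤ ∣ ξ n ∣ ℕ.+ ∣ a ∣ ℕ.^ (2 ℕ.^ n) ℕ.* ∣ d ∣
  cb≤ n = subst₂ (λ x y → x ℕ.≤ ∣ ξ n ∣ ℕ.+ y) (∣cb∣ n) (∣ad∣ n)
    (subst (λ x → ∣ c * pow b n ∣ ℕ.≤ x ℕ.+ ∣ pow a n * d ∣) (∣i-j∣≡∣j-i∣ (c * pow b n) (pow a n * d)) (∣i∣≤∣i-j∣+∣j∣ (c * pow b n) (pow a n * d)))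

  good-or-good′ : ∀ n m → suc n ℕ.< m → Good n ⊎ Good m
  good-or-good′ n m n+2≤m with ℕ.<-cmp ∣ a ∣ ∣ b ∣
  ... | tri≈ _ eq _ = ⊥-elim (∣a∣≢∣b∣ eq)
  ... | tri> _ _ b<a = [ inj₁ ∘ convert n , inj₂ ∘ convert m ]′
      (good-or-good b<a (abs>0 b≢0) (abs>0 c≢0) (abs>0 d≢0) (λ n → ∣ ξ n ∣) ad≤ cb≤ n m n+2≤m)
    where
    H≡ : H ≡ ∣ a ∣
    H≡ = ℕ.m≥n⇒m⊔n≡m (ℕ.<⇒≤ b<a)
    convert : ∀ n → ∣ a ∣ ℕ.^ (2 ℕ.^ n) ℕ.≤ ∣ a ∣ ℕ.* ∣ ξ n ∣ × ∣ c ∣ ℕ.≤ ∣ a ∣ ℕ.* ∣ ξ n ∣ × ∣ d ∣ ℕ.≤ ∣ a ∣ ℕ.* ∣ ξ n ∣ → Good n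
    convert n (h₁ , h₂ , h₃) =
      subst₂ (λ x y → x ℕ.≤ y ℕ.* ∣ ξ n ∣) (sym (trans (X-def n) (cong (ℕ._^ (2 ℕ.^ n)) H≡))) (sym H≡) h₁ ,
      subst (λ y → T ℕ.≤ y ℕ.* ∣ ξ n ∣) (sym H≡) (ℕ.⊔-lub h₂ h₃)
  ... | tri< a<b _ _ = [ inj₁ ∘ convert n , inj₂ ∘ convert m ]′
      (good-or-good a<b (abs>0 a≢0) (abs>0 d≢0) (abs>0 c≢0) (λ n → ∣ ξ n ∣)
        (λ n → subst₂ (λ x y → x ℕ.≤ ∣ ξ n ∣ ℕ.+ y) (ℕ.*-comm ∣ c ∣ _) (ℕ.*-comm _ ∣ d ∣) (cb≤ n))
        (λ n → subst₂ (λ x y → x ℕ.≤ ∣ ξ n ∣ ℕ.+ y) (ℕ.*-comm _ ∣ d ∣) (ℕ.*-comm ∣ c ∣ _) (ad≤ n)) n m n+2≤m)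
    where
    H≡ : H ≡ ∣ b ∣
    H≡ = ℕ.m≤n⇒m⊔n≡n (ℕ.<⇒≤ a<b)
    convert : ∀ n → ∣ b ∣ ℕ.^ (2 ℕ.^ n) ℕ.≤ ∣ b ∣ ℕ.* ∣ ξ n ∣ × ∣ d ∣ ℕ.≤ ∣ b ∣ ℕ.* ∣ ξ n ∣ × ∣ c ∣ ℕ.≤ ∣ b ∣ ℕ.* ∣ ξ n ∣ → Good n
    convert n (h₁ , h₂ , h₃) =
      subst₂ (λ x y → x ℕ.≤ y ℕ.* ∣ ξ n ∣) (sym (trans (X-def n) (cong (ℕ._^ (2 ℕ.^ n)) H≡))) (sym H≡) h₁ ,
      subst (λ y → T ℕ.≤ y ℕ.* ∣ ξ n ∣) (sym H≡) (ℕ.⊔-lub h₃ h₂)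

  atMost-bad : AtMost 2 Bad
  atMost-bad = atMost-2 λ {x} {y} {z} bx by bz x<y y<z → [ bx , bz ]′ (good-or-good′ x z (ℕ.≤-<-trans x<y y<z))

  -- A dominant prime needs |ξ n| > 1. For n ≥ 1 this follows from H ^ 2 ≤ X n ≤ H |ξ n|, and so n =
  -- 0 is counted apart.
  candidate : ∀ n → 1 ℕ.≤ n → Good n → Supported n → ∃ λ p → p ∈ ps × Candidate τ p n
  candidate n 1≤n good supported with dominantPrime ps primes ∣ ξ n ∣ 1<ξ supported
    where
    1<ξ : 1 ℕ.< ∣ ξ n ∣
    1<ξ = ℕ.<-≤-trans 1<H (ℕ.*-cancelˡ-≤ H (ℕ.≤-trans (H²≤X 1≤n) (proj₁ good)))
  ... | p , K , p∈ , pr , pᴷ∣ξ , ≤K = p , p∈ , record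
    { prime = pr ; 1≤n = 1≤n ; good = good
    ; dominated = record
      { K = K ; K∣ξ = ∣ᵤ⇒∣ {+ (p ℕ.^ K)} {ξ n} pᴷ∣ξ
      ; ξ≤ = ℕ.≤-trans ≤K (ℕ.^-monoʳ-≤ (p ℕ.^ K) {{ℕ.m^n≢0 p K {{nonZero}}}} (ℕ.<⇒≤ ps<)) } }
    where
    open import Data.Nat.Primality using (prime⇒nonZero)
    nonZero = prime⇒nonZero pr

  least : ∀ {P : ℕ → Set} → Decidable P → ∀ N → P N → ∃ λ lo → P lo × (∀ {n} → n ℕ.< lo → ¬ P n)
  least P? zero p = 0 , p , λ ()
  least {P} P? (suc N) p with P? 0
  ... | yes p₀ = 0 , p₀ , λ ()
  ... | no ¬p₀ with least (P? ∘ suc) N p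
  ...   | lo , plo , below = suc lo , plo , λ { {zero} _ → ¬p₀ ; {suc n} (ℕ.s≤s n<lo) → below n<lo }

  -- Counted from the first index that is not small, τ + 2 squarings bring the height up to T, and E
  -- more bring it up to T ^ (2 ^ E).
  len : ℕ
  len = τ ℕ.+ 2 ℕ.+ E

  Middle : ℕ → Set
  Middle n = ¬ Small τ n × ¬ Large n

  atMost-middle : AtMost len Middle
  atMost-middle with least {λ n → T ℕ.≤ X n ℕ.^ (2 ℕ.^ (τ ℕ.+ 2))} (λ n → T ℕ.≤? _) T T≤
    where
    open ℕ.≤-Reasoning
    T≤ : T ℕ.≤ X T ℕ.^ (2 ℕ.^ (τ ℕ.+ 2))
    T≤ = begin
      T                                     ≤⟨ ℕ.<⇒≤ (n<2^n T) ⟩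
      2 ℕ.^ T                               ≤⟨ ℕ.<⇒≤ (n<2^n (2 ℕ.^ T)) ⟩
      2 ℕ.^ (2 ℕ.^ T)                       ≤⟨ ℕ.^-monoˡ-≤ (2 ℕ.^ T) 1<H ⟩
      H ℕ.^ (2 ℕ.^ T)                       ≡⟨ sym (X-def T) ⟩
      X T                                   ≡⟨ sym (ℕ.*-identityʳ (X T)) ⟩
      X T ℕ.^ 1                             ≤⟨ ℕ.^-monoʳ-≤ (X T) (ℕ.m^n>0 2 (τ ℕ.+ 2)) ⟩
      X T ℕ.^ (2 ℕ.^ (τ ℕ.+ 2)) ∎
  ... | lo , T≤lo , below = atMost-map within (atMost-interval lo len)
    where
    open ℕ.≤-Reasoning
    within : ∀ {n} → Middle n → lo ℕ.≤ n × n ℕ.< lo ℕ.+ len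
    within {n} (¬small , ¬large) = ℕ.≮⇒≥ (λ n<lo → below n<lo (ℕ.≮⇒≥ ¬small)) , ℕ.≰⇒> λ hi≤n → ¬large (begin
      T ℕ.^ (2 ℕ.^ E)                                     ≤⟨ ℕ.^-monoˡ-≤ (2 ℕ.^ E) T≤lo ⟩
      (X lo ℕ.^ (2 ℕ.^ (τ ℕ.+ 2))) ℕ.^ (2 ℕ.^ E)          ≡⟨ cong (ℕ._^ (2 ℕ.^ E)) (sym (X-+ lo (τ ℕ.+ 2))) ⟩
      X (lo ℕ.+ (τ ℕ.+ 2)) ℕ.^ (2 ℕ.^ E)                  ≡⟨ sym (X-+ (lo ℕ.+ (τ ℕ.+ 2)) E) ⟩
      X (lo ℕ.+ (τ ℕ.+ 2) ℕ.+ E)                          ≡⟨ cong X (ℕ.+-assoc lo (τ ℕ.+ 2) E) ⟩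
      X (lo ℕ.+ len)                                      ≤⟨ X-mono hi≤n ⟩
      X n ∎)

  Extreme : ℕ → ℕ → Set
  Extreme p n = (Candidate τ p n × Small τ n) ⊎ (Candidate τ p n × Large n)

  atMost-extreme : ∀ p → AtMost 3 (Extreme p)
  atMost-extreme p = atMost-⊎
    (atMost-1 λ { (C , _) (C′ , small) n<m → small-unique C C′ small n<m })
    (atMost-2 λ { (C₁ , large) (C₂ , _) (C₃ , _) n₁<n₂ n₂<n₃ → no-three-large C₁ C₂ C₃ large n₁<n₂ n₂<n₃ })

  classify : ∀ {n} → Supported n → n ≡ 0 ⊎ Bad n ⊎ Middle n ⊎ (∃ λ p → p ∈ ps × Extreme p n)
  classify {zero} _ = inj₁ refl
  classify {n@(suc _)} supported with good? n
  ... | no bad = inj₂ (inj₁ bad)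
  ... | yes good with candidate n (ℕ.s≤s ℕ.z≤n) good supported
  ...   | p , p∈ , C with X n ℕ.^ (2 ℕ.^ (τ ℕ.+ 2)) ℕ.<? T | T ℕ.^ (2 ℕ.^ E) ℕ.≤? X n
  ...     | yes small | _         = inj₂ (inj₂ (inj₂ (p , p∈ , inj₁ (C , small))))
  ...     | no _      | yes large = inj₂ (inj₂ (inj₂ (p , p∈ , inj₂ (C , large))))
  ...     | no ¬small | no ¬large = inj₂ (inj₂ (inj₁ (¬small , ¬large)))

  atMost-supported : AtMost (1 ℕ.+ (2 ℕ.+ (len ℕ.+ length ps ℕ.* 3))) Supported
  atMost-supported = atMost-map classify
    (atMost-⊎ (atMost-1 λ { refl refl () }) (atMost-⊎ atMost-bad (atMost-⊎ atMost-middle (atMost-∈ atMost-extreme ps))))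

-- From rational points to coprime integer coordinates, and the theorem.

open import Data.Integer using (ℤ; +_; -[1+_]; 0ℤ; 1ℤ; ∣_∣)
open import Data.Nat using (_≤_; _<_; _^_; _*_; _+_; z≤n; s≤s)
open import Data.List.Membership.DecPropositional ℕ._≟_ using (_∈?_)
open import Data.Nat.GCD using (gcd)
open import Data.Nat.Logarithm using (⌊log₂_⌋; ⌊log₂⌋-mono-≤; ⌊log₂[2^n]⌋≡n)
open import Data.Nat.Properties
open import Data.Nat.Tactic.RingSolver using (solve-∀)
open import Data.Rational using (ℚ; mkℚ; ↥_; ↧_)
open import Data.Rational.Properties using (↥-*; ↧-*; ↥p≡0⇒p≡0)
open Lcm using (coprime-*)
open Squaring

coprime-↥↧ : ∀ x → Coprime ∣ ↥ x ∣ ∣ ↧ x ∣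
coprime-↥↧ (mkℚ _ _ coprime) = Coprimality.recompute coprime

-- The square of a reduced fraction is reduced, so normalisation changes nothing and the iterates of
-- φ have `pow` coordinates.
gcd-squares : ∀ x → + gcd ∣ ↥ x ℤ.* ↥ x ∣ ∣ ↧ x ℤ.* ↧ x ∣ ≡ 1ℤ
gcd-squares x = cong +_ (Coprimality.coprime⇒gcd≡1 (subst₂ Coprime (sym (ℤ.∣i*j∣≡∣i∣*∣j∣ (↥ x) (↥ x))) (sym (ℤ.∣i*j∣≡∣i∣*∣j∣ (↧ x) (↧ x)))
  (coprime-* square square)))
  where
  square : Coprime ∣ ↥ x ∣ (∣ ↧ x ∣ * ∣ ↧ x ∣)
  square = Coprimality.sym (coprime-* (Coprimality.sym (coprime-↥↧ x)) (Coprimality.sym (coprime-↥↧ x)))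

↥-φ : ∀ x → ↥ (φ x) ≡ ↥ x ℤ.* ↥ x
↥-φ x = trans (sym (ℤ.*-identityʳ (↥ (φ x)))) (trans (cong (↥ (φ x) ℤ.*_) (sym (gcd-squares x))) (↥-* x x))

↧-φ : ∀ x → ↧ (φ x) ≡ ↧ x ℤ.* ↧ x
↧-φ x = trans (sym (ℤ.*-identityʳ (↧ (φ x)))) (trans (cong (↧ (φ x) ℤ.*_) (sym (gcd-squares x))) (↧-* x x))

↥-φ^ : ∀ n x → ↥ (φ^ n x) ≡ pow (↥ x) n
↥-φ^ zero x = sym (trans (pow-def (↥ x) 0) (ℤ.*-identityʳ (↥ x)))
↥-φ^ (suc n) x = trans (↥-φ (φ^ n x)) (trans (cong₂ ℤ._*_ (↥-φ^ n x) (↥-φ^ n x)) (sym (pow-suc (↥ x) n)))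

↧-φ^ : ∀ n x → ↧ (φ^ n x) ≡ pow (↧ x) n
↧-φ^ zero x = sym (trans (pow-def (↧ x) 0) (ℤ.*-identityʳ (↧ x)))
↧-φ^ (suc n) x = trans (↧-φ (φ^ n x)) (trans (cong₂ ℤ._*_ (↧-φ^ n x) (↧-φ^ n x)) (sym (pow-suc (↧ x) n)))

↥≢0 : ∀ x → ¬ Preperiodic x → ↥ x ≢ 0ℤ
↥≢0 x wandering e = wandering (0 , 1 , (λ ()) , subst (λ y → y ≡ φ y) (sym (↥p≡0⇒p≡0 x e)) refl)

↧≢0 : ∀ x → ↧ x ≢ 0ℤ
↧≢0 (mkℚ _ _ _) ()

-- Coprime coordinates of equal absolute value must be 1 in absolute value, and φ sends both 1 and
-- -1 to its fixed point 1.
∣↥∣≢∣↧∣ : ∀ x → ¬ Preperiodic x → ∣ ↥ x ∣ ≢ ∣ ↧ x ∣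
∣↥∣≢∣↧∣ x wandering e = roots x wandering
  (Coprimality.0-coprimeTo-m⇒m≡1 {∣ ↧ x ∣} λ (_ , d∣↧) → coprime-↥↧ x (subst (_ ℕ.∣_) (sym e) d∣↧ , d∣↧)) e
  where
  roots : ∀ x → ¬ Preperiodic x → ∣ ↧ x ∣ ≡ 1 → ∣ ↥ x ∣ ≡ ∣ ↧ x ∣ → ⊥
  roots (mkℚ (+ .1) .0 _)    wandering refl refl = wandering (1 , 2 , (λ ()) , refl)
  roots (mkℚ -[1+ .0 ] .0 _) wandering refl refl = wandering (1 , 2 , (λ ()) , refl)

log₂-bounds : ∀ n → 0 < n → ∃ λ σ → 2 ^ σ ≤ n × n < 2 ^ suc σ
log₂-bounds (suc zero) _ = 0 , s≤s z≤n , s≤s (s≤s z≤n)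
log₂-bounds (suc (suc n)) _ with log₂-bounds (suc n) (s≤s z≤n)
... | σ , lo , hi with m≤n⇒m<n∨m≡n hi
...   | inj₁ lt = σ , m≤n⇒m≤1+n lo , lt
...   | inj₂ eq = suc σ , ≤-reflexive (sym eq) , subst (_< 2 ^ suc (suc σ)) (sym eq) (^-monoʳ-< 2 (s≤s (s≤s z≤n)) (n<1+n (suc σ)))

theorem8p3 : (S : PlaceSet) (α β : ℚ) → ¬ Preperiodic α → ¬ Preperiodic β →
    (ns : List ℕ) → Unique ns → All (λ n → SIntegral S (φ^ n α) β) ns →
    length ns ≤ bound (card S)
theorem8p3 S α β α-wandering β-wandering ns unique integral = proof (log₂-bounds (card S) (s≤s z≤n))
  where
  open PlaceSet S
  ξ : ℕ → ℤ
  ξ = Orbit.ξ (↥ α) (↧ α) (↥ β) (↧ β) (coprime-↥↧ α) (coprime-↥↧ β)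
  ξ≡ : ∀ n → ↥ (φ^ n α) ℤ.* ↧ β ℤ.- ↥ β ℤ.* ↧ (φ^ n α) ≡ ξ n
  ξ≡ n = cong₂ (λ x y → x ℤ.* ↧ β ℤ.- ↥ β ℤ.* y) (↥-φ^ n α) (↧-φ^ n α)
  proof : (∃ λ σ → 2 ^ σ ≤ card S × card S < 2 ^ suc σ) → length ns ≤ bound (card S)
  proof (σ , lo , hi) = begin
    length ns
      ≤⟨ O.atMost-supported unique (All.map supported integral) ⟩
    -- One for n = 0, two bad indices, the middle interval with τ = σ + 1 and E = 3 (σ + 2) + 12,
    -- and three for each finite place.
    1 + (2 + (suc σ + 2 + (suc (suc σ) + (suc (suc σ) + (suc (suc σ) + 12))) + length finitePlaces * 3))
      ≡⟨ alg σ (length finitePlaces) ⟩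
    3 * card S + 4 * σ + 21
      ≤⟨ +-mono-≤ (+-monoʳ-≤ (3 * card S) (≤-trans (*-monoˡ-≤ σ (m≤m+n 4 8)) 12σ≤)) (m≤m+n 21 29) ⟩
    bound (card S) ∎
    where
    open ≤-Reasoning
    module O = Orbits (↥ α) (↧ α) (↥ β) (↧ β) (coprime-↥↧ α) (coprime-↥↧ β)
      (↥≢0 α α-wandering) (↧≢0 α) (↥≢0 β β-wandering) (↧≢0 β) (∣↥∣≢∣↧∣ α α-wandering) (∣↥∣≢∣↧∣ β β-wandering)
      finitePlaces allPrime σ (<-trans (n<1+n _) hi)
    alg : ∀ σ l → 1 + (2 + (suc σ + 2 + (suc (suc σ) + (suc (suc σ) + (suc (suc σ) + 12))) + l * 3)) ≡ 3 * suc l + 4 * σ + 21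
    alg = solve-∀
    12σ≤ : 12 * σ ≤ ⌊log₂ (card S ^ 12) ⌋
    12σ≤ = subst (_≤ ⌊log₂ (card S ^ 12) ⌋) (trans (cong ⌊log₂_⌋ (^-*-assoc 2 σ 12)) (trans (⌊log₂[2^n]⌋≡n (σ * 12)) (*-comm σ 12)))
      (⌊log₂⌋-mono-≤ (^-monoˡ-≤ 12 lo))
    supported : ∀ {n} → SIntegral S (φ^ n α) β → O.Supported n
    supported {n} integral p p-prime p∣ξ with p ∈? finitePlaces
    ... | yes p∈ = p∈
    ... | no p∉ = ⊥-elim (integral p p-prime p∉ (subst (λ x → p ℕ.∣ ∣ x ∣) (sym (ξ≡ n)) p∣ξ))
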